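{- Let $\mu\in(0,1)$ be a constant. Suppose there exists an algorithm that, given any straight-line grammar (SLG) $G=(V,\Sigma,R,S)$ generating a string $T\in\Sigma^{N}$, where $\Sigma=\{1,\ldots,\sigma\}$ and $\sigma=\Omega(N^{\mu/3})$, computes an $\lfloor N^{1-\mu}\rfloor$-additive approximation of (each query in) any batch of $m$ two-sided rank queries on $T$ in $O((|G|+m)\log^{O(1)}N)$ total time. Then the Boolean matrix product of any two $n\times n$ Boolean matrices can be computed in $O(n^2\log^{O(1)}n)$ time.
   Context: **Model and asymptotics.** Running times are in the standard word RAM model with machine words of $\Theta(\log n)$ bits ($n$ the input-size parameter), where standard arithmetic and bitwise operations take $O(1)$ time. $\log^{O(1)}N$ means $(\log N)^c$ for some constant $c$. The condition $\sigma=\Omega(N^{\mu/3})$ restricts the inputs the algorithm must handle to those with $\sigma\ge\kappa N^{\mu/3}$ for a fixed constant $\kappa>0$. **Straight-line grammars.** An SLG is a context-free grammar $G=(V,\Sigma,R,S)$ (nonterminals $V$, terminals $\Sigma$, $V\cap\Sigma=\emptyset$, rules $R\subseteq V\times(V\cup\Sigma)^*$, start symbol $S\in V$) such that each $N\in V$ has exactly one rule $(N,\gamma)\in R$, whose right-hand side $\gamma$ is denoted $\mathrm{rhs}_G(N)$, and there is an ordering $N_1,\ldots,N_{|V|}$ of $V$ with $\mathrm{rhs}_G(N_i)\in(\{N_{i+1},\ldots,N_{|V|}\}\cup\Sigma)^*$ for all $i$. Hence $G$ generates exactly one string. The size of $G$ is $|G|=\sum_{N\in V}\max(|\mathrm{rhs}_G(N)|,1)$.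 **Two-sided rank query.** Strings are indexed from $1$. For $T\in\Sigma^N$, $b,e\in\{0,\ldots,N\}$ and $c\in\Sigma$, the query asks for $\mathrm{rank}_T(b,e,c)=|\{i: b<i\le e,\ T[i]=c\}|$. **Additive approximation.** For an integer $k\ge1$, an integer $x$ is a $k$-additive approximation of $\mathrm{rank}_T(b,e,c)$ if $\mathrm{rank}_T(b,e,c)-k<x<\mathrm{rank}_T(b,e,c)+k$. **Boolean matrix product.** For $A,B\in\{0,1\}^{n\times n}$, $(AB)[i,j]=\bigvee_{k=1}^n A[i,k]\wedge B[k,j]$. -}

module Defs where

open import Data.Bool.Base using (Bool; true; false; if_then_else_; _∧_; _∨_; _xor_)
open import Data.Fin.Base as Fin using (Fin; toℕ)
import Data.Fin.Properties as Finₚ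
open import Data.Fin.Permutation using (Permutation′; _⟨$⟩ʳ_)
open import Data.Integer.Base as ℤ using (ℤ; +_)
open import Data.List.Base as List using (List; []; _∷_; _++_; length; allFin)
open import Data.List.Membership.Propositional using (_∈_)
open import Data.Nat.Base
open import Data.Nat.DivMod using (_/_; _%_)
open import Data.Nat.ListAction using (sum)
open import Data.Nat.Logarithm using (⌊log₂_⌋)
open import Data.Nat.Properties using (m^n≢0; _<?_; _≤?_)
open import Data.Product.Base using (∃; _×_; _,_; ∃-syntax; Σ-syntax)
open import Data.Rational.Base as ℚ using (ℚ; 0ℚ; 1ℚ)
import Data.Rational.Properties as ℚₚ
open import Data.Sum.Base using (_⊎_; inj₁; inj₂)
open import Data.Vec.Base as Vec using (Vec; lookup; toList)
import Data.Vec.Functional as Vector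
open import Function.Base using (_∘_)
open import Function.Bundles using (_⇔_; mk⇔; Equivalence)
open import Relation.Binary.Construct.Closure.ReflexiveTransitive using (Star)
open import Relation.Binary.PropositionalEquality
  using (_≡_; _≢_; sym; trans; cong; subst)
open import Relation.Nullary using (¬_)
open import Relation.Nullary.Decidable using (_×-dec_)

------------------------------------------------------------------------
-- Real numbers as located two-sided Dedekind cuts

record ℝ : Set₁ where
  field
    below : ℚ → Set          -- below q : q is strictly less than the number
    above : ℚ → Set          -- above q : q is strictly greater
    inhabitedˡ : ∃ below
    inhabitedʳ : ∃ above
    roundedˡ   : ∀ q → below q ⇔ (∃[ r ] (q ℚ.< r × below r))
    roundedʳ   : ∀ q → above q ⇔ (∃[ r ] (r ℚ.< q × above r))
    disjoint   : ∀ q → ¬ (below q × above q)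
    located    : ∀ q r → q ℚ.< r → below q ⊎ above r

open ℝ public using (below; above)

infix 4 _<ᴿ_ _ᴿ<_

_<ᴿ_ : ℚ → ℝ → Set
q <ᴿ x = below x q

_ᴿ<_ : ℝ → ℚ → Set
x ᴿ< q = above x q

private
  1-_ : ℚ → ℚ
  1- q = 1ℚ ℚ.- q

  1-anti : ∀ {q r} → q ℚ.< r → 1- r ℚ.< 1- q
  1-anti q<r = ℚₚ.+-monoʳ-< 1ℚ (ℚₚ.neg-antimono-< q<r)

  1-invol : ∀ q → 1- (1- q) ≡ q
  1-invol q =
    trans (cong (λ z → 1ℚ ℚ.+ z)
             (trans (ℚₚ.neg-distrib-+ 1ℚ (ℚ.- q))
                    (cong (λ z → ℚ.- 1ℚ ℚ.+ z) (neg-neg q))))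
    (trans (sym (ℚₚ.+-assoc 1ℚ (ℚ.- 1ℚ) q)) (ℚₚ.+-identityˡ q))
    where
    open import Algebra.Properties.Group ℚₚ.+-0-group
      using () renaming (⁻¹-involutive to neg-neg)

  3ℚ ⅓ : ℚ
  3ℚ = + 3 ℚ./ 1
  ⅓  = + 1 ℚ./ 3

  3*⅓* : ∀ q → 3ℚ ℚ.* (⅓ ℚ.* q) ≡ q
  3*⅓* q = trans (sym (ℚₚ.*-assoc 3ℚ ⅓ q)) (ℚₚ.*-identityˡ q)

  3*-mono : ∀ {q r} → q ℚ.< r → 3ℚ ℚ.* q ℚ.< 3ℚ ℚ.* r
  3*-mono = ℚₚ.*-monoʳ-<-pos 3ℚ

  3*-adjˡ : ∀ {q s} → 3ℚ ℚ.* q ℚ.< s → q ℚ.< ⅓ ℚ.* s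
  3*-adjˡ {q} {s} h =
    ℚₚ.*-cancelˡ-<-nonNeg 3ℚ (subst (3ℚ ℚ.* q ℚ.<_) (sym (3*⅓* s)) h)

  3*-adjʳ : ∀ {q s} → s ℚ.< 3ℚ ℚ.* q → ⅓ ℚ.* s ℚ.< q
  3*-adjʳ {q} {s} h =
    ℚₚ.*-cancelˡ-<-nonNeg 3ℚ (subst (ℚ._< 3ℚ ℚ.* q) (sym (3*⅓* s)) h)

1ᴿ-_ : ℝ → ℝ
1ᴿ- x = record
  { below = λ q → above x (1- q)
  ; above = λ q → below x (1- q)
  ; inhabitedˡ = let (q , h) = inhabitedʳ in 1- q , subst (above x) (sym (1-invol q)) h
  ; inhabitedʳ = let (q , h) = inhabitedˡ in 1- q , subst (below x) (sym (1-invol q)) h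
  ; roundedˡ = λ q → mk⇔
      (λ h → let (s , s<1-q , hs) = Equivalence.to (roundedʳ (1- q)) h in
         1- s , subst (ℚ._< 1- s) (1-invol q) (1-anti s<1-q)
              , subst (above x) (sym (1-invol s)) hs)
      (λ (r , q<r , hr) → Equivalence.from (roundedʳ (1- q)) (1- r , 1-anti q<r , hr))
  ; roundedʳ = λ q → mk⇔
      (λ h → let (s , 1-q<s , hs) = Equivalence.to (roundedˡ (1- q)) h in
         1- s , subst (1- s ℚ.<_) (1-invol q) (1-anti 1-q<s)
              , subst (below x) (sym (1-invol s)) hs)
      (λ (r , r<q , hr) → Equivalence.from (roundedˡ (1- q)) (1- r , 1-anti r<q , hr))
  ; disjoint = λ q (a , b) → disjoint (1- q) (b , a)
  ; located = λ q r q<r → swap (located (1- r) (1- q) (1-anti q<r))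
  }
  where
  open ℝ x hiding (below; above)
  swap : ∀ {A B : Set} → A ⊎ B → B ⊎ A
  swap (inj₁ a) = inj₂ a
  swap (inj₂ b) = inj₁ b

_/3 : ℝ → ℝ
x /3 = record
  { below = λ q → below x (3ℚ ℚ.* q)
  ; above = λ q → above x (3ℚ ℚ.* q)
  ; inhabitedˡ = let (q , h) = inhabitedˡ in ⅓ ℚ.* q , subst (below x) (sym (3*⅓* q)) h
  ; inhabitedʳ = let (q , h) = inhabitedʳ in ⅓ ℚ.* q , subst (above x) (sym (3*⅓* q)) h
  ; roundedˡ = λ q → mk⇔
      (λ h → let (s , l , hs) = Equivalence.to (roundedˡ (3ℚ ℚ.* q)) h in
         ⅓ ℚ.* s , 3*-adjˡ l , subst (below x) (sym (3*⅓* s)) hs)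
      (λ (r , l , hr) → Equivalence.from (roundedˡ (3ℚ ℚ.* q)) (3ℚ ℚ.* r , 3*-mono l , hr))
  ; roundedʳ = λ q → mk⇔
      (λ h → let (s , l , hs) = Equivalence.to (roundedʳ (3ℚ ℚ.* q)) h in
         ⅓ ℚ.* s , 3*-adjʳ l , subst (above x) (sym (3*⅓* s)) hs)
      (λ (r , l , hr) → Equivalence.from (roundedʳ (3ℚ ℚ.* q)) (3ℚ ℚ.* r , 3*-mono l , hr))
  ; disjoint = λ q → disjoint (3ℚ ℚ.* q)
  ; located = λ q r q<r → located (3ℚ ℚ.* q) (3ℚ ℚ.* r) (3*-mono q<r)
  }
  where open ℝ x hiding (below; above)

-- Comparisons with a real power N^α, for N ≥ 1 and α > 0 (not meaningful
-- otherwise).  As p/q ranges over the rationals on one side of α, N^(p/q)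
-- approximates N^α from that side, and N^(p/q) compares with a like N^p with a^q.
-- Denominators are written suc q.

_≤_^ᴿ_ : ℕ → ℕ → ℝ → Set
a ≤ N ^ᴿ α = ∀ p q → α ᴿ< (+ p ℚ./ suc q) → a ^ suc q ≤ N ^ p

_^ᴿ_<_ : ℕ → ℝ → ℕ → Set
N ^ᴿ α < a = ∃[ p ] ∃[ q ] (α ᴿ< (+ p ℚ./ suc q) × N ^ p < a ^ suc q)

⌊_^ᴿ_⌋≡_ : ℕ → ℝ → ℕ → Set
⌊ N ^ᴿ α ⌋≡ k = k ≤ N ^ᴿ α × N ^ᴿ α < suc k

-- κ · N^α ≤ s for κ > 0 : (a/b) · N^(p/q) ≤ s whenever a/b < κ and p/q < α.
_·_^ᴿ_≤_ : ℝ → ℕ → ℝ → ℕ → Set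
κ · N ^ᴿ α ≤ s =
  ∀ a b p q → (+ a ℚ./ suc b) <ᴿ κ → (+ p ℚ./ suc q) <ᴿ α →
  a ^ suc q * N ^ p ≤ (suc b * s) ^ suc q

------------------------------------------------------------------------
-- Word RAM with words of w bits
--
-- A word is a natural number below 2 ^ w; words are also the addresses.
-- A program uses finitely many registers and has structured control flow;
-- every primitive instruction and every test costs one time unit.

data Op : Set where
  add sub mul div mod and or xor shl shr lt eq : Op

data Prog : Set where
  const : (r k : ℕ) → Prog                          -- r ← k
  op    : Op → (r r₁ r₂ : ℕ) → Prog                 -- r ← r₁ ∙ r₂
  load  : (r a : ℕ) → Prog                          -- r ← mem[a]
  store : (a r : ℕ) → Prog                          -- mem[a] ← r
  _⨾_   : Prog → Prog → Prog
  ifnz  : (r : ℕ) → Prog → Prog → Prog              -- if r ≠ 0 then _ else _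
  while : (r : ℕ) → Prog → Prog                     -- while r ≠ 0 do _

infixr 5 _⨾_

record State : Set where
  constructor state
  field
    reg : ℕ → ℕ
    mem : ℕ → ℕ

open State public

_[_↦_] : (ℕ → ℕ) → ℕ → ℕ → (ℕ → ℕ)
(f [ i ↦ x ]) j = if i ≡ᵇ j then x else f j

bit : Bool → ℕ
bit true  = 1
bit false = 0

bitwise : (Bool → Bool → Bool) → ℕ → ℕ → ℕ → ℕ
bitwise f zero    x y = 0
bitwise f (suc w) x y =
  bit (f (x % 2 ≡ᵇ 1) (y % 2 ≡ᵇ 1)) + 2 * bitwise f w (x / 2) (y / 2)

module WordRAM (w : ℕ) where

  wrap : ℕ → ℕ
  wrap x = _%_ x (2 ^ w) {{m^n≢0 2 w}}

  -- Division and remainder by zero give 0.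
  ⟦_⟧ : Op → ℕ → ℕ → ℕ
  ⟦ add ⟧ x y       = wrap (x + y)
  ⟦ sub ⟧ x y       = wrap (x + (2 ^ w ∸ y))
  ⟦ mul ⟧ x y       = wrap (x * y)
  ⟦ div ⟧ x zero    = 0
  ⟦ div ⟧ x (suc y) = x / suc y
  ⟦ mod ⟧ x zero    = 0
  ⟦ mod ⟧ x (suc y) = x % suc y
  ⟦ and ⟧ x y       = bitwise _∧_ w x y
  ⟦ or  ⟧ x y       = bitwise _∨_ w x y
  ⟦ xor ⟧ x y       = bitwise _xor_ w x y
  ⟦ shl ⟧ x y       = wrap (x * 2 ^ y)
  ⟦ shr ⟧ x y       = _/_ x (2 ^ y) {{m^n≢0 2 y}}
  ⟦ lt  ⟧ x y       = wrap (bit (x <ᵇ y))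
  ⟦ eq  ⟧ x y       = wrap (bit (x ≡ᵇ y))

  -- Exec P s t s′ : started in s, P halts in s′ after exactly t time units.
  data Exec : Prog → State → ℕ → State → Set where
    const : ∀ {ρ M r k} →
            Exec (const r k) (state ρ M) 1 (state (ρ [ r ↦ wrap k ]) M)
    op    : ∀ {ρ M ∙ r r₁ r₂} →
            Exec (op ∙ r r₁ r₂) (state ρ M) 1
                 (state (ρ [ r ↦ ⟦ ∙ ⟧ (ρ r₁) (ρ r₂) ]) M)
    load  : ∀ {ρ M r a} →
            Exec (load r a) (state ρ M) 1 (state (ρ [ r ↦ M (ρ a) ]) M)
    store : ∀ {ρ M a r} →
            Exec (store a r) (state ρ M) 1 (state ρ (M [ ρ a ↦ ρ r ]))
    seq   : ∀ {P Q s s′ s″ t u} →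
            Exec P s t s′ → Exec Q s′ u s″ → Exec (P ⨾ Q) s (t + u) s″
    then′ : ∀ {r P Q s s′ t} → reg s r ≢ 0 →
            Exec P s t s′ → Exec (ifnz r P Q) s (suc t) s′
    else′ : ∀ {r P Q s s′ t} → reg s r ≡ 0 →
            Exec Q s t s′ → Exec (ifnz r P Q) s (suc t) s′
    loop  : ∀ {r P s s′ s″ t u} → reg s r ≢ 0 →
            Exec P s t s′ → Exec (while r P) s′ u s″ →
            Exec (while r P) s (suc (t + u)) s″
    exit  : ∀ {r P s} → reg s r ≡ 0 → Exec (while r P) s 1 s

  cell : List ℕ → ℕ → ℕ
  cell []       _       = 0
  cell (x ∷ _)  zero    = x
  cell (_ ∷ xs) (suc i) = cell xs i

  -- The input occupies the memory cells 0, 1, 2, …; everything else is 0.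
  initial : List ℕ → State
  initial input = state (λ _ → 0) (wrap ∘ cell input)

  -- Run P input t out : P halts on the input after t time units, with the
  -- memory contents out.
  Run : Prog → List ℕ → ℕ → (ℕ → ℕ) → Set
  Run P input t out = ∃[ ρ ] Exec P (initial input) t (state ρ out)

  -- Two's complement reading of a word.
  signed : ℕ → ℤ
  signed x = if 2 * x <ᵇ 2 ^ w then + x else x ℤ.⊖ 2 ^ w

open WordRAM using (Run; signed) public

-- 1 + ⌊log₂ n⌋, used for log n so that it does not vanish at n = 1.
bits : ℕ → ℕ
bits n = suc ⌊log₂ n ⌋

------------------------------------------------------------------------
-- Straight-line grammars over the alphabet Σ = {1, …, σ}
--
-- The letter a : Fin σ stands for suc (toℕ a).

data Symbol (V σ : ℕ) : Set where
  nonterminal : Fin V → Symbol V σ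
  terminal    : Fin σ → Symbol V σ

record SLG (σ : ℕ) : Set where
  field
    ∣V∣   : ℕ
    rhs   : Fin ∣V∣ → List (Symbol ∣V∣ σ)
    start : Fin ∣V∣
    order : Permutation′ ∣V∣
    acyclic : ∀ i j →
      nonterminal (order ⟨$⟩ʳ j) ∈ rhs (order ⟨$⟩ʳ i) → i Fin.< j

module _ {σ : ℕ} (G : SLG σ) where
  open SLG G

  data _⟶_ : List (Symbol ∣V∣ σ) → List (Symbol ∣V∣ σ) → Set where
    rewrite-at : ∀ α X β → (α ++ nonterminal X ∷ β) ⟶ (α ++ rhs X ++ β)

  Generates : ∀ {N} → Vec (Fin σ) N → Set
  Generates T = Star _⟶_ (nonterminal start ∷ []) (List.map terminal (toList T))

  grammarSize : ℕ
  grammarSize = sum (List.map (λ X → length (rhs X) ⊔ 1) (allFin ∣V∣))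

------------------------------------------------------------------------
-- Two-sided rank queries

record Query (N σ : ℕ) : Set where
  constructor query
  field
    b e : Fin (suc N)
    c   : Fin σ

-- Position i : Fin N stands for suc (toℕ i).
rank : ∀ {N σ} → Vec (Fin σ) N → Query N σ → ℕ
rank {N} T (query b e c) =
  length (List.filter
    (λ i → (toℕ b <? suc (toℕ i)) ×-dec (suc (toℕ i) ≤? toℕ e)
             ×-dec (lookup T i Finₚ.≟ c))
    (allFin N))

AdditiveApprox : (k : ℕ) (exact : ℕ) (x : ℤ) → Set
AdditiveApprox k r x = (+ r ℤ.- + k ℤ.< x) × (x ℤ.< + r ℤ.+ + k)

-- Terminals are written as 1, …, σ and nonterminals as σ + 1, …, σ + |V|.
-- After the header |V|, σ, m, S come the right-hand sides, each preceded by
-- its length, and then the queries.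
encodeRank : ∀ {σ N m} → SLG σ → Vec (Query N σ) m → List ℕ
encodeRank {σ} {m = m} G Q =
  ∣V∣ ∷ σ ∷ m ∷ code (nonterminal start) ∷
  List.concatMap (λ X → length (rhs X) ∷ List.map code (rhs X)) (allFin ∣V∣) ++
  List.concatMap (λ (query b e c) → toℕ b ∷ toℕ e ∷ suc (toℕ c) ∷ []) (toList Q)
  where
  open SLG G
  code : Symbol ∣V∣ σ → ℕ
  code (nonterminal X) = suc (σ + toℕ X)
  code (terminal a)    = suc (toℕ a)

-- The words have Θ(log (|G| + σ + m + N)) bits, so that every number and
-- address of the input fits.  N ≥ 1 ensures that ⌊N^(1-μ)⌋ ≥ 1.  The floor is
-- a relation because it is not computable from a real μ.
-- Answer i is left in memory cell i.
ApproxRankAlgorithm : (μ κ : ℝ) → Set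
ApproxRankAlgorithm μ κ =
  Σ[ P ∈ Prog ] ∃[ c ] ∃[ C ] ∃[ d ]
    1 ≤ c ×
    (∀ {σ N m} (G : SLG σ) (T : Vec (Fin σ) N) (Q : Vec (Query N σ) m) →
     Generates G T → 1 ≤ N → κ · N ^ᴿ (μ /3) ≤ σ →
     let w = c * bits (grammarSize G + σ + m + N) in
     ∃[ t ] ∃[ out ]
       Run w P (encodeRank G Q) t out ×
       t ≤ C * ((grammarSize G + m) * bits N ^ d) ×
       (∀ (i : Fin m) k → ⌊ N ^ᴿ (1ᴿ- μ) ⌋≡ k →
        AdditiveApprox k (rank T (lookup Q i)) (signed w (out (toℕ i)))))

------------------------------------------------------------------------
-- Boolean matrix multiplication

BoolMatrix : ℕ → Set
BoolMatrix n = Fin n → Fin n → Bool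

_⊗_ : ∀ {n} → BoolMatrix n → BoolMatrix n → BoolMatrix n
(A ⊗ B) i j = Vector.foldr _∨_ false (λ k → A i k ∧ B k j)

-- Row by row, one entry per word.
entries : ∀ {n} → BoolMatrix n → List ℕ
entries {n} A = List.concatMap (λ i → List.map (λ j → bit (A i j)) (allFin n)) (allFin n)

encodeMatrices : ∀ {n} → BoolMatrix n → BoolMatrix n → List ℕ
encodeMatrices {n} A B = n ∷ entries A ++ entries B

-- The product is left in the memory cells 0, …, n² - 1, row by row.
FastBooleanMatrixProduct : Set
FastBooleanMatrixProduct =
  Σ[ P ∈ Prog ] ∃[ c ] ∃[ C ] ∃[ d ]
    1 ≤ c ×
    (∀ {n} (A B : BoolMatrix n) → 1 ≤ n →
     let w = c * bits n in
     ∃[ t ] ∃[ out ]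
       Run w P (encodeMatrices A B) t out ×
       t ≤ C * (n ^ 2 * bits n ^ d) ×
       (∀ (i j : Fin n) → out (n * toℕ i + toℕ j) ≡ bit ((A ⊗ B) i j)))

{-# OPTIONS --safe #-}
-- Row i of A becomes the concatenation, over k, of row k of B written as a string (the
-- letter j for B[k,j] = 1, a padding letter for 0) if A[i,k] = 1, and of padding otherwise.
-- In it the letter j occurs once for each k with A[i,k] = B[k,j] = 1.  All these strings
-- have length n², so their positions are known, and repeating each of them R = 2^r times
-- costs only r rules: a grammar of size O(n² + n log n) generates a string of length
-- N = n³R in which n² rank queries have answers that are 0 or at least R.  As R is a
-- power of n with a large exponent, R ≥ 2 N^(1-μ), so the approximations tell these apart.
--
-- The alphabet size σ is a free parameter.  It is chosen as a power of two that dominates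
-- all other quantities; this meets σ = Ω(N^(μ/3)) and makes the word length of the assumed
-- algorithm an exact constant multiple of bits n, so the algorithm can be run as it is.
--
-- ⌊N^(1-μ)⌋ need not exist constructively; it exists up to double negation, which
-- is enough because equality of the computed bits is decidable.

module Submission where

open import Defs
open import Data.Bool.Base using (Bool; true; false; if_then_else_; _∧_; _∨_; _xor_; T)
open import Data.Empty using (⊥; ⊥-elim)
open import Data.Fin.Base as Fin using (Fin; toℕ)
open import Data.Fin.Permutation as Permutation using ()
import Data.Fin.Properties as Finₚ
open import Data.Integer.Base as ℤ using (ℤ; -[1+_]) renaming (+_ to pos)
import Data.Integer.Properties as ℤₚ
open import Data.List.Base as List using (List; []; _∷_; _++_; length; allFin; tabulate; filter; applyUpTo; concatMap)
open import Data.List.Membership.Propositional using (_∈_)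
open import Data.List.Membership.Propositional.Properties using (∈-++⁺ˡ; ∈-++⁺ʳ; ∈-map⁻; ∈-applyUpTo⁺)
open import Data.List.Properties hiding (sum-++)
open import Data.List.Relation.Unary.All as All using (All; []; _∷_)
import Data.List.Relation.Unary.All.Properties as Allₚ
open import Data.List.Relation.Unary.Any using (here; there)
open import Data.Nat.Base
open import Data.Nat.DivMod hiding (_div_; result) renaming (_mod_ to _modulo_)
open import Data.Nat.ListAction using (sum)
open import Data.Nat.ListAction.Properties using (sum-++)
open import Data.Nat.Logarithm
open import Data.Nat.Properties
open import Data.Nat.Solver using (module +-*-Solver)
open import Data.Product.Base using (_×_; _,_; proj₁; proj₂; ∃-syntax)
open import Data.Rational.Base as ℚ using (ℚ; mkℚ; 0ℚ; 1ℚ)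
import Data.Rational.Properties as ℚₚ
open import Data.Rational.Unnormalised.Base as ℚᵘ using (mkℚᵘ; 1ℚᵘ; *≤*; *<*)
import Data.Rational.Unnormalised.Properties as ℚᵘₚ
open import Data.Sum.Base using (_⊎_; inj₁; inj₂)
open import Data.Unit.Base using (⊤; tt)
open import Data.Vec.Base as Vec using (Vec; []; _∷_; lookup; toList; fromList)
import Data.Vec.Functional as Vector
import Data.Vec.Properties as Vecₚ
open import Function.Base using (_∘_)
open import Function.Bundles using (_⇔_; mk⇔; Equivalence)
open import Relation.Binary.Construct.Closure.ReflexiveTransitive as Star using (Star; ε; _◅_; _◅◅_)
open import Relation.Binary.PropositionalEquality
open import Relation.Nullary using (¬_; yes; no; Dec)
open import Relation.Nullary.Decidable using (_×-dec_; decidable-stable)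

open +-*-Solver using (solve; _:=_; _:+_; _:*_; con)

-- The obstacle on the machine side is that the assumed program is known to work only from its exact
-- initial state: its input from cell 0 on, zeros in all later cells, zeros in all registers, and a
-- word length dictated by the numbers in its input. Hence the construction may leave no scratch
-- data behind. It computes the length of the query input beforehand, writes that input in place
-- over the matrices with no other memory, and keeps its own values in a few registers that the
-- called program never sees. On the quantitative side μ is accessible only through rationals on
-- either side of it. One rational 1/(1+q) below μ is fixed. It determines an exponent `e` such that
-- the additive error is at most `repeats` = 2^(b e), where b is the bit length of n. Each row
-- string is then repeated not `repeats` but 2 · `repeats` times. An approximation of 0 stays below
-- `repeats`, and one of any positive answer stays above it, so a single threshold decides every
-- entry.

-- Word RAM: bounded words, relocated programs, Hoare triples

bit≤1 : ∀ b → bit b ≤ 1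
bit≤1 true  = ≤-refl
bit≤1 false = z≤n

bitwise-bound : ∀ f w x y → bitwise f w x y < 2 ^ w
bitwise-bound f zero    x y = s≤s z≤n
bitwise-bound f (suc w) x y = begin
  suc (bit c + 2 * r)  ≤⟨ s≤s (+-monoˡ-≤ (2 * r) (bit≤1 c)) ⟩
  2 + 2 * r            ≡⟨ sym (*-suc 2 r) ⟩
  2 * suc r            ≤⟨ *-monoʳ-≤ 2 (bitwise-bound f w (x / 2) (y / 2)) ⟩
  2 * 2 ^ w            ∎
  where
  open ≤-Reasoning
  r = bitwise f w (x / 2) (y / 2)
  c = f (x % 2 ≡ᵇ 1) (y % 2 ≡ᵇ 1)

update-elim : (P : ℕ → Set) (f : ℕ → ℕ) (a : ℕ) {x : ℕ} → P x → (∀ j → P (f j)) → ∀ j → P ((f [ a ↦ x ]) j)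
update-elim P f a px pf j with a ≡ᵇ j
... | true  = px
... | false = pf j

update-same : ∀ f a x → (f [ a ↦ x ]) a ≡ x
update-same f a x with a ≡ᵇ a in eq
... | true  = refl
... | false = ⊥-elim (subst T eq (≡⇒≡ᵇ a a refl))

update-other : ∀ f a {j} x → a ≢ j → (f [ a ↦ x ]) j ≡ f j
update-other f a {j} x a≢j with a ≡ᵇ j in eq
... | true  = ⊥-elim (a≢j (≡ᵇ⇒≡ a j (subst T (sym eq) tt)))
... | false = refl

update-cong : ∀ {f g} → f ≗ g → ∀ {a b x y} → a ≡ b → x ≡ y → (f [ a ↦ x ]) ≗ (g [ b ↦ y ])
update-cong f≗g {a} refl refl j with a ≡ᵇ j
... | true  = refl
... | false = f≗g j

-- The assumed algorithm runs as a subroutine on the registers from 20 on, so that the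
-- registers below 20 survive the call.
shift : Prog → Prog
shift (const r k)    = const (20 + r) k
shift (op ∙ r r₁ r₂) = op ∙ (20 + r) (20 + r₁) (20 + r₂)
shift (load r a)     = load (20 + r) (20 + a)
shift (store a r)    = store (20 + a) (20 + r)
shift (P ⨾ Q)        = shift P ⨾ shift Q
shift (ifnz r P Q)   = ifnz (20 + r) (shift P) (shift Q)
shift (while r P)    = while (20 + r) (shift P)

-- Memories are compared pointwise, since the memory that the construction leaves is known only cell
-- by cell to agree with `initial`.
_≈_ : State → State → Set
s ≈ s₀ = (∀ i → reg s (20 + i) ≡ reg s₀ i) × mem s ≗ mem s₀

SameLow : State → State → Set
SameLow s s′ = ∀ i → i < 20 → reg s′ i ≡ reg s i

update-low : ∀ f r x i → i < 20 → (f [ 20 + r ↦ x ]) i ≡ f i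
update-low f r x i i<20 = update-other f (20 + r) x λ { refl → <⇒≱ i<20 (m≤m+n 20 r) }

Straight : Prog → Set
Straight (P ⨾ Q)      = Straight P × Straight Q
Straight (ifnz _ _ _) = ⊥
Straight (while _ _)  = ⊥
Straight _            = ⊤

module RAM (w : ℕ) where
  open WordRAM w public hiding (Run; signed)

  private instance
    2^w≢0 : NonZero (2 ^ w)
    2^w≢0 = m^n≢0 2 w

  wrap-< : ∀ x → wrap x < 2 ^ w
  wrap-< x = m%n<n x (2 ^ w)

  wrap-id : ∀ {x} → x < 2 ^ w → wrap x ≡ x
  wrap-id = m<n⇒m%n≡m

  op-bound : ∀ ∙ {x} y → x < 2 ^ w → ⟦ ∙ ⟧ x y < 2 ^ w
  op-bound add     y       x< = wrap-< _
  op-bound sub     y       x< = wrap-< _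
  op-bound mul     y       x< = wrap-< _
  op-bound div     zero    x< = m^n>0 2 w
  op-bound div {x} (suc y) x< = ≤-<-trans (m/n≤m x (suc y)) x<
  op-bound mod     zero    x< = m^n>0 2 w
  op-bound mod {x} (suc y) x< = ≤-<-trans (m%n≤m x (suc y)) x<
  op-bound and     y       x< = bitwise-bound _∧_ w _ y
  op-bound or      y       x< = bitwise-bound _∨_ w _ y
  op-bound xor     y       x< = bitwise-bound _xor_ w _ y
  op-bound shl     y       x< = wrap-< _
  op-bound shr {x} y       x< = ≤-<-trans (m/n≤m x (2 ^ y) {{m^n≢0 2 y}}) x<
  op-bound lt      y       x< = wrap-< _
  op-bound eq      y       x< = wrap-< _

  Bounded : State → Set
  Bounded s = (∀ i → reg s i < 2 ^ w) × (∀ a → mem s a < 2 ^ w)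

  -- Needed on both sides of the call: the list built in memory consists of words, so the `wrap` in
  -- `initial` leaves it unchanged, and the answers of the called program are words, so their two's
  -- complement reading makes sense.
  exec-bounded : ∀ {P s t s′} → Exec P s t s′ → Bounded s → Bounded s′
  exec-bounded (const {ρ} {r = r}) (ρ< , M<) = update-elim (_< 2 ^ w) ρ r (wrap-< _) ρ< , M<
  exec-bounded (op {ρ} {∙ = ∙} {r}) (ρ< , M<) = update-elim (_< 2 ^ w) ρ r (op-bound ∙ _ (ρ< _)) ρ< , M<
  exec-bounded (load {ρ} {r = r}) (ρ< , M<) = update-elim (_< 2 ^ w) ρ r (M< _) ρ< , M<
  exec-bounded (store {ρ} {M} {a}) (ρ< , M<) = ρ< , update-elim (_< 2 ^ w) M (ρ a) (ρ< _) M<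
  exec-bounded (seq p q)   b = exec-bounded q (exec-bounded p b)
  exec-bounded (then′ _ p) b = exec-bounded p b
  exec-bounded (else′ _ p) b = exec-bounded p b
  exec-bounded (loop _ p q) b = exec-bounded q (exec-bounded p b)
  exec-bounded (exit _)    b = b

  private
    update-shift : ∀ {f g : ℕ → ℕ} r {x y} → (∀ i → f (20 + i) ≡ g i) → x ≡ y →
                   ∀ i → (f [ 20 + r ↦ x ]) (20 + i) ≡ (g [ r ↦ y ]) i
    update-shift r f≈g refl i with r ≡ᵇ i
    ... | true  = refl
    ... | false = f≈g i

  -- Relocation renames registers but not addresses, so the original and the relocated run go in
  -- lockstep, with the same memory and the same time.
  shift-exec : ∀ {P s₀ t s₀′} → Exec P s₀ t s₀′ → ∀ {s} → s ≈ s₀ →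
               ∃[ s′ ] Exec (shift P) s t s′ × s′ ≈ s₀′ × SameLow s s′
  shift-exec (const {r = r}) {s} (ρ≈ , M≈) =
    _ , const , (update-shift {reg s} r ρ≈ refl , M≈) , update-low (reg s) r _
  shift-exec (op {∙ = ∙} {r} {r₁} {r₂}) {s} (ρ≈ , M≈) =
    _ , op , (update-shift {reg s} r ρ≈ (cong₂ ⟦ ∙ ⟧ (ρ≈ r₁) (ρ≈ r₂)) , M≈) , update-low (reg s) r _
  shift-exec (load {M = M} {r = r} {a}) {s} (ρ≈ , M≈) =
    _ , load , (update-shift {reg s} r ρ≈ (trans (M≈ _) (cong M (ρ≈ a))) , M≈) , update-low (reg s) r _
  shift-exec (store {a = a} {r}) (ρ≈ , M≈) =
    _ , store , (ρ≈ , update-cong M≈ (ρ≈ a) (ρ≈ r)) , λ _ _ → refl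
  shift-exec (seq p q) s≈
    with _ , p′ , s≈′ , low  ← shift-exec p s≈
    with _ , q′ , s≈″ , low′ ← shift-exec q s≈′
    = _ , seq p′ q′ , s≈″ , λ i i< → trans (low′ i i<) (low i i<)
  shift-exec (then′ {r = r} c p) s≈ with _ , p′ , s≈′ , low ← shift-exec p s≈ =
    _ , then′ (subst (_≢ 0) (sym (proj₁ s≈ r)) c) p′ , s≈′ , low
  shift-exec (else′ {r = r} c p) s≈ with _ , p′ , s≈′ , low ← shift-exec p s≈ =
    _ , else′ (trans (proj₁ s≈ r) c) p′ , s≈′ , low
  shift-exec (loop {r = r} c p q) s≈
    with _ , p′ , s≈′ , low  ← shift-exec p s≈
    with _ , q′ , s≈″ , low′ ← shift-exec q s≈′
    = _ , loop (subst (_≢ 0) (sym (proj₁ s≈ r)) c) p′ q′ , s≈″ , λ i i< → trans (low′ i i<) (low i i<)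
  shift-exec (exit {r = r} c) s≈ = _ , exit (trans (proj₁ s≈ r) c) , s≈ , λ _ _ → refl

  Assertion : Set₁
  Assertion = State → Set

  infix 2 ⟨_⟩_⟨_⟩_
  -- Hoare triple for total correctness, with a bound on the running time.
  ⟨_⟩_⟨_⟩_ : Assertion → Prog → ℕ → Assertion → Set
  ⟨ Φ ⟩ P ⟨ T ⟩ Ψ = ∀ s → Φ s → ∃[ t ] ∃[ s′ ] Exec P s t s′ × t ≤ T × Ψ s′

  infixr 3 _⟫_
  _⟫_ : ∀ {Φ Ψ Ξ P Q T U} → ⟨ Φ ⟩ P ⟨ T ⟩ Ψ → ⟨ Ψ ⟩ Q ⟨ U ⟩ Ξ → ⟨ Φ ⟩ P ⨾ Q ⟨ T + U ⟩ Ξ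
  (p ⟫ q) s φ
    with _ , s′ , p′ , t≤ , ψ ← p s φ
    with _ , s″ , q′ , u≤ , ξ ← q s′ ψ
    = _ , s″ , seq p′ q′ , +-mono-≤ t≤ u≤ , ξ

  weaken : ∀ {Φ Ψ Ξ P T} → (∀ {s} → Ψ s → Ξ s) → ⟨ Φ ⟩ P ⟨ T ⟩ Ψ → ⟨ Φ ⟩ P ⟨ T ⟩ Ξ
  weaken imp p s φ = let t , s′ , p′ , t≤ , ψ = p s φ in t , s′ , p′ , t≤ , imp ψ

  -- The index of the invariant is the number of passes left. A pass costs its test and its body;
  -- the final 1 is the failing test.
  while-rule : ∀ {r P T} (I : ℕ → Assertion) →
               (∀ x s → I (suc x) s → reg s r ≢ 0) → (∀ s → I 0 s → reg s r ≡ 0) →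
               (∀ x → ⟨ I (suc x) ⟩ P ⟨ T ⟩ I x) →
               ∀ x → ⟨ I x ⟩ while r P ⟨ x * suc T + 1 ⟩ I 0
  while-rule I nz z body zero    s i = _ , s , exit (z s i) , ≤-refl , i
  while-rule {T = T} I nz z body (suc x) s i
    with t , s′ , p , t≤ , i′ ← body x s i
    with u , s″ , q , u≤ , i″ ← while-rule I nz z body x s′ i′
    = _ , s″ , loop (nz x s i) p q
    , s≤s (≤-trans (+-mono-≤ t≤ u≤) (≤-reflexive (sym (+-assoc T (x * suc T) 1)))) , i″

  run : Prog → State → State
  run (const r k)    (state ρ M) = state (ρ [ r ↦ wrap k ]) M
  run (op ∙ r r₁ r₂) (state ρ M) = state (ρ [ r ↦ ⟦ ∙ ⟧ (ρ r₁) (ρ r₂) ]) M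
  run (load r a)     (state ρ M) = state (ρ [ r ↦ M (ρ a) ]) M
  run (store a r)    (state ρ M) = state ρ (M [ ρ a ↦ ρ r ])
  run (P ⨾ Q)        s           = run Q (run P s)
  -- Junk values: `Straight` excludes branches and loops.
  run (ifnz _ _ _)   s           = s
  run (while _ _)    s           = s

  steps : Prog → ℕ
  steps (P ⨾ Q) = steps P + steps Q
  steps _       = 1

  run-exec : ∀ P → Straight P → ∀ s → Exec P s (steps P) (run P s)
  run-exec (const r k)    _       s = const
  run-exec (op ∙ r r₁ r₂) _       s = op
  run-exec (load r a)     _       s = load
  run-exec (store a r)    _       s = store
  run-exec (P ⨾ Q)        (p , q) s = seq (run-exec P p s) (run-exec Q q (run P s))

  -- The final state is obtained by evaluation, so facts about untouched registers carry over as
  -- they stand and only the arithmetic of the changed ones has to be supplied. `Straight P` is a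
  -- product of unit types, which is found by unification.
  straight : ∀ {P Φ Ψ} {_ : Straight P} → (∀ s → Φ s → Ψ (run P s)) → ⟨ Φ ⟩ P ⟨ steps P ⟩ Ψ
  straight {P} {_} {_} {p} h s φ = _ , _ , run-exec P p s , ≤-refl , h s φ

  const-ok : ∀ {k} → k < 2 ^ w → wrap k ≡ k
  const-ok = wrap-id

  add-ok : ∀ {a b x y} → a ≡ x → b ≡ y → x + y < 2 ^ w → ⟦ add ⟧ a b ≡ x + y
  add-ok refl refl = wrap-id

  mul-ok : ∀ {a b x y} → a ≡ x → b ≡ y → x * y < 2 ^ w → ⟦ mul ⟧ a b ≡ x * y
  mul-ok refl refl = wrap-id

  sub-ok : ∀ {a b} x y → a ≡ y + x → b ≡ y → y + x < 2 ^ w → ⟦ sub ⟧ a b ≡ x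
  sub-ok x y refl refl y+x< = begin
    wrap ((y + x) + (2 ^ w ∸ y))   ≡⟨ cong (λ z → wrap (z + (2 ^ w ∸ y))) (+-comm y x) ⟩
    wrap ((x + y) + (2 ^ w ∸ y))   ≡⟨ cong wrap (+-assoc x y _) ⟩
    wrap (x + (y + (2 ^ w ∸ y)))   ≡⟨ cong (λ z → wrap (x + z)) (m+[n∸m]≡n (<⇒≤ (≤-<-trans (m≤m+n y x) y+x<))) ⟩
    wrap (x + 2 ^ w)               ≡⟨ [m+n]%n≡m%n x (2 ^ w) ⟩
    wrap x                         ≡⟨ wrap-id (≤-<-trans (m≤n+m x y) y+x<) ⟩
    x                              ∎
    where open ≡-Reasoning

  -- Compared with `sub-ok`, only the result has to be a word, so a loop counter needs no bound on
  -- its old value.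
  dec-ok : ∀ {a b x} → a ≡ suc x → b ≡ 1 → x < 2 ^ w → ⟦ sub ⟧ a b ≡ x
  dec-ok {x = x} refl refl x< = begin
    wrap (suc x + (2 ^ w ∸ 1))     ≡⟨ cong wrap (sym (+-suc x (2 ^ w ∸ 1))) ⟩
    wrap (x + (1 + (2 ^ w ∸ 1)))   ≡⟨ cong (λ z → wrap (x + z)) (m+[n∸m]≡n (m^n>0 2 w)) ⟩
    wrap (x + 2 ^ w)               ≡⟨ [m+n]%n≡m%n x (2 ^ w) ⟩
    wrap x                         ≡⟨ wrap-id x< ⟩
    x                              ∎
    where open ≡-Reasoning

  div-ok : ∀ {a b x y} .{{_ : NonZero y}} → a ≡ x → b ≡ y → ⟦ div ⟧ a b ≡ x / y
  div-ok {y = suc y} refl refl = refl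

  mod-ok : ∀ {a b x y} .{{_ : NonZero y}} → a ≡ x → b ≡ y → ⟦ mod ⟧ a b ≡ x % y
  mod-ok {y = suc y} refl refl = refl

  pow-ok : ∀ {a b y} → a ≡ 1 → b ≡ y → 2 ^ y < 2 ^ w → ⟦ shl ⟧ a b ≡ 2 ^ y
  pow-ok {y = y} refl refl y< = trans (cong wrap (+-identityʳ (2 ^ y))) (wrap-id y<)

  lt-ok : ∀ {a b x y} → a ≡ x → b ≡ y → 1 < 2 ^ w → ⟦ lt ⟧ a b ≡ bit (x <ᵇ y)
  lt-ok {x = x} {y} refl refl 1< = wrap-id (≤-<-trans (bit≤1 (x <ᵇ y)) 1<)

-- The program for the matrix product
--
-- Registers that are constant once set:
--   0: n    2: 1    3: n + 1    4: n²    11: repeats    12: half    13: blockLength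
--   14: σ   15: σ + 1 (b before)   16: doublings   17: 2   18: 0   19: nonterminals
-- Register 1 is the write pointer, 5 the read pointer, 6 and 7 are loop counters and
-- 8, 9, 10 are temporary.

-- It differs from `bits` only at 0, where it vanishes. Halving thus lowers it by exactly one all
-- the way down to 0, and it can count the passes of `countBits`.
bitLength : ℕ → ℕ
bitLength zero    = 0
bitLength (suc n) = bits (suc n)

bitLength-half : ∀ n → bitLength (suc n) ≡ suc (bitLength ⌊ suc n /2⌋)
bitLength-half zero    = refl
bitLength-half (suc n) = cong suc (begin
  ⌊log₂ 2 + n ⌋                     ≡⟨ sym (m+[n∸m]≡n (⌊log₂⌋-mono-≤ {2} {2 + n} (s≤s (s≤s z≤n)))) ⟩
  suc (⌊log₂ 2 + n ⌋ ∸ 1)           ≡⟨ cong suc (sym (⌊log₂⌊n/2⌋⌋≡⌊log₂n⌋∸1 (2 + n))) ⟩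
  suc ⌊log₂ ⌊ 2 + n /2⌋ ⌋           ∎)
  where open ≡-Reasoning

n/2≡⌊n/2⌋ : ∀ n → n / 2 ≡ ⌊ n /2⌋
n/2≡⌊n/2⌋ zero          = refl
n/2≡⌊n/2⌋ (suc zero)    = refl
n/2≡⌊n/2⌋ (suc (suc n)) = trans (m/n≡1+[m∸n]/n {2 + n} {2} (s≤s (s≤s z≤n))) (cong suc (n/2≡⌊n/2⌋ n))

-- The largest index comes first, as in a loop that counts down. When each pass pushes onto the
-- front of a list, the pieces end up in increasing order.
loopTo : ∀ {A : Set} → (ℕ → A → A) → ℕ → A → A
loopTo f zero    a = a
loopTo f (suc x) a = loopTo f x (f x a)

-- Register 18 is never written and so keeps its initial 0.
copy : ℕ → ℕ → Prog
copy r r₁ = op add r r₁ 18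

push : ℕ → Prog
push r = op sub 1 1 2 ⨾ store 1 r

readSize : Prog
-- Register 8 is still 0, which is the address of n.
readSize = const 2 1 ⨾ load 0 8 ⨾ copy 8 0

halve : Prog
halve = op shr 8 8 2 ⨾ op add 15 15 2

countBits : Prog
countBits = while 8 halve

setParameters : (c K e : ℕ) → Prog
setParameters c K e =
  const 17 2 ⨾
  const 8 e ⨾ op mul 16 15 8 ⨾ op shl 11 2 16 ⨾
  const 8 K ⨾ op mul 8 15 8 ⨾ op sub 8 8 2 ⨾ op shl 14 2 8 ⨾
  const 8 c ⨾ op mul 8 15 8 ⨾ op sub 8 8 2 ⨾ op shl 12 2 8 ⨾
  op add 3 2 0 ⨾ op mul 4 0 0 ⨾
  op mul 13 4 11 ⨾ op add 13 13 13 ⨾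
  op add 15 2 14 ⨾
  op add 16 16 2 ⨾ op mul 16 16 0 ⨾
  op add 19 0 2 ⨾ op add 19 0 19 ⨾ op add 19 16 19 ⨾ op add 19 2 19

-- Sets the write pointer to `area`, the exact length of the query input, so that the last push
-- lands in cell 0.
setPointer : Prog
setPointer =
  const 9 3 ⨾
  op add 1 17 17 ⨾ op add 1 3 1 ⨾
  op mul 8 16 9 ⨾ op add 1 8 1 ⨾
  op mul 8 0 3 ⨾ op add 1 8 1 ⨾ op add 1 8 1 ⨾
  op add 1 3 1 ⨾
  op mul 8 4 9 ⨾ op add 1 8 1

pushQuery : Prog
pushQuery =
  op sub 6 6 2 ⨾
  op mod 8 6 0 ⨾ op add 8 8 2 ⨾ push 8 ⨾
  op div 9 6 0 ⨾ op mul 9 9 13 ⨾ op add 8 9 13 ⨾ push 8 ⨾ push 9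

pushQueries : Prog
pushQueries = copy 6 4 ⨾ while 6 pushQuery

pushPad : Prog
pushPad = op sub 7 7 2 ⨾ push 3

pushPadding : Prog
pushPadding = copy 7 0 ⨾ while 7 pushPad ⨾ push 0

-- With a = mem[r₅] ∈ {0, 1}, the pushed value is r₁₀ + (r₇ · a + (1 - a) · n).
pushEntry : Prog
pushEntry =
  op sub 7 7 2 ⨾ op sub 5 5 2 ⨾ load 8 5 ⨾
  op mul 9 7 8 ⨾ op sub 8 2 8 ⨾ op mul 8 8 0 ⨾ op add 9 9 8 ⨾ op add 9 9 10 ⨾ push 9

pushRow : Prog
pushRow = (op sub 6 6 2 ⨾ copy 7 0) ⨾ while 7 pushEntry ⨾ push 0

pushMatrix : Prog
pushMatrix = copy 6 0 ⨾ while 6 pushRow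

pushDoubling : Prog
pushDoubling = op sub 6 6 2 ⨾ op add 8 10 6 ⨾ push 8 ⨾ push 8 ⨾ push 17

pushDoublings : Prog
pushDoublings = (op add 10 15 3 ⨾ copy 6 16) ⨾ while 6 pushDoubling

pushRoot : Prog
pushRoot = op sub 6 6 2 ⨾ op add 8 10 6 ⨾ push 8

pushStart : Prog
pushStart = (op add 10 15 2 ⨾ copy 6 0) ⨾ while 6 pushRoot ⨾ push 0

pushHeader : Prog
pushHeader = push 15 ⨾ push 4 ⨾ push 14 ⨾ push 19

pointToB : Prog
pointToB = copy 10 2 ⨾ op add 5 2 4 ⨾ op add 5 5 4

pointToA : Prog
-- Register 5 needs no change: the reading of B has stopped at its first cell, which is just behind
-- the last entry of A.
pointToA = op add 10 15 3 ⨾ op add 10 10 16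

-- The query input is written over the matrices from its last cell downwards.  The code
-- of a matrix entry lies above the entry, so each entry is read before its cell is reused.
build : (c K e : ℕ) → Prog
build c K e =
  readSize ⨾ countBits ⨾ setParameters c K e ⨾ setPointer ⨾
  pushQueries ⨾ pushPadding ⨾
  pointToB ⨾ pushMatrix ⨾ pointToA ⨾ pushMatrix ⨾
  pushDoublings ⨾ pushStart ⨾ pushHeader

-- Decides low ≤ x < high.
answer : ℕ → ℕ → ℕ → ℕ
answer low high x = bit (bit (x <ᵇ low) <ᵇ bit (x <ᵇ high))

decide : Prog
decide = op sub 6 6 2 ⨾ load 8 6 ⨾ op lt 9 8 11 ⨾ op lt 8 8 12 ⨾ op lt 8 9 8 ⨾ store 6 8

threshold : Prog
threshold = copy 6 4 ⨾ while 6 decide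

-- Correctness of the constructed program

module Verification (w : ℕ) (orig : ℕ → ℕ) where
  open RAM w public

  -- Below the pointer the input is intact, which allows matrix entries to be read while the output
  -- grows. As `cell` is 0 behind the end of a list, `upper` also says that the memory behind the
  -- output is clean.
  record Stack (d : ℕ) (xs : List ℕ) (p : ℕ) (M : ℕ → ℕ) : Set where
    constructor stack
    field
      pointer : p ≡ d
      bound   : d < 2 ^ w
      lower   : ∀ a → a < d → M a ≡ orig a
      upper   : ∀ i → M (d + i) ≡ cell xs i

  stack-push : ∀ {d xs p M one v x} → one ≡ 1 → v ≡ x → Stack (suc d) xs p M →
               Stack d (x ∷ xs) (⟦ sub ⟧ p one) (M [ ⟦ sub ⟧ p one ↦ v ])
  stack-push {d} {xs} {p} {M} {one} {v} one≡ refl (stack p≡ d< lo hi) =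
    stack p′≡ (<-trans (n<1+n d) d<) lo′ hi′
    where
    p′≡ : ⟦ sub ⟧ p one ≡ d
    p′≡ = dec-ok p≡ one≡ (<-trans (n<1+n d) d<)
    lo′ : ∀ a → a < d → (M [ ⟦ sub ⟧ p one ↦ v ]) a ≡ orig a
    lo′ a a<d rewrite p′≡ = trans (update-other M d v (λ d≡a → <⇒≢ a<d (sym d≡a))) (lo a (m<n⇒m<1+n a<d))
    hi′ : ∀ i → (M [ ⟦ sub ⟧ p one ↦ v ]) (d + i) ≡ cell (v ∷ xs) i
    hi′ zero    rewrite p′≡ | +-identityʳ d = update-same M d v
    hi′ (suc i) rewrite p′≡ | +-suc d i =
      trans (update-other M d v (<⇒≢ (s≤s (m≤m+n d i)))) (hi i)

  -- Every pass pushes ℓ cells. A pointer at `x * ℓ + d` leaves room for exactly the x passes to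
  -- come, so the final position d is fixed from the start.
  for-rule : ∀ {r P T ℓ} (I : ℕ → ℕ → List ℕ → Assertion) (f : ℕ → List ℕ → List ℕ) →
             (∀ {x d ys s} → I x d ys s → reg s r ≡ x) →
             (∀ x d ys → ⟨ I (suc x) (ℓ + d) ys ⟩ P ⟨ T ⟩ I x d (f x ys)) →
             ∀ x d ys → ⟨ I x (x * ℓ + d) ys ⟩ while r P ⟨ x * suc T + 1 ⟩ I 0 d (loopTo f x ys)
  for-rule I f cnt body zero    d ys s i = _ , s , exit (cnt i) , ≤-refl , i
  for-rule {T = T} {ℓ} I f cnt body (suc x) d ys s i
    with t , s′ , p , t≤ , i′ ← body x (x * ℓ + d) ys s (subst (λ z → I (suc x) z ys s) (+-assoc ℓ (x * ℓ) d) i)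
    with u , s″ , q , u≤ , i″ ← for-rule I f cnt body x d (f x ys) s′ i′
    = _ , s″ , loop (λ z → 1+n≢0 (trans (sym (cnt i)) z)) p q
    , s≤s (≤-trans (+-mono-≤ t≤ u≤) (≤-reflexive (sym (+-assoc T (x * suc T) 1)))) , i″

algorithm : Prog → (c K e : ℕ) → Prog
algorithm P c K e = build c K e ⨾ shift P ⨾ threshold

module Parameters (n b c K e : ℕ) .{{_ : NonZero n}} where

  -- The extra level in `levels` is the factor 2 between the threshold `repeats` and the least
  -- positive answer. `half` is the first word that is negative in two's complement, provided b * c
  -- is the word length. The summands of `area` are the lengths of the parts in the order in which
  -- they are pushed.
  repeats half σ levels doublings blockLength nonterminals area : ℕ
  repeats      = 2 ^ (b * e)
  half         = 2 ^ (b * c ∸ 1)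
  σ            = 2 ^ (b * K ∸ 1)
  levels       = b * e + 1
  doublings    = levels * n
  blockLength  = n * n * repeats + n * n * repeats
  nonterminals = suc (doublings + (n + (n + 1)))
  area         = n * n * 3 + (suc n + (n * suc n + (n * suc n + (doublings * 3 + (suc n + 4)))))

  queryTriple : ℕ → List ℕ → List ℕ
  queryTriple x zs = x / n * blockLength ∷ x / n * blockLength + blockLength ∷ x % n + 1 ∷ zs

  doubling : ℕ → List ℕ → List ℕ
  doubling x zs = 2 ∷ suc σ + suc n + x ∷ suc σ + suc n + x ∷ zs

  entry : ℕ → (ℕ → ℕ → Bool) → ℕ → ℕ → ℕ
  entry base X k x = (if X k x then x else n) + base

  row : ℕ → (ℕ → ℕ → Bool) → ℕ → List ℕ → List ℕ
  row base X k zs = n ∷ loopTo (λ x → entry base X k x ∷_) n zs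

  -- The code of the nonterminal for row 0 of B. An entry of A adds the row number to it, or n for
  -- the padding row.
  baseA : ℕ
  baseA = suc σ + suc n + doublings

  target : (α β : ℕ → ℕ → Bool) → List ℕ
  target α β =
    nonterminals ∷ σ ∷ n * n ∷ suc σ ∷
    n ∷ loopTo (λ x → suc σ + 1 + x ∷_) n
    (loopTo doubling doublings
    (loopTo (row baseA α) n
    (loopTo (row 1 β) n
    (n ∷ loopTo (λ _ → suc n ∷_) n
    (loopTo queryTriple (n * n) [])))))

  buildTime : ℕ
  buildTime =
    3 + (b * 3 + 1 + (23 + (11 +
    (1 + (n * n * 13 + 1) + (1 + (n * 4 + 1 + 2) +
    (3 + (matrixTime + (2 + (matrixTime +
    (2 + (doublings * 9 + 1) + (2 + (n * 5 + 1 + 2) + 8)))))))))))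
    where matrixTime = 1 + (n * suc (2 + (n * 11 + 1 + 2)) + 1)

module Build
  (w n b c K e : ℕ) (orig : ℕ → ℕ) .{{_ : NonZero n}} where

  open Verification w orig public
  open Parameters n b c K e public

  -- The inequalities that keep the arithmetic of the construction from wrapping round;
  -- `Bounds.fits` supplies them all.
  record Fits : Set where
    field
      b*c≥1   : 1 ≤ b * c
      b*K≥1   : 1 ≤ b * K
      3<      : 3 < 2 ^ w
      b<      : b < 2 ^ w
      e<      : e < 2 ^ w
      K<      : K < 2 ^ w
      c<      : c < 2 ^ w
      b*e<    : b * e < 2 ^ w
      b*K<    : b * K < 2 ^ w
      b*c<    : b * c < 2 ^ w
      repeats< : repeats < 2 ^ w
      half<   : half < 2 ^ w
      codes<  : suc σ + nonterminals < 2 ^ w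
      string< : n * blockLength < 2 ^ w
      area<   : area < 2 ^ w

  -- The last component preserves the zero registers in which the relocated program has to start.
  Globals : (ℕ → ℕ) → Set
  Globals ρ =
    ρ 0 ≡ n × ρ 2 ≡ 1 × ρ 3 ≡ suc n × ρ 4 ≡ n * n × ρ 11 ≡ repeats × ρ 12 ≡ half ×
    ρ 13 ≡ blockLength × ρ 14 ≡ σ × ρ 15 ≡ suc σ × ρ 16 ≡ doublings × ρ 17 ≡ 2 ×
    ρ 18 ≡ 0 × ρ 19 ≡ nonterminals × (∀ i → ρ (20 + i) ≡ 0)

  Built : ℕ → List ℕ → Assertion
  Built d ys s = Globals (reg s) × Stack d ys (reg s 1) (mem s)

  copy-ok : ∀ {a z x} → a ≡ x → z ≡ 0 → x < 2 ^ w → ⟦ add ⟧ a z ≡ x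
  copy-ok {x = x} a≡ z≡ x< = trans (add-ok a≡ z≡ (subst (_< 2 ^ w) (sym (+-identityʳ x)) x<)) (+-identityʳ x)

  Fresh : Assertion
  Fresh s = reg s 0 ≡ n × reg s 2 ≡ 1 × reg s 18 ≡ 0 × (∀ i → reg s (20 + i) ≡ 0) × (∀ a → mem s a ≡ orig a)

  module _ (fits : Fits) where
    open Fits fits

    private
      sum-<ˡ : ∀ x y → x + y < 2 ^ w → x < 2 ^ w
      sum-<ˡ x y = ≤-<-trans (m≤m+n x y)

      sum-<ʳ : ∀ x y → x + y < 2 ^ w → y < 2 ^ w
      sum-<ʳ x y = ≤-<-trans (m≤n+m y x)

      1< : 1 < 2 ^ w
      1< = ≤-<-trans (s≤s z≤n) 3<

      2< : 2 < 2 ^ w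
      2< = ≤-<-trans (s≤s (s≤s z≤n)) 3<

      V< : nonterminals < 2 ^ w
      V< = ≤-<-trans (m≤n+m nonterminals (suc σ)) codes<

      n≤V : n ≤ nonterminals
      n≤V = m≤n⇒m≤1+n (≤-trans (m≤m+n n (n + 1)) (m≤n+m _ doublings))

      n< : n < 2 ^ w
      n< = ≤-<-trans n≤V V<

      1+n≤V : suc n ≤ nonterminals
      1+n≤V = s≤s (≤-trans (m≤m+n n (n + 1)) (m≤n+m _ doublings))

      1+n< : suc n < 2 ^ w
      1+n< = ≤-<-trans 1+n≤V V<

      doublings< : doublings < 2 ^ w
      doublings< = ≤-<-trans (m≤n⇒m≤1+n (m≤m+n doublings _)) V<

      queryArea≤ : n * n * 3 ≤ area
      queryArea≤ = m≤m+n (n * n * 3) _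

      n*n< : n * n < 2 ^ w
      n*n< = ≤-<-trans (≤-trans (m≤m*n (n * n) 3) queryArea≤) area<

    pushQueries-ok : ∀ d ys → ⟨ Built (n * n * 3 + d) ys ⟩ pushQueries ⟨ 1 + (n * n * 13 + 1) ⟩
      Built d (loopTo queryTriple (n * n) ys)
    pushQueries-ok d ys =
      straight {Φ = Built (n * n * 3 + d) ys} {Ψ = I (n * n) (n * n * 3 + d) ys} start ⟫
      λ s i → let t , s′ , p , t≤ , (g , _ , _ , stk) =
                    for-rule I queryTriple (λ (_ , r≡ , _) → r≡)
                      (λ x d ys → straight {pushQuery} {I (suc x) (3 + d) ys} (body x d ys)) (n * n) d ys s i
              in t , s′ , p , t≤ , (g , stk)
      where
      I : ℕ → ℕ → List ℕ → Assertion
      I x d ys s = Globals (reg s) × reg s 6 ≡ x × x ≤ n * n × Stack d ys (reg s 1) (mem s)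
      start : ∀ s → Built (n * n * 3 + d) ys s → I (n * n) (n * n * 3 + d) ys (run (copy 6 4) s)
      start s (g@(_ , _ , _ , r4 , _ , _ , _ , _ , _ , _ , _ , r18 , _) , stk) =
        g , copy-ok r4 r18 n*n< , ≤-refl , stk
      body : ∀ x d ys s → I (suc x) (3 + d) ys s → I x d (queryTriple x ys) (run pushQuery s)
      body x d ys s (g@(r0 , r2 , _ , _ , _ , _ , r13 , _) , r6 , x≤ , stk) =
        g , x≡ , <⇒≤ x≤ , stack-push r2 div≡ (stack-push r2 end≡ (stack-push r2 letter≡ stk))
        where
        x< : x < 2 ^ w
        x< = <-trans x≤ n*n<
        x≡ = dec-ok r6 r2 x<
        letter≡ = add-ok (mod-ok {y = n} x≡ r0) r2
          (≤-<-trans (≤-trans (≤-reflexive (+-comm _ 1)) (<⇒≤ (s≤s (m%n<n x n)))) 1+n<)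
        end< : x / n * blockLength + blockLength < 2 ^ w
        end< = ≤-<-trans (≤-trans (≤-reflexive (+-comm _ blockLength))
                            (*-monoˡ-≤ blockLength (m<n*o⇒m/o<n {x} {n} {n} x≤))) string<
        div≡ = mul-ok (div-ok {y = n} x≡ r0) r13 (≤-<-trans (m≤m+n _ _) end<)
        end≡ = add-ok div≡ r13 end<

    pushPadding-ok : ∀ d ys → ⟨ Built (suc n + d) ys ⟩ pushPadding ⟨ 1 + (n * 4 + 1 + 2) ⟩
      Built d (n ∷ loopTo (λ _ → suc n ∷_) n ys)
    pushPadding-ok d ys =
      straight {Φ = Built (suc n + d) ys} {Ψ = I n (n * 1 + suc d) ys} start ⟫
      for-rule I (λ _ → suc n ∷_) (λ (_ , r≡ , _) → r≡)
         (λ x d ys → straight {Φ = I (suc x) (1 + d) ys} (body x d ys)) n (suc d) ys ⟫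
      straight {Φ = I 0 (suc d) (loopTo (λ _ → suc n ∷_) n ys)} {Built d (n ∷ loopTo (λ _ → suc n ∷_) n ys)} λ { s (g@(r0 , r2 , _) , _ , _ , stk) → g , stack-push r2 r0 stk }
      where
      I : ℕ → ℕ → List ℕ → Assertion
      I x d ys s = Globals (reg s) × reg s 7 ≡ x × x < 2 ^ w × Stack d ys (reg s 1) (mem s)
      start : ∀ s → Built (suc n + d) ys s → I n (n * 1 + suc d) ys (run (copy 7 0) s)
      start s (g@(r0 , _ , _ , _ , _ , _ , _ , _ , _ , _ , _ , r18 , _) , stk) =
        g , copy-ok r0 r18 n< , n<
        , subst (λ z → Stack z ys (reg s 1) (mem s)) (trans (sym (+-suc n d)) (cong (_+ suc d) (sym (*-identityʳ n)))) stk
      body : ∀ x d ys s → I (suc x) (1 + d) ys s → I x d (suc n ∷ ys) (run pushPad s)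
      body x d ys s (g@(_ , r2 , r3 , _) , r7 , x< , stk) =
        g , dec-ok r7 r2 x<′ , x<′ , stack-push r2 r3 stk
        where x<′ = <-trans (n<1+n x) x<

    pushStart-ok : ∀ d ys → ⟨ Built (suc n + d) ys ⟩ pushStart ⟨ 2 + (n * 5 + 1 + 2) ⟩
      Built d (n ∷ loopTo (λ x → suc σ + 1 + x ∷_) n ys)
    pushStart-ok d ys =
      straight {Φ = Built (suc n + d) ys} {Ψ = I n (n * 1 + suc d) ys} start ⟫
      for-rule I (λ x → suc σ + 1 + x ∷_) (λ (_ , r≡ , _) → r≡)
         (λ x d ys → straight {Φ = I (suc x) (1 + d) ys} (body x d ys)) n (suc d) ys ⟫
      straight {Φ = I 0 (suc d) (loopTo (λ x → suc σ + 1 + x ∷_) n ys)} {Built d (n ∷ loopTo (λ x → suc σ + 1 + x ∷_) n ys)} λ { s (g@(r0 , r2 , _) , _ , _ , _ , stk) → g , stack-push r2 r0 stk }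
      where
      I : ℕ → ℕ → List ℕ → Assertion
      I x d ys s = Globals (reg s) × reg s 6 ≡ x × reg s 10 ≡ suc σ + 1 × x ≤ n × Stack d ys (reg s 1) (mem s)
      start : ∀ s → Built (suc n + d) ys s → I n (n * 1 + suc d) ys (run (op add 10 15 2 ⨾ copy 6 0) s)
      start s (g@(r0 , r2 , _ , _ , _ , _ , _ , _ , r15 , _ , _ , r18 , _) , stk) =
        g , copy-ok r0 r18 n< , add-ok r15 r2 (≤-<-trans (+-monoʳ-≤ (suc σ) (s≤s z≤n)) codes<) , ≤-refl
        , subst (λ z → Stack z ys (reg s 1) (mem s)) (trans (sym (+-suc n d)) (cong (_+ suc d) (sym (*-identityʳ n)))) stk
      body : ∀ x d ys s → I (suc x) (1 + d) ys s → I x d (suc σ + 1 + x ∷ ys) (run pushRoot s)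
      body x d ys s (g@(_ , r2 , r3 , _) , r6 , r10 , x< , stk) =
        g , x≡ , r10 , <⇒≤ x<
        , stack-push r2 (add-ok r10 x≡ (≤-<-trans (≤-trans (≤-reflexive (+-assoc (suc σ) 1 x))
                                            (+-monoʳ-≤ (suc σ) (≤-trans x< n≤V))) codes<)) stk
        where x≡ = dec-ok r6 r2 (<-trans x< n<)

    pushDoublings-ok : ∀ d ys → ⟨ Built (doublings * 3 + d) ys ⟩ pushDoublings ⟨ 2 + (doublings * 9 + 1) ⟩
      Built d (loopTo doubling doublings ys)
    pushDoublings-ok d ys =
      straight {Φ = Built (doublings * 3 + d) ys} {Ψ = I doublings (doublings * 3 + d) ys} start ⟫
      λ s i → let t , s′ , p , t≤ , (g , _ , _ , _ , stk) =
                    for-rule I doubling (λ (_ , r≡ , _) → r≡)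
                      (λ x d ys → straight {Φ = I (suc x) (3 + d) ys} (body x d ys)) doublings d ys s i
              in t , s′ , p , t≤ , (g , stk)
      where
      I : ℕ → ℕ → List ℕ → Assertion
      I x d ys s = Globals (reg s) × reg s 6 ≡ x × reg s 10 ≡ suc σ + suc n × x ≤ doublings ×
                   Stack d ys (reg s 1) (mem s)
      start : ∀ s → Built (doublings * 3 + d) ys s → I doublings (doublings * 3 + d) ys (run (op add 10 15 3 ⨾ copy 6 16) s)
      start s (g@(_ , _ , r3 , _ , _ , _ , _ , _ , r15 , r16 , _ , r18 , _) , stk) =
        g , copy-ok r16 r18 doublings< , add-ok r15 r3 (≤-<-trans (+-monoʳ-≤ (suc σ) 1+n≤V) codes<) , ≤-refl , stk
      body : ∀ x d ys s → I (suc x) (3 + d) ys s → I x d (doubling x ys) (run pushDoubling s)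
      body x d ys s (g@(_ , r2 , _ , _ , _ , _ , _ , _ , _ , _ , r17 , _) , r6 , r10 , x< , stk) =
        g , x≡ , r10 , <⇒≤ x< , stack-push r2 r17 (stack-push r2 code≡ (stack-push r2 code≡ stk))
        where
        x≡ = dec-ok r6 r2 (<-trans x< doublings<)
        code≡ = add-ok r10 x≡ (≤-<-trans (≤-trans (≤-reflexive (+-assoc (suc σ) (suc n) x))
          (+-monoʳ-≤ (suc σ) (s≤s (≤-trans (≤-reflexive (+-comm n x)) (+-mono-≤ (<⇒≤ x<) (m≤m+n n (n + 1))))))) codes<)

    pushHeader-ok : ∀ d ys → ⟨ Built (4 + d) ys ⟩ pushHeader ⟨ 8 ⟩
      Built d (nonterminals ∷ σ ∷ n * n ∷ suc σ ∷ ys)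
    pushHeader-ok d ys = straight {Φ = Built (4 + d) ys}
      λ { s (g@(_ , r2 , _ , r4 , _ , _ , _ , r14 , r15 , _ , _ , _ , r19 , _) , stk) →
          g , stack-push r2 r19 (stack-push r2 r14 (stack-push r2 r4 (stack-push r2 r15 stk))) }

    module _ (base source : ℕ) (X : ℕ → ℕ → Bool)
             (base< : n + base < 2 ^ w) (source< : source + n * n < 2 ^ w)
             (origX : ∀ k x → k < n → x < n → orig (source + (n * k + x)) ≡ bit (X k x)) where

      private
        -- The inequality keeps the write pointer above the unread entries. A row has n cells of
        -- input but n + 1 of output: the slack k stands for the lengths of the k rows to come, and
        -- the strictness for the length of the current row, which is pushed last.
        Row : ℕ → ℕ → ℕ → List ℕ → Assertion
        Row k x d ys s =
          Globals (reg s) × reg s 6 ≡ k × reg s 10 ≡ base × reg s 7 ≡ x ×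
          reg s 5 ≡ source + (n * k + x) × x ≤ n × source + (n * k + x) + k < d ×
          Stack d ys (reg s 1) (mem s)

        address< : ∀ {k x} → k < n → x ≤ n → source + (n * k + x) < 2 ^ w
        address< {k} {x} k< x≤ = ≤-<-trans (+-monoʳ-≤ source (begin
          n * k + x  ≤⟨ +-monoʳ-≤ (n * k) x≤ ⟩
          n * k + n  ≡⟨ trans (+-comm (n * k) n) (sym (*-suc n k)) ⟩
          n * suc k  ≤⟨ *-monoʳ-≤ n k< ⟩
          n * n      ∎)) source<
          where open ≤-Reasoning

        -- The choice between x and n is made by arithmetic on the bit, which keeps `pushEntry` free
        -- of branches.
        select-ok : ∀ β {r₇ r₈ one r₀ x} → r₇ ≡ x → r₈ ≡ bit β → one ≡ 1 → r₀ ≡ n → x < n →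
                    ⟦ add ⟧ (⟦ mul ⟧ r₇ r₈) (⟦ mul ⟧ (⟦ sub ⟧ one r₈) r₀) ≡ (if β then x else n)
        select-ok true {x = x} refl refl refl refl x< =
          trans (add-ok (trans (mul-ok {x = x} {1} refl refl (subst (_< 2 ^ w) (sym (*-identityʳ x)) x<w)) (*-identityʳ x))
                  (trans (mul-ok (sub-ok 0 1 refl refl 1<) refl (<-trans z<s 1<)) refl)
                  (subst (_< 2 ^ w) (sym (+-identityʳ x)) x<w))
                (+-identityʳ x)
          where x<w = <-trans x< n<
        select-ok false {x = x} refl refl refl refl x< =
          add-ok (trans (mul-ok {x = x} {0} refl refl (subst (_< 2 ^ w) (sym (*-zeroʳ x)) (<-trans z<s 1<))) (*-zeroʳ x))
                 (trans (mul-ok (sub-ok 1 0 refl refl 1<) refl (subst (_< 2 ^ w) (sym (*-identityˡ n)) n<)) (*-identityˡ n))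
                 n<

        if-≤ : ∀ β {x} → x ≤ n → (if β then x else n) ≤ n
        if-≤ true  x≤ = x≤
        if-≤ false x≤ = ≤-refl

        row-step : ∀ k → k < n → ∀ x d ys s → Row k (suc x) (1 + d) ys s → Row k x d (entry base X k x ∷ ys) (run pushEntry s)
        row-step k k< x d ys s (g@(r0 , r2 , _) , r6 , r10 , r7 , r5 , x< , (s≤s room) , stk) =
          g , r6 , r10 , x≡ , a≡ , <⇒≤ x< , room′
          , stack-push r2 (add-ok (select-ok (X k x) x≡ bit≡ r2 r0 x<) r10
              (≤-<-trans (+-monoˡ-≤ base (if-≤ (X k x) (<⇒≤ x<))) base<)) stk
          where
          x≡ = dec-ok r7 r2 (<-trans x< n<)
          a≡ = dec-ok (trans r5 (trans (cong (source +_) (+-suc (n * k) x)) (+-suc source _))) r2 (address< k< (<⇒≤ x<))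
          room′ : source + (n * k + x) + k < d
          room′ = ≤-trans (≤-reflexive (cong (_+ k) (trans (sym (+-suc source _)) (cong (source +_) (sym (+-suc (n * k) x)))))) room
          -- The cell lies below the write pointer, so it still holds the original entry.
          bit≡ = trans (cong (mem s) a≡)
                   (trans (Stack.lower stk _ (m<n⇒m<1+n (≤-<-trans (m≤m+n _ k) room′))) (origX k x k< x<))

        Rows : ℕ → ℕ → List ℕ → Assertion
        Rows k d ys s =
          Globals (reg s) × reg s 6 ≡ k × reg s 10 ≡ base ×
          reg s 5 ≡ source + n * k × k ≤ n × source + n * k + k ≤ d ×
          Stack d ys (reg s 1) (mem s)

        matrix-step : ∀ k d ys → ⟨ Rows (suc k) (suc n + d) ys ⟩ pushRow ⟨ 2 + (n * 11 + 1 + 2) ⟩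
                      Rows k d (row base X k ys)
        matrix-step k d ys s i@(_ , _ , _ , _ , k< , _) =
          (straight {Φ = Rows (suc k) (suc n + d) ys} {Ψ = Row k n (n * 1 + suc d) ys} first ⟫
           for-rule (Row k) (λ x → entry base X k x ∷_) (λ (_ , _ , _ , r≡ , _) → r≡)
             (λ x d ys → straight {Φ = Row k (suc x) (1 + d) ys} (row-step k k< x d ys)) n (suc d) ys ⟫
           straight {Φ = Row k 0 (suc d) zs} {Ψ = Rows k d (n ∷ zs)} last) s i
          where
          first : ∀ s → Rows (suc k) (suc n + d) ys s → Row k n (n * 1 + suc d) ys (run (op sub 6 6 2 ⨾ copy 7 0) s)
          first s (g@(r0 , r2 , _ , _ , _ , _ , _ , _ , _ , _ , _ , r18 , _) , r6 , r10 , r5 , k< , room , stk) =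
            g , dec-ok r6 r2 (<-trans k< n<) , r10 , copy-ok r0 r18 n<
            , trans r5 (cong (source +_) nk≡) , ≤-refl
            , subst (suc (source + (n * k + n) + k) ≤_) size≡
                (≤-trans (≤-reflexive (trans (sym (+-suc _ k)) (cong (λ z → source + z + suc k) (sym nk≡)))) room)
            , subst (λ z → Stack z ys (reg s 1) (mem s)) size≡ stk
            where
            nk≡ : n * suc k ≡ n * k + n
            nk≡ = trans (*-suc n k) (+-comm n (n * k))
            size≡ : suc n + d ≡ n * 1 + suc d
            size≡ = trans (sym (+-suc n d)) (cong (_+ suc d) (sym (*-identityʳ n)))
          zs = loopTo (λ x → entry base X k x ∷_) n ys
          last : ∀ s → Row k 0 (suc d) zs s → Rows k d (n ∷ zs) (run (push 0) s)
          last s (g@(r0 , r2 , _) , r6 , r10 , _ , r5 , _ , (s≤s room) , stk) =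
            g , r6 , r10 , trans r5 (cong (source +_) (+-identityʳ (n * k))) , <⇒≤ k<
            , subst (λ z → source + z + k ≤ d) (+-identityʳ (n * k)) room , stack-push r2 r0 stk

      -- The hypothesis amounts to `source` ≤ d: the lowest cell written is not below the lowest
      -- cell read. The n row lengths, one cell each, then give the slack that the invariant of the
      -- loop asks for.
      pushMatrix-ok : ∀ d ys → source + n * n ≤ n * n + d →
        ⟨ (λ s → Built (n * suc n + d) ys s × reg s 10 ≡ base × reg s 5 ≡ source + n * n) ⟩
        pushMatrix ⟨ 1 + (n * suc (2 + (n * 11 + 1 + 2)) + 1) ⟩
        (λ s → Built d (loopTo (row base X) n ys) s × reg s 5 ≡ source)
      pushMatrix-ok d ys room =
        straight {Φ = λ s → Built (n * suc n + d) ys s × reg s 10 ≡ base × reg s 5 ≡ source + n * n}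
                 {Ψ = Rows n (n * suc n + d) ys}
          (λ { s ((g@(r0 , r2 , _ , _ , _ , _ , _ , _ , _ , _ , _ , r18 , _) , stk) , r10 , r5) →
               g , copy-ok r0 r18 n< , r10 , r5 , ≤-refl , room′ , stk }) ⟫
        λ s i → let t , s′ , p , t≤ , (g , _ , _ , r5 , _ , _ , stk) =
                      for-rule Rows (row base X) (λ (_ , r≡ , _) → r≡) matrix-step n d ys s i
                in t , s′ , p , t≤ , (g , stk) , trans r5 (trans (cong (source +_) (*-zeroʳ n)) (+-identityʳ source))
        where
        room′ : source + n * n + n ≤ n * suc n + d
        room′ = begin
          source + n * n + n  ≤⟨ +-monoˡ-≤ n room ⟩
          n * n + d + n       ≡⟨ solve 2 (λ n d → n :* n :+ d :+ n := n :* (con 1 :+ n) :+ d) refl n d ⟩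
          n * suc n + d       ∎
          where open ≤-Reasoning

    readSize-ok : orig 0 ≡ n → ⟨ (λ s → (∀ i → reg s i ≡ 0) × (∀ a → mem s a ≡ orig a)) ⟩ readSize ⟨ 3 ⟩
      (λ s → Fresh s × reg s 8 ≡ n × reg s 15 ≡ 0)
    readSize-ok orig0 = straight {readSize} λ s (r≡0 , M≡) →
      let r0 = trans (trans (cong (mem s) (r≡0 8)) (M≡ 0)) orig0 in
      (r0 , const-ok 1< , r≡0 18 , (λ i → r≡0 (20 + i)) , M≡) , copy-ok r0 (r≡0 18) n< , r≡0 15

    countBits-ok : bitLength n ≡ b →
      ⟨ (λ s → Fresh s × reg s 8 ≡ n × reg s 15 ≡ 0) ⟩ countBits ⟨ b * 3 + 1 ⟩
      (λ s → Fresh s × reg s 15 ≡ b)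
    countBits-ok refl s (fresh , r8 , r15) =
      let t , s′ , p , t≤ , fresh′ , _ , r15′ =
            while-rule I nonzero zeroed (λ x → straight {halve} {I (suc x)} {I x} (body x)) b s
              (fresh , cong bitLength r8 , cong (_+ b) r15)
      in t , s′ , p , t≤ , fresh′ , trans (sym (+-identityʳ _)) r15′
      where
      I : ℕ → Assertion
      I x s = Fresh s × bitLength (reg s 8) ≡ x × reg s 15 + x ≡ b
      nonzero : ∀ x s → I (suc x) s → reg s 8 ≢ 0
      nonzero x s (_ , len≡ , _) z = 0≢1+n (trans (cong bitLength (sym z)) len≡)
      zeroed : ∀ s → I 0 s → reg s 8 ≡ 0
      zeroed s (_ , len≡ , _) with reg s 8
      ... | zero = refl
      body : ∀ x s → I (suc x) s → I x (run halve s)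
      body x s (fresh@(_ , r2 , _) , len≡ , sum≡) =
        fresh
        , suc-injective (trans (cong (λ z → suc (bitLength z)) (halve-ok r2)) (trans (halved (reg s 8) len≡) len≡))
        , trans (cong (_+ x) (add-ok {x = reg s 15} refl r2
                  (≤-<-trans (≤-trans (+-monoʳ-≤ (reg s 15) (s≤s z≤n)) (≤-reflexive sum≡)) b<)))
                (trans (+-assoc (reg s 15) 1 x) sum≡)
        where
        halve-ok : ∀ {y a} → a ≡ 1 → ⟦ shr ⟧ y a ≡ ⌊ y /2⌋
        halve-ok {y} refl = n/2≡⌊n/2⌋ y
        halved : ∀ y {z} → bitLength y ≡ suc z → suc (bitLength ⌊ y /2⌋) ≡ bitLength y
        halved (suc y) _ = sym (bitLength-half y)

    setParameters-ok : ⟨ (λ s → Fresh s × reg s 15 ≡ b) ⟩ setParameters c K e ⟨ 23 ⟩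
      (λ s → Globals (reg s) × (∀ a → mem s a ≡ orig a))
    setParameters-ok = straight {setParameters c K e} λ s ((r0 , r2 , r18 , r20 , M≡) , r15) →
      let
        r16₀ = mul-ok r15 (const-ok e<) b*e<
        r11  = pow-ok r2 r16₀ repeats<
        r14  = pow-ok r2 (dec-ok (trans (mul-ok r15 (const-ok K<) b*K<) (sym (m+[n∸m]≡n b*K≥1))) r2
                 (≤-<-trans (m∸n≤m _ 1) b*K<)) σ<
        r12  = pow-ok r2 (dec-ok (trans (mul-ok r15 (const-ok c<) b*c<) (sym (m+[n∸m]≡n b*c≥1))) r2
                 (≤-<-trans (m∸n≤m _ 1) b*c<)) half<
        r4   = mul-ok r0 r0 n*n<
        r13₀ = mul-ok r4 r11 (sum-<ˡ _ _ blockLength<)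
        r16₁ = add-ok r16₀ r2 levels<
        r16  = mul-ok r16₁ r0 doublings<
        r19₀ = add-ok r0 r2 (sum-<ʳ n _ (sum-<ʳ doublings _ (sum-<ʳ 1 _ V<)))
        r19₁ = add-ok r0 r19₀ (sum-<ʳ doublings _ (sum-<ʳ 1 _ V<))
        r19₂ = add-ok r16 r19₁ (sum-<ʳ 1 _ V<)
      in (r0 , r2 , add-ok r2 r0 1+n< , r4 , r11 , r12 , add-ok r13₀ r13₀ blockLength< , r14 , add-ok r2 r14 1+σ<
         , r16 , const-ok 2< , r18 , add-ok r2 r19₂ V< , r20) , M≡
      where
      1+σ< : suc σ < 2 ^ w
      1+σ< = sum-<ˡ (suc σ) _ codes<
      σ< : σ < 2 ^ w
      σ< = <-trans (n<1+n σ) 1+σ<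
      blockLength< : blockLength < 2 ^ w
      blockLength< = ≤-<-trans (m≤n*m blockLength n) string<
      levels< : levels < 2 ^ w
      levels< = ≤-<-trans (m≤m*n levels n) doublings<

    setPointer-ok : (∀ i → orig (area + i) ≡ 0) →
      ⟨ (λ s → Globals (reg s) × (∀ a → mem s a ≡ orig a)) ⟩ setPointer ⟨ 11 ⟩ Built area []
    setPointer-ok orig-0 =
      straight {setPointer} λ s (g@(r0 , _ , r3 , r4 , _ , _ , _ , _ , _ , r16 , r17 , _) , M≡) →
      let
        r9  = const-ok 3<
        r1₀ = add-ok r17 r17 (sum-<ʳ (suc n) _ d₁<)
        r1₁ = add-ok r3 r1₀ d₁<
        r1₂ = add-ok (mul-ok r16 r9 (sum-<ˡ _ _ d₂<)) r1₁ d₂<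
        r8  = mul-ok r0 r3 (sum-<ˡ _ _ d₃<)
        r1₃ = add-ok r8 r1₂ d₃<
        r1₄ = add-ok r8 r1₃ d₄<
        r1₅ = add-ok r3 r1₄ d₅<
        r1₆ = add-ok (mul-ok r4 r9 (sum-<ˡ _ _ area<)) r1₅ area<
      in g , stack r1₆ area< (λ a _ → M≡ a) (λ i → trans (M≡ _) (orig-0 i))
      where
      d₅< = sum-<ʳ (n * n * 3) _ area<
      d₄< = sum-<ʳ (suc n) _ d₅<
      d₃< = sum-<ʳ (n * suc n) _ d₄<
      d₂< = sum-<ʳ (n * suc n) _ d₃<
      d₁< = sum-<ʳ (doublings * 3) _ d₂<

    module _ (α β : ℕ → ℕ → Bool) (size≡ : orig 0 ≡ n) (bits≡ : bitLength n ≡ b)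
             (orig-α : ∀ k x → k < n → x < n → orig (1 + (n * k + x)) ≡ bit (α k x))
             (orig-β : ∀ k x → k < n → x < n → orig (1 + n * n + (n * k + x)) ≡ bit (β k x))
             (orig-0 : ∀ i → orig (area + i) ≡ 0) where

      private
        n+1< : n + 1 < 2 ^ w
        n+1< = subst (_< 2 ^ w) (+-comm 1 n) 1+n<

        sourceB< : 1 + n * n + n * n < 2 ^ w
        sourceB< = ≤-<-trans (begin
          1 + n * n + n * n                       ≤⟨ +-monoˡ-≤ (n * n) (s≤s (m≤n+m (n * n) n)) ⟩
          suc n + n * n + n * n                   ≤⟨ m≤m+n _ (n * n + _) ⟩
          suc n + n * n + n * n + (n * n + rest)  ≡⟨ solve 2 (λ x r → con 1 :+ x :+ x :* x :+ x :* x :+ (x :* x :+ r)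
                                                       := x :* x :* con 3 :+ (con 1 :+ x :+ r)) refl n rest ⟩
          area                                    ∎) area<
          where
          open ≤-Reasoning
          rest = n * suc n + (n * suc n + (doublings * 3 + (suc n + 4)))

        baseA< : n + baseA < 2 ^ w
        baseA< = ≤-<-trans (begin
          n + (suc σ + suc n + doublings)                ≤⟨ n≤1+n _ ⟩
          suc (n + (suc σ + suc n + doublings))          ≡⟨ solve 3 (λ x s d → con 1 :+ (x :+ (s :+ (con 1 :+ x) :+ d))
                                                              := s :+ (con 1 :+ (d :+ (x :+ (x :+ con 1)))))
                                                              refl n (suc σ) doublings ⟩
          suc σ + nonterminals                           ∎) codes<
          where open ≤-Reasoning

        roomB : 1 + n * n + n * n ≤ n * n + (n * suc n + (doublings * 3 + (suc n + 4)))
        roomB = begin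
          1 + n * n + n * n              ≡⟨ +-comm (1 + n * n) (n * n) ⟩
          n * n + (1 + n * n)            ≤⟨ +-monoʳ-≤ (n * n) (+-mono-≤ (>-nonZero⁻¹ n) (≤-refl {n * n})) ⟩
          n * n + (n + n * n)            ≡⟨ cong (n * n +_) (sym (*-suc n n)) ⟩
          n * n + n * suc n              ≤⟨ +-monoʳ-≤ (n * n) (m≤m+n (n * suc n) _) ⟩
          _                              ∎
          where open ≤-Reasoning

        roomA : 1 + n * n ≤ n * n + (doublings * 3 + (suc n + 4))
        roomA = ≤-trans (≤-reflexive (+-comm 1 (n * n)))
                  (+-monoʳ-≤ (n * n) (≤-trans (s≤s z≤n) (m≤n+m (suc n + 4) (doublings * 3))))

      build-ok :
        ⟨ (λ s → (∀ i → reg s i ≡ 0) × (∀ a → mem s a ≡ orig a)) ⟩ build c K e ⟨ buildTime ⟩ Built 0 (target α β)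
      build-ok =
        readSize-ok size≡ ⟫ countBits-ok bits≡ ⟫ setParameters-ok ⟫ setPointer-ok orig-0 ⟫
        pushQueries-ok _ _ ⟫ pushPadding-ok _ _ ⟫
        straight {pointToB} (λ { s (g@(_ , r2 , _ , r4 , _ , _ , _ , _ , _ , _ , _ , r18 , _) , stk) →
          (g , stk) , copy-ok r2 r18 1< , add-ok (add-ok r2 r4 1+n*n<) r4 sourceB< }) ⟫
        pushMatrix-ok 1 (1 + n * n) β n+1< sourceB< orig-β _ _ roomB ⟫
        straight {pointToA} (λ { s ((g@(_ , _ , r3 , _ , _ , _ , _ , _ , r15 , r16 , _) , stk) , r5) →
          (g , stk) , add-ok (add-ok r15 r3 (sum-<ˡ _ doublings (sum-<ʳ n _ baseA<))) r16 (sum-<ʳ n _ baseA<) , r5 }) ⟫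
        weaken proj₁ (pushMatrix-ok baseA 1 α baseA< 1+n*n< orig-α _ _ roomA) ⟫
        pushDoublings-ok _ _ ⟫ pushStart-ok _ _ ⟫ pushHeader-ok _ _
        where
        1+n*n< = sum-<ˡ (1 + n * n) (n * n) sourceB<

    threshold-ok : ∀ (out : ℕ → ℕ) →
      ⟨ (λ s → (reg s 2 ≡ 1 × reg s 4 ≡ n * n × reg s 11 ≡ repeats × reg s 12 ≡ half × reg s 18 ≡ 0) × mem s ≗ out) ⟩
      threshold ⟨ 1 + (n * n * 7 + 1) ⟩
      (λ s → ∀ a → a < n * n → mem s a ≡ answer repeats half (out a))
    threshold-ok out =
      straight {copy 6 4} {Ψ = I (n * n)} (λ { s (g@(_ , r4 , _ , _ , r18) , M≡) →
        g , copy-ok r4 r18 n*n< , ≤-refl , (λ a _ → M≡ a) , λ a ≤a a< → ⊥-elim (<⇒≱ a< ≤a) }) ⟫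
      weaken (λ (_ , _ , _ , _ , done) a → done a z≤n)
        (while-rule I (λ x s (_ , r6 , _) z → 1+n≢0 (trans (sym r6) z)) (λ s (_ , r6 , _) → r6)
          (λ x → straight {decide} {I (suc x)} {I x} (body x)) (n * n))
      where
      I : ℕ → Assertion
      I x s = (reg s 2 ≡ 1 × reg s 4 ≡ n * n × reg s 11 ≡ repeats × reg s 12 ≡ half × reg s 18 ≡ 0) ×
        reg s 6 ≡ x × x ≤ n * n × (∀ a → a < x → mem s a ≡ out a) ×
        (∀ a → x ≤ a → a < n * n → mem s a ≡ answer repeats half (out a))
      body : ∀ x s → I (suc x) s → I x (run decide s)
      body x (state ρ M) (g@(r2 , r4 , r11 , r12 , _) , r6 , x< , todo , done) =
        g , x≡ , <⇒≤ x< , todo′ , done′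
        where
        x≡ = dec-ok r6 r2 (<-trans x< n*n<)
        ρ′ = reg (run decide (state ρ M))
        read≡ : M (ρ′ 6) ≡ out x
        read≡ = trans (cong M x≡) (todo x ≤-refl)
        answer≡ : ρ′ 8 ≡ answer repeats half (out x)
        answer≡ = lt-ok (lt-ok read≡ r11 1<) (lt-ok read≡ r12 1<) 1<
        todo′ : ∀ a → a < x → (M [ ρ′ 6 ↦ ρ′ 8 ]) a ≡ out a
        todo′ a a<x = trans (update-other M (ρ′ 6) (ρ′ 8) (λ x≡a → <⇒≢ a<x (trans (sym x≡a) x≡))) (todo a (m<n⇒m<1+n a<x))
        done′ : ∀ a → x ≤ a → a < n * n → (M [ ρ′ 6 ↦ ρ′ 8 ]) a ≡ answer repeats half (out a)
        done′ a x≤a a< with m≤n⇒m<n∨m≡n x≤a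
        ... | inj₁ x<a  = trans (update-other M (ρ′ 6) (ρ′ 8) (λ x≡a → <⇒≢ x<a (trans (sym x≡) x≡a))) (done a x<a a<)
        ... | inj₂ refl = trans (cong (M [ ρ′ 6 ↦ ρ′ 8 ]) (sym x≡)) (trans (update-same M (ρ′ 6) (ρ′ 8)) answer≡)

module _ (w n b c K e : ℕ) .{{_ : NonZero n}} (input : List ℕ) where
  open Build w n b c K e (λ a → WordRAM.wrap w (WordRAM.cell w input a))

  module _ (fits : Fits) {P : Prog} {xs : List ℕ} {t₀ : ℕ} {out₀ : ℕ → ℕ} (run₀ : Run w P xs t₀ out₀) where

    Answered : Set
    Answered = (∀ a → out₀ a < 2 ^ w) × ∃[ t ] ∃[ out ] Run w (algorithm P c K e) input t out ×
      t ≤ buildTime + (t₀ + (1 + (n * n * 7 + 1))) ×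
      (∀ a → a < n * n → out a ≡ answer repeats half (out₀ a))

    answer-after : ∀ {t₁ s₁} → Exec (build c K e) (initial input) t₁ s₁ → t₁ ≤ buildTime → Built 0 xs s₁ → Answered
    answer-after {t₁} {s₁} build₁ t₁≤ ((_ , r2 , _ , r4 , r11 , r12 , _ , _ , _ , _ , _ , r18 , _ , r20≡) , stack _ _ _ M₁≡) =
      finish (shift-exec (proj₂ run₀) {s₁}
        -- Execution keeps every cell below 2 ^ w, so wrapping the entries of `xs` does not change
        -- them.
        (r20≡ , λ a → trans (M₁≡ a) (sym (wrap-id (subst (_< 2 ^ w) (M₁≡ a) (proj₂ bounded₁ a))))))
      where
      bounded₁ : Bounded s₁
      bounded₁ = exec-bounded build₁ ((λ _ → m^n>0 2 w) , (λ _ → wrap-< _))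

      finish : ∃[ s₂ ] Exec (shift P) s₁ t₀ s₂ × s₂ ≈ state (proj₁ run₀) out₀ × SameLow s₁ s₂ → Answered
      finish (s₂ , exec₂ , (_ , M₂≡) , low) = conclude (threshold-ok fits out₀ s₂
        (( trans (low 2 (m≤m+n 3 17)) r2 , trans (low 4 (m≤m+n 5 15)) r4 , trans (low 11 (m≤m+n 12 8)) r11
         , trans (low 12 (m≤m+n 13 7)) r12 , trans (low 18 (m≤m+n 19 1)) r18) , M₂≡))
        where
        conclude : ∃[ t₃ ] ∃[ s₃ ] Exec threshold s₂ t₃ s₃ × t₃ ≤ 1 + (n * n * 7 + 1) ×
                   (∀ a → a < n * n → mem s₃ a ≡ answer repeats half (out₀ a)) → Answered
        conclude (_ , _ , exec₃ , t₃≤ , answers) =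
            (λ a → subst (_< 2 ^ w) (M₂≡ a) (proj₂ (exec-bounded exec₂ bounded₁) a))
          , _ , _ , (_ , seq build₁ (seq exec₂ exec₃)) , +-mono-≤ t₁≤ (+-monoʳ-≤ t₀ t₃≤) , answers

  algorithm-ok : ∀ (fits : Fits) (α β : ℕ → ℕ → Bool) → wrap (cell input 0) ≡ n → bitLength n ≡ b →
    (∀ k x → k < n → x < n → wrap (cell input (1 + (n * k + x))) ≡ bit (α k x)) →
    (∀ k x → k < n → x < n → wrap (cell input (1 + n * n + (n * k + x))) ≡ bit (β k x)) →
    (∀ i → wrap (cell input (area + i)) ≡ 0) →
    ∀ {P t₀ out₀} (run₀ : Run w P (target α β) t₀ out₀) → Answered fits {xs = target α β} run₀
  algorithm-ok fits α β size≡ bits≡ α≡ β≡ zero≡ run₀ =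
    let _ , _ , build₁ , t₁≤ , built = build-ok fits α β size≡ bits≡ α≡ β≡ zero≡ (initial input) ((λ _ → refl) , (λ _ → refl))
    in answer-after fits run₀ build₁ t₁≤ built

-- Rank as a letter count

count : ℕ → List ℕ → ℕ
count c []       = 0
count c (x ∷ xs) = bit (x ≡ᵇ c) + count c xs

count-++ : ∀ c xs ys → count c (xs ++ ys) ≡ count c xs + count c ys
count-++ c []       ys = refl
count-++ c (x ∷ xs) ys = trans (cong (bit (x ≡ᵇ c) +_) (count-++ c xs ys)) (sym (+-assoc (bit (x ≡ᵇ c)) _ _))

≡ᵇ-refl : ∀ n → (n ≡ᵇ n) ≡ true
≡ᵇ-refl zero    = refl
≡ᵇ-refl (suc n) = ≡ᵇ-refl n

≢⇒≡ᵇ-false : ∀ m n → m ≢ n → (m ≡ᵇ n) ≡ false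
≢⇒≡ᵇ-false zero    zero    m≢n = ⊥-elim (m≢n refl)
≢⇒≡ᵇ-false zero    (suc n) m≢n = refl
≢⇒≡ᵇ-false (suc m) zero    m≢n = refl
≢⇒≡ᵇ-false (suc m) (suc n) m≢n = ≢⇒≡ᵇ-false m n (m≢n ∘ cong suc)

count-∉ : ∀ {c xs} → All (_≢ c) xs → count c xs ≡ 0
count-∉ []                    = refl
count-∉ {c} {x ∷ _} (x≢c ∷ p) rewrite ≢⇒≡ᵇ-false x c x≢c = count-∉ p

count-∈ : ∀ {c xs} → c ∈ xs → 1 ≤ count c xs
count-∈ {c} (here refl) rewrite ≡ᵇ-refl c = s≤s z≤n
count-∈ {c} {x ∷ _} (there c∈) = ≤-trans (count-∈ c∈) (m≤n+m _ (bit (x ≡ᵇ c)))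

-- Reindexing for the induction on the string: the tail of `allFin (suc N)` is a tabulation of
-- successors and has to be compared with `allFin N`.
length-filter-tabulate : ∀ {k m n} {P : Fin m → Set} {Q : Fin n → Set}
  (P? : ∀ i → Dec (P i)) (Q? : ∀ i → Dec (Q i)) (f : Fin k → Fin m) (g : Fin k → Fin n) →
  (∀ i → P (f i) ⇔ Q (g i)) → length (filter P? (tabulate f)) ≡ length (filter Q? (tabulate g))
length-filter-tabulate {zero}  P? Q? f g P⇔Q = refl
length-filter-tabulate {suc k} P? Q? f g P⇔Q
  with ih ← length-filter-tabulate P? Q? (f ∘ Fin.suc) (g ∘ Fin.suc) (P⇔Q ∘ Fin.suc)
  with P? (f Fin.zero) | Q? (g Fin.zero)
... | yes p | yes q = cong suc ih
... | yes p | no ¬q = ⊥-elim (¬q (Equivalence.to (P⇔Q Fin.zero) p))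
... | no ¬p | yes q = ⊥-elim (¬p (Equivalence.from (P⇔Q Fin.zero) q))
... | no ¬p | no ¬q = ih

module _ {σ : ℕ} where

  InRange : ∀ {N} → Vec (Fin σ) N → ℕ → ℕ → Fin σ → Fin N → Set
  InRange T b e c i = b < suc (toℕ i) × suc (toℕ i) ≤ e × lookup T i ≡ c

  inRange? : ∀ {N} (T : Vec (Fin σ) N) b e c i → Dec (InRange T b e c i)
  inRange? T b e c i = (b <? suc (toℕ i)) ×-dec (suc (toℕ i) ≤? e) ×-dec (lookup T i Finₚ.≟ c)

  -- The bounds are freed from `Fin (suc N)` so that the induction can shift them; on actual queries
  -- it agrees with `rank` by definition.
  rankℕ : ∀ {N} → Vec (Fin σ) N → ℕ → ℕ → Fin σ → ℕ
  rankℕ {N} T b e c = length (filter (inRange? T b e c) (allFin N))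

  rankℕ-skip : ∀ {N} x (T : Vec (Fin σ) N) b e c → rankℕ (x ∷ T) (suc b) (suc e) c ≡ rankℕ T b e c
  rankℕ-skip {N} x T b e c =
    trans (cong length (filter-reject (inRange? (x ∷ T) (suc b) (suc e) c) {Fin.zero} {tabulate {n = N} Fin.suc} λ { (s≤s () , _) }))
      (length-filter-tabulate (inRange? (x ∷ T) (suc b) (suc e) c) (inRange? T b e c) Fin.suc (λ i → i)
        λ i → mk⇔ (λ (p , q , r) → s<s⁻¹ p , s≤s⁻¹ q , r) (λ (p , q , r) → s≤s p , s≤s q , r))

  rankℕ-take : ∀ {N} x (T : Vec (Fin σ) N) e c →
               rankℕ (x ∷ T) 0 (suc e) c ≡ bit (toℕ x ≡ᵇ toℕ c) + rankℕ T 0 e c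
  rankℕ-take {N} x T e c = trans (hit (x Finₚ.≟ c)) (cong (bit (toℕ x ≡ᵇ toℕ c) +_)
    (length-filter-tabulate (inRange? (x ∷ T) 0 (suc e) c) (inRange? T 0 e c) Fin.suc (λ i → i)
      λ i → mk⇔ (λ (p , q , r) → s≤s z≤n , s≤s⁻¹ q , r) (λ (p , q , r) → s≤s z≤n , s≤s q , r)))
    where
    rest = tabulate {n = N} Fin.suc
    hit : Dec (x ≡ c) → length (filter (inRange? (x ∷ T) 0 (suc e) c) (Fin.zero ∷ rest)) ≡
                        bit (toℕ x ≡ᵇ toℕ c) + length (filter (inRange? (x ∷ T) 0 (suc e) c) rest)
    hit (yes refl) rewrite ≡ᵇ-refl (toℕ x) =
      cong length (filter-accept (inRange? (x ∷ T) 0 (suc e) x) {Fin.zero} {rest} (s≤s z≤n , s≤s z≤n , refl))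
    hit (no x≢c) rewrite ≢⇒≡ᵇ-false (toℕ x) (toℕ c) (x≢c ∘ Finₚ.toℕ-injective) =
      cong length (filter-reject (inRange? (x ∷ T) 0 (suc e) c) {Fin.zero} {rest} λ (_ , _ , r) → x≢c r)

  rankℕ-empty : ∀ {N} (T : Vec (Fin σ) N) c → rankℕ T 0 0 c ≡ 0
  rankℕ-empty {N} T c = cong length (filter-none (inRange? T 0 0 c) (All.universal (λ { i (_ , () , _) }) (allFin N)))

  -- Letters of `u` are dropped while both bounds go down together; then letters of `v` are counted
  -- one at a time while only the upper bound goes down.
  rankℕ-segment : ∀ {N} (T : Vec (Fin σ) N) u v {z} c → List.map toℕ (toList T) ≡ u ++ v ++ z →
                  rankℕ T (length u) (length u + length v) c ≡ count (toℕ c) v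
  rankℕ-segment T       []      []      c xs≡ = rankℕ-empty T c
  rankℕ-segment (x ∷ T) []      (y ∷ v) c xs≡ with refl , xs≡′ ← ∷-injective xs≡ =
    trans (rankℕ-take x T (length v) c) (cong (bit (toℕ x ≡ᵇ toℕ c) +_) (rankℕ-segment T [] v c xs≡′))
  rankℕ-segment (x ∷ T) (y ∷ u) v       c xs≡ =
    trans (rankℕ-skip x T (length u) _ c) (rankℕ-segment T u v c (∷-injectiveʳ xs≡))

-- f on the first a arguments, then g, renumbered from 0.
seg : ∀ {B : Set} → ℕ → (f g : ℕ → B) → ℕ → B
seg zero    f g x       = g x
seg (suc a) f g zero    = f 0
seg (suc a) f g (suc x) = seg a (f ∘ suc) g x

module _ {B : Set} where
  seg-< : ∀ {a} {f g : ℕ → B} {x} → x < a → seg a f g x ≡ f x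
  seg-< {suc a} {x = zero}  x<a       = refl
  seg-< {suc a} {x = suc x} (s≤s x<a) = seg-< x<a

  seg-+ : ∀ a {f g : ℕ → B} y → seg a f g (a + y) ≡ g y
  seg-+ zero    y = refl
  seg-+ (suc a) y = seg-+ a y

  seg-elim : ∀ (P : ℕ → B → Set) a {f g b} → (∀ x → x < a → P x (f x)) → (∀ y → y < b → P (a + y) (g y)) →
             ∀ x → x < a + b → P x (seg a f g x)
  seg-elim P zero    pf pg x       x<       = pg x x<
  seg-elim P (suc a) pf pg zero    x<       = pf 0 z<s
  seg-elim P (suc a) pf pg (suc x) (s≤s x<) =
    seg-elim (P ∘ suc) a (λ x x< → pf (suc x) (s<s x<)) pg x x<

-- Blocks of a sequence

module _ {A : Set} where

  concatUpTo : (ℕ → List A) → ℕ → List A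
  concatUpTo f zero    = []
  concatUpTo f (suc n) = f 0 ++ concatUpTo (f ∘ suc) n

  concatUpTo-cong : ∀ {f g} n → (∀ x → x < n → f x ≡ g x) → concatUpTo f n ≡ concatUpTo g n
  concatUpTo-cong zero    f≡g = refl
  concatUpTo-cong (suc n) f≡g = cong₂ _++_ (f≡g 0 z<s) (concatUpTo-cong n (λ x x<n → f≡g (suc x) (s<s x<n)))

  concatUpTo-snoc : ∀ f n → concatUpTo f (suc n) ≡ concatUpTo f n ++ f n
  concatUpTo-snoc f zero    = ++-identityʳ (f 0)
  concatUpTo-snoc f (suc n) = trans (cong (f 0 ++_) (concatUpTo-snoc (f ∘ suc) n)) (sym (++-assoc (f 0) _ _))

  loopTo-++ : ∀ {h : ℕ → List A → List A} {f} → (∀ x zs → h x zs ≡ f x ++ zs) →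
              ∀ n zs → loopTo h n zs ≡ concatUpTo f n ++ zs
  loopTo-++ h≡ zero    zs = refl
  loopTo-++ {h} {f} h≡ (suc n) zs = begin
    loopTo h n (h n zs)             ≡⟨ loopTo-++ h≡ n _ ⟩
    concatUpTo f n ++ h n zs        ≡⟨ cong (concatUpTo f n ++_) (h≡ n zs) ⟩
    concatUpTo f n ++ f n ++ zs     ≡⟨ sym (++-assoc (concatUpTo f n) (f n) zs) ⟩
    (concatUpTo f n ++ f n) ++ zs   ≡⟨ cong (_++ zs) (sym (concatUpTo-snoc f n)) ⟩
    concatUpTo f (suc n) ++ zs      ∎
    where open ≡-Reasoning

  loopTo-∷ : ∀ (f : ℕ → A) n zs → loopTo (λ x → f x ∷_) n zs ≡ applyUpTo f n ++ zs
  loopTo-∷ f zero    zs = refl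
  loopTo-∷ f (suc n) zs = begin
    loopTo (λ x → f x ∷_) n (f n ∷ zs)  ≡⟨ loopTo-∷ f n (f n ∷ zs) ⟩
    applyUpTo f n ++ f n ∷ zs           ≡⟨ sym (++-assoc (applyUpTo f n) (f n ∷ []) zs) ⟩
    (applyUpTo f n List.∷ʳ f n) ++ zs   ≡⟨ cong (_++ zs) (applyUpTo-∷ʳ f n) ⟩
    applyUpTo f (suc n) ++ zs           ∎
    where open ≡-Reasoning

  concat-tabulate : ∀ n {F : Fin n → List A} {f} → (∀ i → F i ≡ f (toℕ i)) → List.concat (tabulate F) ≡ concatUpTo f n
  concat-tabulate zero    F≡ = refl
  concat-tabulate (suc n) F≡ = cong₂ _++_ (F≡ Fin.zero) (concat-tabulate n (F≡ ∘ Fin.suc))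

  concatMap-allFin : ∀ n {F : Fin n → List A} {f} → (∀ i → F i ≡ f (toℕ i)) → concatMap F (allFin n) ≡ concatUpTo f n
  concatMap-allFin n {F} F≡ = trans (cong List.concat (map-tabulate (λ i → i) F)) (concat-tabulate n F≡)

  concatUpTo-All : ∀ {P : A → Set} f n → (∀ x → x < n → All P (f x)) → All P (concatUpTo f n)
  concatUpTo-All f zero    p = []
  concatUpTo-All f (suc n) p = Allₚ.++⁺ (p 0 z<s) (concatUpTo-All (f ∘ suc) n (λ x x<n → p (suc x) (s<s x<n)))

  concatUpTo-split : ∀ f {n} i → i < n → ∃[ v ] concatUpTo f n ≡ concatUpTo f i ++ f i ++ v
  concatUpTo-split f {suc n} zero    i<n       = _ , refl
  concatUpTo-split f {suc n} (suc i) (s≤s i<n) =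
    let v , xs≡ = concatUpTo-split (f ∘ suc) i i<n in v , trans (cong (f 0 ++_) xs≡) (sym (++-assoc (f 0) _ _))

  length-concatUpTo : ∀ {f : ℕ → List A} {ℓ} → (∀ x → length (f x) ≡ ℓ) → ∀ n → length (concatUpTo f n) ≡ n * ℓ
  length-concatUpTo         ℓ≡ zero    = refl
  length-concatUpTo {f} {ℓ} ℓ≡ (suc n) = trans (length-++ (f 0)) (cong₂ _+_ (ℓ≡ 0) (length-concatUpTo (ℓ≡ ∘ suc) n))

  selfConcat : ℕ → List A → List A
  selfConcat zero    xs = xs
  selfConcat (suc t) xs = selfConcat t xs ++ selfConcat t xs

  length-selfConcat : ∀ t xs → length (selfConcat t xs) ≡ 2 ^ t * length xs
  length-selfConcat zero    xs = sym (+-identityʳ _)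
  length-selfConcat (suc t) xs = begin
    length (selfConcat t xs ++ selfConcat t xs)          ≡⟨ length-++ (selfConcat t xs) ⟩
    length (selfConcat t xs) + length (selfConcat t xs)  ≡⟨ cong₂ _+_ ih ih ⟩
    2 ^ t * length xs + 2 ^ t * length xs                ≡⟨ solve 2 (λ p l → p :* l :+ p :* l := con 2 :* p :* l) refl (2 ^ t) (length xs) ⟩
    2 ^ suc t * length xs                                ∎
    where
    open ≡-Reasoning
    ih = length-selfConcat t xs

  selfConcat-All : ∀ {P : A → Set} t {xs} → All P xs → All P (selfConcat t xs)
  selfConcat-All zero    p = p
  selfConcat-All (suc t) p = Allₚ.++⁺ (selfConcat-All t p) (selfConcat-All t p)

  concatUpTo-seg : ∀ {B : Set} (F : B → List A) a {f g} b →
    concatUpTo (F ∘ seg a f g) (a + b) ≡ concatUpTo (F ∘ f) a ++ concatUpTo (F ∘ g) b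
  concatUpTo-seg F zero    b = refl
  concatUpTo-seg F (suc a) {f} b = trans (cong (F (f 0) ++_) (concatUpTo-seg F a b)) (sym (++-assoc (F (f 0)) _ _))

count-selfConcat : ∀ c t xs → count c (selfConcat t xs) ≡ 2 ^ t * count c xs
count-selfConcat c zero    xs = sym (+-identityʳ _)
count-selfConcat c (suc t) xs = begin
  count c (selfConcat t xs ++ selfConcat t xs)           ≡⟨ count-++ c (selfConcat t xs) _ ⟩
  count c (selfConcat t xs) + count c (selfConcat t xs)  ≡⟨ cong₂ _+_ ih ih ⟩
  2 ^ t * count c xs + 2 ^ t * count c xs                ≡⟨ solve 2 (λ p l → p :* l :+ p :* l := con 2 :* p :* l) refl (2 ^ t) (count c xs) ⟩
  2 ^ suc t * count c xs                                 ∎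
  where
  open ≡-Reasoning
  ih = count-selfConcat c t xs

sum-concatUpTo : ∀ {f : ℕ → List ℕ} {ℓ} n → (∀ x → x < n → sum (f x) ≡ ℓ) → sum (concatUpTo f n) ≡ n * ℓ
sum-concatUpTo         zero    ℓ≡ = refl
sum-concatUpTo {f} {ℓ} (suc n) ℓ≡ = trans (sum-++ (f 0) _) (cong₂ _+_ (ℓ≡ 0 z<s) (sum-concatUpTo n (λ x x<n → ℓ≡ (suc x) (s<s x<n))))

-- Derivations in a straight-line grammar

module _ {σ : ℕ} (G : SLG σ) where
  open SLG G

  private
    _⟶*_ : List (Symbol ∣V∣ σ) → List (Symbol ∣V∣ σ) → Set
    _⟶*_ = Star (_⟶_ G)

  derive-++ʳ : ∀ {xs ys} zs → xs ⟶* ys → (xs ++ zs) ⟶* (ys ++ zs)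
  derive-++ʳ zs = Star.gmap (_++ zs) λ { (rewrite-at u X v) →
    subst₂ (_⟶_ G) (sym (++-assoc u (nonterminal X ∷ v) zs))
      (sym (trans (++-assoc u (rhs X ++ v) zs) (cong (u ++_) (++-assoc (rhs X) v zs))))
      (rewrite-at u X (v ++ zs)) }

  derive-++ˡ : ∀ {xs ys} zs → xs ⟶* ys → (zs ++ xs) ⟶* (zs ++ ys)
  derive-++ˡ zs = Star.gmap (zs ++_) λ { (rewrite-at u X v) →
    subst₂ (_⟶_ G) (++-assoc zs u (nonterminal X ∷ v)) (++-assoc zs u (rhs X ++ v)) (rewrite-at (zs ++ u) X v) }

  derive-++ : ∀ {xs ys us vs} → xs ⟶* ys → us ⟶* vs → (xs ++ us) ⟶* (ys ++ vs)
  derive-++ {ys = ys} {us} p q = derive-++ʳ us p ◅◅ derive-++ˡ ys q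

  derive-rhs : ∀ {X ys} → rhs X ⟶* ys → (nonterminal X ∷ []) ⟶* ys
  derive-rhs {X} {ys} p = rewrite-at [] X [] ◅ subst (_⟶* ys) (sym (++-identityʳ (rhs X))) p

-- Elements of `Fin` are made from numbers by reduction, so definitions carry no range proofs; in
-- range the reduction does nothing.
toℕ-mod : ∀ {x m} .{{_ : NonZero m}} → x < m → toℕ (x modulo m) ≡ x
toℕ-mod {x} {m} x<m = trans (Finₚ.toℕ-fromℕ< (m%n<n x m)) (m<n⇒m%n≡m x<m)

map-toℕ-mod : ∀ {m xs} .{{_ : NonZero m}} → All (_< m) xs → List.map toℕ (List.map (_modulo m) xs) ≡ xs
map-toℕ-mod []       = refl
map-toℕ-mod (p ∷ ps) = cong₂ _∷_ (toℕ-mod p) (map-toℕ-mod ps)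

-- The grammar

-- Symbols by number; terminals are numbered from 0.
data Sym : Set where
  nt tm : ℕ → Sym

module Grammar (n b c K e : ℕ) .{{_ : NonZero n}} (α β : ℕ → ℕ → Bool) (n<σ : n < Parameters.σ n b c K e) where

  open Parameters n b c K e

  instance
    σ≢0 : NonZero σ
    σ≢0 = >-nonZero (≤-<-trans z≤n n<σ)

  -- The default n serves twice: the padding row follows the n rows of B, and the padding letter
  -- follows the n column letters.
  sel : Bool → ℕ → ℕ
  sel β x = if β then x else n

  sel-≤ : ∀ β {x} → x < n → sel β x ≤ n
  sel-≤ true  x< = <⇒≤ x<
  sel-≤ false x< = ≤-refl

  -- Nonterminals: 0 is the start symbol, the next doublings + n ones are, level by level,
  -- the iterated squares of the rows of A, then come the rows of B and the padding row.
  firstRow : ℕ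
  firstRow = suc (doublings + n)

  rule : ℕ → List Sym
  rule =
    seg 1 (λ _ → applyUpTo (λ i → nt (1 + i)) n)
    -- A level has n nonterminals, so adding n leads to the same row of A one level further on.
    (seg doublings (λ x → nt (suc n + x) ∷ nt (suc n + x) ∷ [])
    (seg n (λ i → applyUpTo (λ k → nt (firstRow + sel (α i k) k)) n)
    (seg n (λ k → applyUpTo (λ j → tm (sel (β k j) j)) n)
    (λ _ → applyUpTo (λ _ → tm n) n))))

  -- Rules refer only to larger numbers, so the identity permutation witnesses acyclicity.
  WellFormed : ℕ → Sym → Set
  WellFormed i (nt x) = i < x × x < nonterminals
  WellFormed i (tm a) = a < σ

  rule-wellFormed : ∀ i → i < nonterminals → All (WellFormed i) (rule i)
  rule-wellFormed = seg-elim WF 1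
    (λ { zero _ → Allₚ.applyUpTo⁺₁ _ n λ i< → z<s , s≤s (<-≤-trans i< (≤-trans (m≤m+n n (n + 1)) (m≤n+m _ doublings))) ; (suc _) (s≤s ()) })
    (seg-elim (WF ∘ suc) doublings (λ x x< → let wf = chain x x< in wf ∷ wf ∷ [])
    (seg-elim (λ y → WF (suc (doublings + y))) n
      (λ i i< → Allₚ.applyUpTo⁺₁ _ n λ {k} k< →
        s≤s (≤-trans (≤-reflexive (sym (+-suc doublings i))) (≤-trans (+-monoʳ-≤ doublings i<) (m≤m+n _ _)))
        , s≤s (subst (doublings + n + sel (α i k) k <_) (+-assoc doublings n (n + 1)) (+-monoʳ-< (doublings + n) (≤-<-trans (sel-≤ (α i k) k<) n<n+1))))
    (seg-elim (λ z → WF (suc (doublings + (n + z)))) n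
      (λ k k< → Allₚ.applyUpTo⁺₁ _ n λ {j} j< → ≤-<-trans (sel-≤ (β k j) j<) n<σ)
      (λ y _ → Allₚ.applyUpTo⁺₂ _ n λ _ → n<σ))))
    where
    WF : ℕ → List Sym → Set
    WF i = All (WellFormed i)
    n<n+1 : n < n + 1
    n<n+1 = ≤-reflexive (+-comm 1 n)
    chain : ∀ x → x < doublings → WellFormed (suc x) (nt (suc n + x))
    chain x x< = s≤s (m<n+m x (>-nonZero⁻¹ n))
               , s≤s (<-≤-trans (subst (_< doublings + n) (+-comm x n) (+-monoˡ-< n x<)) (+-monoʳ-≤ doublings (m≤m+n n (n + 1))))

  toSymbol : Sym → Symbol nonterminals σ
  toSymbol (nt x) = nonterminal (x modulo nonterminals)
  toSymbol (tm a) = terminal (a modulo σ)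

  grammar : SLG σ
  grammar = record
    { ∣V∣     = nonterminals
    ; rhs     = λ X → List.map toSymbol (rule (toℕ X))
    ; start   = Fin.zero
    ; order   = Permutation.id
    ; acyclic = λ i j j∈ → later i j (∈-map⁻ toSymbol j∈)
    }
    where
    later : ∀ i j → (∃[ s ] s ∈ rule (toℕ i) × nonterminal j ≡ toSymbol s) → toℕ i < toℕ j
    later i j (nt x , x∈ , refl) =
      let i<x , x< = All.lookup (rule-wellFormed (toℕ i) (Finₚ.toℕ<n i)) x∈ in
      subst (toℕ i <_) (sym (toℕ-mod x<)) i<x

  open SLG grammar using (rhs)

  _⟶*_ : List (Symbol nonterminals σ) → List (Symbol nonterminals σ) → Set
  _⟶*_ = Star (_⟶_ grammar)

  letters : List ℕ → List (Symbol nonterminals σ)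
  letters = List.map (λ a → terminal (a modulo σ))

  _yields_ : Sym → List ℕ → Set
  s yields xs = (toSymbol s ∷ []) ⟶* letters xs

  yield-rule : ∀ {x ys} → x < nonterminals → List.map toSymbol (rule x) ⟶* letters ys → nt x yields ys
  yield-rule {x} {ys} x< p = derive-rhs grammar
    (subst (λ z → List.map toSymbol (rule z) ⟶* letters ys) (sym (toℕ-mod x<)) p)

  yield-++ : ∀ {ss ts ys zs} → List.map toSymbol ss ⟶* letters ys → List.map toSymbol ts ⟶* letters zs →
             List.map toSymbol (ss ++ ts) ⟶* letters (ys ++ zs)
  yield-++ {ss} {ts} {ys} {zs} p q =
    subst₂ _⟶*_ (sym (map-++ toSymbol ss ts)) (sym (map-++ _ ys zs)) (derive-++ grammar p q)

  yield-concat : ∀ (h : ℕ → Sym) (y : ℕ → List ℕ) m → (∀ x → x < m → h x yields y x) →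
                 List.map toSymbol (applyUpTo h m) ⟶* letters (concatUpTo y m)
  yield-concat h y zero    p = ε
  yield-concat h y (suc m) p =
    yield-++ {h 0 ∷ []} {applyUpTo (h ∘ suc) m} {y 0} (p 0 z<s)
      (yield-concat (h ∘ suc) (y ∘ suc) m (λ x x< → p (suc x) (s<s x<)))

  yield-letters : ∀ (h : ℕ → ℕ) m → List.map toSymbol (applyUpTo (tm ∘ h) m) ⟶* letters (applyUpTo h m)
  yield-letters h m = subst (List.map toSymbol (applyUpTo (tm ∘ h) m) ⟶*_)
    (trans (map-applyUpTo (tm ∘ h) toSymbol m) (sym (map-applyUpTo h (λ a → terminal (a modulo σ)) m))) ε

  rowB padding : ℕ → List ℕ
  rowB k    = applyUpTo (λ j → sel (β k j) j) n
  padding _ = applyUpTo (λ _ → n) n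

  item : ℕ → ℕ → List ℕ
  item i k = (if α i k then rowB else padding) k

  rowA : ℕ → List ℕ
  rowA i = concatUpTo (item i) n

  block : ℕ → List ℕ
  block i = selfConcat levels (rowA i)

  text : List ℕ
  text = concatUpTo block n

  rule-double : ∀ {x} → x < doublings → rule (suc x) ≡ nt (suc n + x) ∷ nt (suc n + x) ∷ []
  rule-double = seg-<

  rule-A : ∀ {i} → i < n → rule (suc (doublings + i)) ≡ applyUpTo (λ k → nt (firstRow + sel (α i k) k)) n
  rule-A {i} i< = trans (seg-+ doublings i) (seg-< i<)

  rule-B : ∀ {k} → k < n → rule (firstRow + k) ≡ applyUpTo (λ j → tm (sel (β k j) j)) n
  rule-B {k} k< = trans (cong (rule ∘ suc) (+-assoc doublings n k))
    (trans (seg-+ doublings (n + k)) (trans (seg-+ n k) (seg-< k<)))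

  rule-padding : rule (firstRow + n) ≡ applyUpTo (λ _ → tm n) n
  rule-padding = trans (cong (rule ∘ suc) (+-assoc doublings n n))
    (trans (seg-+ doublings (n + n)) (trans (seg-+ n n)
      -- The padding row is number 0 behind the rows of B, so n is read as n + 0.
      (trans (cong (seg n _ _) (sym (+-identityʳ n))) (seg-+ n 0))))

  <nonterminals : ∀ {x} → x ≤ n → firstRow + x < nonterminals
  <nonterminals {x} x≤ = s≤s (begin
    suc (doublings + n + x)      ≡⟨ sym (+-suc (doublings + n) x) ⟩
    doublings + n + suc x        ≤⟨ +-monoʳ-≤ (doublings + n) (s≤s x≤) ⟩
    doublings + n + suc n        ≡⟨ cong (doublings + n +_) (+-comm 1 n) ⟩
    doublings + n + (n + 1)      ≡⟨ +-assoc doublings n (n + 1) ⟩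
    doublings + (n + (n + 1))    ∎)
    where open ≤-Reasoning

  yield-item : ∀ i k → k < n → nt (firstRow + sel (α i k) k) yields item i k
  yield-item i k k< with α i k
  ... | true  = yield-rule (<nonterminals (<⇒≤ k<))
    (subst (λ ss → List.map toSymbol ss ⟶* letters (rowB k)) (sym (rule-B k<)) (yield-letters (λ j → sel (β k j) j) n))
  ... | false = yield-rule (<nonterminals ≤-refl)
    (subst (λ ss → List.map toSymbol ss ⟶* letters (padding k)) (sym rule-padding) (yield-letters (λ _ → n) n))

  -- Induction on the number t of levels still ahead of level l. Each level squares what the next
  -- one yields, and at t = 0 the nonterminal is row i of A itself.
  yield-block : ∀ t l i → l + t ≡ levels → i < n → nt (suc (l * n + i)) yields selfConcat t (rowA i)
  yield-block zero l i eq≡ i<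
    rewrite trans (sym (+-identityʳ l)) eq≡ =
    yield-rule (s≤s (+-monoʳ-< doublings (<-≤-trans i< (m≤m+n n (n + 1)))))
      (subst (λ ss → List.map toSymbol ss ⟶* letters (rowA i)) (sym (rule-A i<))
        (yield-concat _ (item i) n (yield-item i)))
  yield-block (suc t) l i eq≡ i< =
    yield-rule (s≤s (<-≤-trans x< (m≤m+n doublings _)))
      (subst (λ ss → List.map toSymbol ss ⟶* letters (selfConcat (suc t) (rowA i))) (sym (rule-double x<))
        (yield-++ {nt next ∷ []} {nt next ∷ []} {selfConcat t (rowA i)} child child))
    where
    next = suc n + (l * n + i)
    x< : l * n + i < doublings
    x< = <-≤-trans (subst (l * n + i <_) (+-comm (l * n) n) (+-monoʳ-< (l * n) i<))
           (*-monoˡ-≤ n (≤-trans (m≤m+n (suc l) t) (≤-reflexive (trans (sym (+-suc l t)) eq≡))))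
    child : nt next yields selfConcat t (rowA i)
    child = subst (λ z → nt (suc z) yields selfConcat t (rowA i)) (+-assoc n (l * n) i)
             (yield-block t (suc l) i (trans (sym (+-suc l t)) eq≡) i<)

  yield-text : (nonterminal Fin.zero ∷ []) ⟶* letters text
  yield-text = derive-rhs grammar (yield-concat _ block n λ i i< → yield-block levels 0 i refl i<)

  N : ℕ
  N = length (List.map (_modulo σ) text)

  string : Vec (Fin σ) N
  string = fromList (List.map (_modulo σ) text)

  generates : Generates grammar string
  generates = subst ((nonterminal Fin.zero ∷ []) ⟶*_)
    (trans (map-∘ text) (cong (List.map terminal) (sym (Vecₚ.toList∘fromList (List.map (_modulo σ) text))))) yield-text

  length-item : ∀ i k → length (item i k) ≡ n
  length-item i k with α i k
  ... | true  = length-applyUpTo _ n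
  ... | false = length-applyUpTo _ n

  length-block : ∀ i → length (block i) ≡ blockLength
  length-block i = begin
    length (selfConcat levels (rowA i))             ≡⟨ length-selfConcat levels (rowA i) ⟩
    2 ^ levels * length (rowA i)                    ≡⟨ cong (2 ^ levels *_) (length-concatUpTo (length-item i) n) ⟩
    2 ^ (b * e + 1) * (n * n)                       ≡⟨ cong (λ z → 2 ^ z * (n * n)) (+-comm (b * e) 1) ⟩
    2 * repeats * (n * n)                           ≡⟨ solve 2 (λ r x → con 2 :* r :* x := x :* r :+ x :* r) refl repeats (n * n) ⟩
    blockLength                                     ∎
    where open ≡-Reasoning

  N≡ : N ≡ n * blockLength
  N≡ = trans (length-map _ text) (length-concatUpTo length-block n)

  item-<σ : ∀ i k → All (_< σ) (item i k)
  item-<σ i k with α i k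
  ... | true  = Allₚ.applyUpTo⁺₁ _ n λ {j} j< → ≤-<-trans (sel-≤ (β k j) j<) n<σ
  ... | false = Allₚ.applyUpTo⁺₂ _ n λ _ → n<σ

  text-<σ : All (_< σ) text
  text-<σ = concatUpTo-All block n λ i _ → selfConcat-All levels (concatUpTo-All (item i) n λ k _ → item-<σ i k)

  rank-block : ∀ i j → i < n → j < n →
    rankℕ string (i * blockLength) (i * blockLength + blockLength) (j modulo σ) ≡ 2 ^ levels * count j (rowA i)
  rank-block i j i< j< with v , text≡ ← concatUpTo-split block i i< = begin
    rankℕ string (i * blockLength) (i * blockLength + blockLength) (j modulo σ)
      ≡⟨ cong₂ (λ x y → rankℕ string x (x + y) (j modulo σ))
           (sym (length-concatUpTo length-block i)) (sym (length-block i)) ⟩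
    rankℕ string (length (concatUpTo block i)) (length (concatUpTo block i) + length (block i)) (j modulo σ)
      ≡⟨ rankℕ-segment string (concatUpTo block i) (block i) (j modulo σ) (begin
           List.map toℕ (toList string)          ≡⟨ cong (List.map toℕ) (Vecₚ.toList∘fromList _) ⟩
           List.map toℕ (List.map (_modulo σ) text) ≡⟨ map-toℕ-mod text-<σ ⟩
           text                                  ≡⟨ text≡ ⟩
           _                                     ∎) ⟩
    count (toℕ (j modulo σ)) (block i)
      ≡⟨ cong (λ z → count z (block i)) (toℕ-mod (<-trans j< n<σ)) ⟩
    count j (selfConcat levels (rowA i))
      ≡⟨ count-selfConcat j levels (rowA i) ⟩
    2 ^ levels * count j (rowA i) ∎
    where open ≡-Reasoning

  count-item : ∀ {i j k} → j < n → k < n → α i k ∧ β k j ≡ true → j ∈ item i k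
  count-item {i} {j} {k} j< k< eq≡ with α i k
  count-item {i} {j} {k} j< k< eq≡ | true =
    subst (_∈ rowB k) (cong (λ z → if z then j else n) eq≡) (∈-applyUpTo⁺ (λ j → sel (β k j) j) j<)

  -- The letter j can only come from column j of row k of B. Any other column shows its own letter
  -- or n, and n differs from j because j < n.
  item-avoids : ∀ {i j k} → j < n → α i k ∧ β k j ≡ false → All (_≢ j) (item i k)
  item-avoids {i} {j} {k} j< eq≡ with α i k
  ... | false = Allₚ.applyUpTo⁺₂ _ n λ _ n≡j → <⇒≢ j< (sym n≡j)
  ... | true  = Allₚ.applyUpTo⁺₁ _ n λ {x} _ x≡j → avoid x (β k x) refl x≡j
    where
    avoid : ∀ x z → β k x ≡ z → sel z x ≢ j
    avoid x true  βx refl with () ← trans (sym βx) eq≡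
    avoid x false βx n≡j = <⇒≢ j< (sym n≡j)

  count-positive : ∀ {i j k} → j < n → k < n → α i k ∧ β k j ≡ true → 1 ≤ count j (rowA i)
  count-positive {i} {j} {k} j< k< eq≡ with v , row≡ ← concatUpTo-split (item i) k k< =
    count-∈ (subst (j ∈_) (sym row≡) (∈-++⁺ʳ (concatUpTo (item i) k) (∈-++⁺ˡ (count-item j< k< eq≡))))

  count-zero : ∀ {i j} → j < n → (∀ k → k < n → α i k ∧ β k j ≡ false) → count j (rowA i) ≡ 0
  count-zero {i} j< eq≡ = count-∉ (concatUpTo-All (item i) n λ k k< → item-avoids j< (eq≡ k k<))

  queryOf : ℕ → Query N σ
  queryOf x = query (x / n * blockLength modulo suc N) ((x / n * blockLength + blockLength) modulo suc N) (x % n modulo σ)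

  queries : Vec (Query N σ) (n * n)
  queries = Vec.tabulate (queryOf ∘ toℕ)

  block≤N : ∀ {i} → i < n → i * blockLength + blockLength ≤ N
  block≤N {i} i< = ≤-trans (≤-reflexive (+-comm _ blockLength))
    (≤-trans (*-monoˡ-≤ blockLength i<) (≤-reflexive (sym N≡)))

  row-quotient : ∀ i j → j < n → (n * i + j) / n ≡ i
  row-quotient i j j< = begin
    (n * i + j) / n      ≡⟨ cong (λ z → (z + j) / n) (*-comm n i) ⟩
    (i * n + j) / n      ≡⟨ +-distrib-/ (i * n) j (subst (_< n) (sym (cong₂ _+_ (m*n%n≡0 i n) (m<n⇒m%n≡m j<))) j<) ⟩
    i * n / n + j / n    ≡⟨ cong₂ _+_ (m*n/n≡m i n) (m<n⇒m/n≡0 j<) ⟩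
    i + 0                ≡⟨ +-identityʳ i ⟩
    i                    ∎
    where open ≡-Reasoning

  row-remainder : ∀ i j → j < n → (n * i + j) % n ≡ j
  row-remainder i j j< = begin
    (n * i + j) % n      ≡⟨ cong (_% n) (trans (+-comm (n * i) j) (cong (j +_) (*-comm n i))) ⟩
    (j + i * n) % n      ≡⟨ [m+kn]%n≡m%n j i n ⟩
    j % n                ≡⟨ m<n⇒m%n≡m j< ⟩
    j                    ∎
    where open ≡-Reasoning

  rank-query : ∀ i j → i < n → j < n → rank string (queryOf (n * i + j)) ≡ 2 ^ levels * count j (rowA i)
  rank-query i j i< j<
    rewrite row-remainder i j j< | row-quotient i j j<
          | toℕ-mod {i * blockLength} {suc N} (s≤s (≤-trans (m≤m+n _ blockLength) (block≤N i<)))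
          | toℕ-mod {i * blockLength + blockLength} {suc N} (s≤s (block≤N i<)) = rank-block i j i< j<

  codeOf : Sym → ℕ
  codeOf (nt x) = suc (σ + x)
  codeOf (tm a) = suc a

  map-code : ∀ {code : Symbol nonterminals σ → ℕ} →
    (∀ X → code (nonterminal X) ≡ suc (σ + toℕ X)) → (∀ a → code (terminal a) ≡ suc (toℕ a)) →
    ∀ {i ss} → All (WellFormed i) ss → List.map code (List.map toSymbol ss) ≡ List.map codeOf ss
  map-code code-nt code-tm []                       = refl
  map-code code-nt code-tm {ss = nt x ∷ _} ((_ , x<) ∷ ps) =
    cong₂ _∷_ (trans (code-nt _) (cong (λ z → suc (σ + z)) (toℕ-mod x<))) (map-code code-nt code-tm ps)
  map-code code-nt code-tm {ss = tm a ∷ _} (a< ∷ ps) =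
    cong₂ _∷_ (trans (code-tm _) (cong suc (toℕ-mod a<))) (map-code code-nt code-tm ps)

  ruleCode : List Sym → List ℕ
  ruleCode ss = length ss ∷ List.map codeOf ss

  encode-rules : ∀ {code : Symbol nonterminals σ → ℕ} →
    (∀ X → code (nonterminal X) ≡ suc (σ + toℕ X)) → (∀ a → code (terminal a) ≡ suc (toℕ a)) →
    concatMap (λ X → length (rhs X) ∷ List.map code (rhs X)) (allFin nonterminals) ≡
    concatUpTo (ruleCode ∘ rule) nonterminals
  encode-rules code-nt code-tm = concatMap-allFin nonterminals {f = ruleCode ∘ rule} λ X → cong₂ _∷_ (length-map toSymbol (rule (toℕ X)))
    (map-code code-nt code-tm (rule-wellFormed (toℕ X) (Finₚ.toℕ<n X)))

  encode-queries : ∀ (enc : Query N σ → List ℕ) m (q : ℕ → Query N σ) {f} → (∀ x → x < m → enc (q x) ≡ f x) →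
    concatMap enc (toList (Vec.tabulate {n = m} (q ∘ toℕ))) ≡ concatUpTo f m
  encode-queries enc zero    q p = refl
  encode-queries enc (suc m) q p = cong₂ _++_ (p 0 z<s) (encode-queries enc m (q ∘ suc) (λ x x< → p (suc x) (s<s x<)))

  queryCode : ℕ → List ℕ
  queryCode x = x / n * blockLength ∷ x / n * blockLength + blockLength ∷ x % n + 1 ∷ []

  encodeQuery : Query N σ → List ℕ
  encodeQuery (query b e c) = toℕ b ∷ toℕ e ∷ suc (toℕ c) ∷ []

  code-queryOf : ∀ x → x < n * n →
    encodeQuery (queryOf x) ≡ queryCode x
  code-queryOf x x< = cong₂ _∷_ (toℕ-mod (s≤s (≤-trans (m≤m+n _ blockLength) (block≤N quotient<))))
    (cong₂ _∷_ (toℕ-mod (s≤s (block≤N quotient<)))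
    (cong (_∷ []) (trans (cong suc (toℕ-mod (<-trans (m%n<n x n) n<σ))) (+-comm 1 (x % n)))))
    where
    quotient< : x / n < n
    quotient< = m<n*o⇒m/o<n {x} {n} {n} x<

  map-code-upTo : ∀ (h : ℕ → Sym) {g : ℕ → ℕ} m → (∀ x → codeOf (h x) ≡ g x) →
                  ruleCode (applyUpTo h m) ≡ m ∷ applyUpTo g m
  map-code-upTo h {g} m p = cong₂ _∷_ (length-applyUpTo h m) (trans (map-applyUpTo h codeOf m) (applyUpTo-cong m p))
    where
    applyUpTo-cong : ∀ {f g : ℕ → ℕ} m → (∀ x → f x ≡ g x) → applyUpTo f m ≡ applyUpTo g m
    applyUpTo-cong zero    p = refl
    applyUpTo-cong (suc m) p = cong₂ _∷_ (p 0) (applyUpTo-cong m (p ∘ suc))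

  -- Links grammar and machine: what the loops write is literally the encoding on which the assumed
  -- program is to run. Both sides are cut into the same six parts behind the header, one for each
  -- loop over rules or queries; within a part only the bracketing of sums differs.
  encode≡target : encodeRank grammar queries ≡ target α β
  encode≡target = cong₂ _∷_ refl (cong₂ _∷_ refl (cong₂ _∷_ refl (cong₂ _∷_ (cong suc (+-identityʳ σ)) (begin
    _ ≡⟨ cong₂ _++_ (encode-rules (λ _ → refl) (λ _ → refl)) (encode-queries _ (n * n) queryOf code-queryOf) ⟩
    concatUpTo (ruleCode ∘ rule) nonterminals ++ queryPart
      ≡⟨ cong (λ z → (ruleCode (rule 0) ++ z) ++ queryPart) split ⟩
    (startPart ++ doublePart ++ partA ++ partB ++ padPart) ++ queryPart
      ≡⟨ trans (++-assoc startPart _ queryPart) (cong (startPart ++_)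
         (trans (++-assoc doublePart _ queryPart) (cong (doublePart ++_)
         (trans (++-assoc partA _ queryPart) (cong (partA ++_)
         (++-assoc partB padPart queryPart)))))) ⟩
    startPart ++ doublePart ++ partA ++ partB ++ padPart ++ queryPart
      ≡⟨ cong₂ _++_ (map-code-upTo (λ i → nt (1 + i)) n λ x →
             cong suc (trans (+-suc σ x) (sym (trans (cong (_+ x) (+-comm σ 1)) refl)))) (sym (
         trans (loopTo-++ {h = doubling} {λ x → 2 ∷ suc σ + suc n + x ∷ suc σ + suc n + x ∷ []} (λ _ _ → refl) doublings _)
           (cong₂ _++_ (concatUpTo-cong doublings λ x _ →
              cong (λ z → 2 ∷ z ∷ z ∷ []) (cong suc (+-assoc σ (suc n) x)))
         (trans (loopTo-++ {h = row baseA α} {λ i → n ∷ applyUpTo (entry baseA α i) n}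
                  (λ i zs → cong (n ∷_) (loopTo-∷ (entry baseA α i) n zs)) n _)
           (cong₂ _++_ (concatUpTo-cong n λ i _ → sym (map-code-upTo (λ k → nt (firstRow + sel (α i k) k)) n λ k →
              solve 4 (λ s d n x → con 1 :+ (s :+ ((con 1 :+ (d :+ n)) :+ x)) :=
                x :+ (con 1 :+ s :+ (con 1 :+ n) :+ d)) refl σ doublings n (sel (α i k) k)))
         (trans (loopTo-++ {h = row 1 β} {λ k → n ∷ applyUpTo (entry 1 β k) n}
                  (λ k zs → cong (n ∷_) (loopTo-∷ (entry 1 β k) n zs)) n _)
           (cong₂ _++_ (concatUpTo-cong n λ k _ → sym (map-code-upTo (λ j → tm (sel (β k j) j)) n λ j →
              +-comm 1 (sel (β k j) j)))
         (trans (cong (n ∷_) (loopTo-∷ (λ _ → suc n) n _))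
           (cong₂ _++_ (sym (trans (++-identityʳ _) (map-code-upTo (λ _ → tm n) n λ _ → refl)))
         (trans (loopTo-++ {h = queryTriple} {queryCode} (λ _ _ → refl) (n * n) []) (++-identityʳ _)))))))))))  ⟩
    (n ∷ applyUpTo (λ x → suc σ + 1 + x) n) ++ loopTo doubling doublings
        (loopTo (row baseA α) n (loopTo (row 1 β) n (n ∷ loopTo (λ _ → suc n ∷_) n (loopTo queryTriple (n * n) []))))
      ≡⟨ cong (n ∷_) (sym (loopTo-∷ (λ x → suc σ + 1 + x) n _)) ⟩
    _ ∎))))
    where
    open ≡-Reasoning
    startPart  = ruleCode (rule 0)
    doublePart = concatUpTo (λ x → ruleCode (nt (suc n + x) ∷ nt (suc n + x) ∷ [])) doublings
    partA      = concatUpTo (λ i → ruleCode (applyUpTo (λ k → nt (firstRow + sel (α i k) k)) n)) n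
    partB      = concatUpTo (λ k → ruleCode (applyUpTo (λ j → tm (sel (β k j) j)) n)) n
    padPart    = concatUpTo (λ _ → ruleCode (applyUpTo (λ _ → tm n) n)) 1
    queryPart  = concatUpTo queryCode (n * n)
    split : concatUpTo (ruleCode ∘ rule ∘ suc) (doublings + (n + (n + 1))) ≡ doublePart ++ partA ++ partB ++ padPart
    split = trans (concatUpTo-seg ruleCode doublings (n + (n + 1))) (cong (doublePart ++_)
      (trans (concatUpTo-seg ruleCode n (n + 1)) (cong (partA ++_) (concatUpTo-seg ruleCode n 1))))

  size≡ : grammarSize grammar ≡ n + (doublings * 2 + (n * n + (n * n + n)))
  size≡ = begin
    sum (List.map (λ X → length (rhs X) ⊔ 1) (allFin nonterminals))
      ≡⟨ cong sum (trans (map-concat (allFin nonterminals)) (concatMap-allFin nonterminals {f = cost ∘ rule} λ X →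
           cong (λ z → z ⊔ 1 ∷ []) (length-map toSymbol (rule (toℕ X))))) ⟩
    sum (concatUpTo (cost ∘ rule) nonterminals)
      ≡⟨ cong₂ _+_ (cost-row (λ i → nt (1 + i)))
           (trans (cong sum (concatUpTo-seg cost doublings (n + (n + 1)))) (trans (sum-++ doublePart _)
           (cong₂ _+_ (sum-concatUpTo doublings λ _ _ → refl)
           (trans (cong sum (concatUpTo-seg cost n (n + 1))) (trans (sum-++ partA _)
           (cong₂ _+_ (sum-concatUpTo n λ i _ → trans (+-identityʳ _) (cost-row (λ k → nt (firstRow + sel (α i k) k))))
           (trans (cong sum (concatUpTo-seg cost n 1)) (trans (sum-++ partB _)
           (cong₂ _+_ (sum-concatUpTo n λ k _ → trans (+-identityʳ _) (cost-row (λ j → tm (sel (β k j) j))))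
             (trans (+-identityʳ _) (cost-row (λ _ → tm n)))))))))))) ⟩
    n + (doublings * 2 + (n * n + (n * n + n))) ∎
    where
    open ≡-Reasoning
    cost : List Sym → List ℕ
    cost ss = length ss ⊔ 1 ∷ []
    cost-row : ∀ (h : ℕ → Sym) → length (applyUpTo h n) ⊔ 1 ≡ n
    cost-row h = trans (cong (_⊔ 1) (length-applyUpTo h n)) (m≥n⇒m⊔n≡m (>-nonZero⁻¹ n))
    doublePart = concatUpTo (λ x → cost (nt (suc n + x) ∷ nt (suc n + x) ∷ [])) doublings
    partA      = concatUpTo (λ i → cost (applyUpTo (λ k → nt (firstRow + sel (α i k) k)) n)) n
    partB      = concatUpTo (λ k → cost (applyUpTo (λ j → tm (sel (β k j) j)) n)) n
    map-concat : ∀ {A : Set} {f : A → ℕ} xs → List.map f xs ≡ concatMap (λ x → f x ∷ []) xs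
    map-concat []       = refl
    map-concat (x ∷ xs) = cong (_ ∷_) (map-concat xs)

-- Powers and bit lengths

^-distrib-* : ∀ m n k → (m * n) ^ k ≡ m ^ k * n ^ k
^-distrib-* m n zero    = refl
^-distrib-* m n (suc k) = trans (cong (m * n *_) (^-distrib-* m n k))
  (solve 4 (λ m n x y → m :* n :* (x :* y) := m :* x :* (n :* y)) refl m n (m ^ k) (n ^ k))

⌊log₂⌋-< : ∀ s n → ⌊log₂ n ⌋ ≤ s → n < 2 ^ suc s
⌊log₂⌋-< zero n log≤ = ≰⇒> λ 2≤n → <⇒≱ z<s (≤-trans (⌊log₂⌋-mono-≤ {2} {n} 2≤n) log≤)
⌊log₂⌋-< (suc s) n log≤ = begin-strict
  n                                    ≡⟨ sym (⌊n/2⌋+⌈n/2⌉≡n n) ⟩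
  ⌊ n /2⌋ + ⌈ n /2⌉                    ≤⟨ +-monoʳ-≤ ⌊ n /2⌋ (⌊n/2⌋-mono (n≤1+n (suc n))) ⟩
  ⌊ n /2⌋ + suc ⌊ n /2⌋                <⟨ +-mono-<-≤ half< half< ⟩
  2 ^ suc s + 2 ^ suc s                ≡⟨ cong (λ z → 2 ^ suc s + z) (sym (+-identityʳ _)) ⟩
  2 ^ suc (suc s)                      ∎
  where
  open ≤-Reasoning
  half< : ⌊ n /2⌋ < 2 ^ suc s
  half< = ⌊log₂⌋-< s ⌊ n /2⌋ (≤-trans (≤-reflexive (⌊log₂⌊n/2⌋⌋≡⌊log₂n⌋∸1 n)) (∸-monoˡ-≤ 1 log≤))

n<2^bits : ∀ n → n < 2 ^ bits n
n<2^bits n = ⌊log₂⌋-< ⌊log₂ n ⌋ n ≤-refl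

⌊log₂⌋-≤ : ∀ s {n} → n < 2 ^ suc s → ⌊log₂ n ⌋ ≤ s
⌊log₂⌋-≤ zero {zero}        n< = z≤n
⌊log₂⌋-≤ zero {suc zero}    n< = z≤n
⌊log₂⌋-≤ zero {suc (suc n)} (s≤s (s≤s ()))
⌊log₂⌋-≤ (suc s) {n} n< = begin
  ⌊log₂ n ⌋             ≤⟨ m≤n+m∸n ⌊log₂ n ⌋ 1 ⟩
  suc (⌊log₂ n ⌋ ∸ 1)   ≡⟨ cong suc (sym (⌊log₂⌊n/2⌋⌋≡⌊log₂n⌋∸1 n)) ⟩
  suc ⌊log₂ ⌊ n /2⌋ ⌋   ≤⟨ s≤s (⌊log₂⌋-≤ s {⌊ n /2⌋} (*-cancelˡ-< 2 _ _ (≤-<-trans double n<))) ⟩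
  suc s                 ∎
  where
  open ≤-Reasoning
  double : 2 * ⌊ n /2⌋ ≤ n
  double = begin
    2 * ⌊ n /2⌋         ≡⟨ cong (⌊ n /2⌋ +_) (+-identityʳ ⌊ n /2⌋) ⟩
    ⌊ n /2⌋ + ⌊ n /2⌋   ≤⟨ +-monoʳ-≤ ⌊ n /2⌋ (⌊n/2⌋≤⌈n/2⌉ n) ⟩
    ⌊ n /2⌋ + ⌈ n /2⌉   ≡⟨ ⌊n/2⌋+⌈n/2⌉≡n n ⟩
    n                   ∎

bits-≤ : ∀ {s n} → 1 ≤ s → n < 2 ^ s → bits n ≤ s
bits-≤ {suc s} _ n< = s≤s (⌊log₂⌋-≤ s n<)

bits-unique : ∀ {s n} → 2 ^ s ≤ n → n < 2 ^ suc s → bits n ≡ suc s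
bits-unique {s} {n} ≤n n< = cong suc (≤-antisym (⌊log₂⌋-≤ s n<)
  (subst (_≤ ⌊log₂ n ⌋) (⌊log₂[2^n]⌋≡n s) (⌊log₂⌋-mono-≤ ≤n)))

-- Real numbers

below-≤ : ∀ (x : ℝ) {q r} → q ℚ.≤ r → below x r → below x q
below-≤ x q≤r x>r =
  let s , r<s , x>s = Equivalence.to (ℝ.roundedˡ x _) x>r
  in Equivalence.from (ℝ.roundedˡ x _) (s , ℚₚ.≤-<-trans q≤r r<s , x>s)

below-above : ∀ (x : ℝ) {q r} → below x q → above x r → q ℚ.< r
below-above x {q} {r} x>q x<r = ℚₚ.≰⇒> λ r≤q → ℝ.disjoint x r (below-≤ x r≤q x>q , x<r)

-- If no k were the floor, then N^α < k would fail for every k by induction: once it fails for k,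
-- the number k is at most N^α, and N^α < 1 + k would make k the floor. But α < 1 yields N^α < 1 +
-- N.
floor-exists : ∀ (α : ℝ) N → α ᴿ< 1ℚ → ¬ ¬ (∃[ k ] ⌊ N ^ᴿ α ⌋≡ k)
floor-exists α N α<1 none = never (suc N) (1 , 0 , α<1 , *-monoˡ-< 1 (n<1+n N))
  where
  never : ∀ k → ¬ (N ^ᴿ α < k)
  never zero    (_ , _ , _ , ())
  never (suc k) N^α<1+k = none (k , (λ p q α<p/q → ≮⇒≥ λ N^p< → never k (p , q , α<p/q , N^p<)) , N^α<1+k)

1-q/[1+q] : ∀ q → ℚ.toℚᵘ (1ℚ ℚ.- (pos q ℚ./ suc q)) ℚᵘ.≃ mkℚᵘ (pos 1) q
1-q/[1+q] q = ℚᵘₚ.≃-trans (ℚₚ.toℚᵘ-homo-+ 1ℚ (ℚ.- x))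
  (ℚᵘₚ.≃-trans (ℚᵘₚ.+-congʳ 1ℚᵘ (ℚᵘₚ.≃-trans (ℚₚ.toℚᵘ-homo‿- x) (ℚᵘₚ.-‿cong (ℚₚ.toℚᵘ-fromℚᵘ (mkℚᵘ (pos q) q)))))
  (ℚᵘ.*≡* numerators))
  where
  x = pos q ℚ./ suc q
  numerators : (pos 1 ℤ.* pos (suc q) ℤ.+ (ℤ.- pos q) ℤ.* pos 1) ℤ.* pos (suc q) ≡ pos 1 ℤ.* (pos 1 ℤ.* pos (suc q))
  numerators = begin
    (pos 1 ℤ.* pos (suc q) ℤ.+ (ℤ.- pos q) ℤ.* pos 1) ℤ.* pos (suc q)
      ≡⟨ cong₂ (λ u v → (u ℤ.+ v) ℤ.* pos (suc q)) (ℤₚ.*-identityˡ (pos (suc q))) (ℤₚ.*-identityʳ (ℤ.- pos q)) ⟩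
    ((pos 1 ℤ.+ pos q) ℤ.+ (ℤ.- pos q)) ℤ.* pos (suc q)
      ≡⟨ cong (ℤ._* pos (suc q)) (trans (ℤₚ.+-assoc (pos 1) (pos q) (ℤ.- pos q)) (cong (λ u → pos 1 ℤ.+ u) (ℤₚ.+-inverseʳ (pos q)))) ⟩
    pos 1 ℤ.* pos (suc q)
      ≡⟨ cong (λ u → pos 1 ℤ.* u) (sym (ℤₚ.*-identityˡ (pos (suc q)))) ⟩
    pos 1 ℤ.* (pos 1 ℤ.* pos (suc q)) ∎
    where open ≡-Reasoning

-- Take a rational r with 0 < r < μ and denominator 1 + d. Its numerator is at least 1, so 1/(1+d) ≤
-- r lies below μ as well. Since 1 - d/(1+d) = 1/(1+d), the witness is q = d.
positive-gap : ∀ (μ : ℝ) → 0ℚ <ᴿ μ → ∃[ q ] 1ᴿ- μ ᴿ< (pos q ℚ./ suc q)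
positive-gap μ 0<μ with Equivalence.to (ℝ.roundedˡ μ 0ℚ) 0<μ
... | r@(mkℚ (pos zero) d _) , 0<r , r<μ =
  ⊥-elim (ℚₚ.<-irrefl refl (ℚₚ.<-≤-trans 0<r (ℚ.*≤* (ℤ.+≤+ z≤n))))
... | r@(mkℚ -[1+ _ ] d _) , 0<r , r<μ =
  ⊥-elim (ℚₚ.<-irrefl refl (ℚₚ.<-≤-trans 0<r (ℚ.*≤* ℤ.-≤+)))
... | r@(mkℚ (pos (suc m)) d _) , 0<r , r<μ = d , below-≤ μ (ℚₚ.toℚᵘ-cancel-≤
  (ℚᵘₚ.≤-respˡ-≃ (ℚᵘₚ.≃-sym (1-q/[1+q] d)) (*≤* (ℤₚ.*-monoʳ-≤-nonNeg (pos (suc d)) (ℤ.+≤+ {1} {suc m} (s≤s z≤n)))))) r<μ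

numerator-bound : ∀ {num d} a b → mkℚᵘ (pos a) b ℚᵘ.< mkℚᵘ num d → a ≤ suc b * ℤ.∣ num ∣
numerator-bound {pos m} {d} a b (*<* p<) = begin
  a           ≤⟨ m≤m*n a (suc d) ⟩
  a * suc d   ≤⟨ <⇒≤ (ℤₚ.drop‿+<+ (subst₂ ℤ._<_ (sym (ℤₚ.pos-* a (suc d))) (sym (ℤₚ.pos-* m (suc b))) p<)) ⟩
  m * suc b   ≡⟨ *-comm m (suc b) ⟩
  suc b * m   ∎
  where open ≤-Reasoning
numerator-bound { -[1+ m ]} {d} a b (*<* p<)
  with () ← subst (ℤ._< -[1+ m ] ℤ.* pos (suc b)) (sym (ℤₚ.pos-* a (suc d))) p<

-- As denominators are at least 1, the numerator of a rational above κ is an integer above κ.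
upper-bound : ∀ (κ : ℝ) → ∃[ u ] ∀ a b → (pos a ℚ./ suc b) <ᴿ κ → a ≤ suc b * u
upper-bound κ with ℝ.inhabitedʳ κ
... | t@(mkℚ num _ _) , κ<t = ℤ.∣ num ∣ , λ a b a/b<κ → numerator-bound a b
  (ℚᵘₚ.<-respˡ-≃ (ℚₚ.toℚᵘ-fromℚᵘ (mkℚᵘ (pos a) b)) (ℚₚ.toℚᵘ-mono-< (below-above κ a/b<κ κ<t)))

third-exponent : ∀ (μ : ℝ) → μ ᴿ< 1ℚ → ∀ p q → (pos p ℚ./ suc q) <ᴿ (μ /3) → p ≤ suc q
third-exponent μ μ<1 p q h = bound
  (ℚᵘₚ.<-respˡ-≃ (ℚᵘₚ.≃-trans (ℚₚ.toℚᵘ-homo-* (pos 3 ℚ./ 1) (pos p ℚ./ suc q))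
      (ℚᵘₚ.*-congˡ {ℚ.toℚᵘ (pos 3 ℚ./ 1)} (ℚₚ.toℚᵘ-fromℚᵘ (mkℚᵘ (pos p) q))))
    (ℚₚ.toℚᵘ-mono-< (below-above μ h μ<1)))
  where
  bound : (mkℚᵘ (pos 3) 0 ℚᵘ.* mkℚᵘ (pos p) q) ℚᵘ.< 1ℚᵘ → p ≤ suc q
  bound (*<* p<) = ≤-trans (m≤n*m p 3) (<⇒≤ (ℤₚ.drop‿+<+ (subst₂ ℤ._<_
    (trans (ℤₚ.*-identityʳ _) (sym (ℤₚ.pos-* 3 p)))
    (trans (ℤₚ.*-identityˡ _) (ℤₚ.*-identityˡ (pos (suc q)))) p<)))

-- The crude estimate κ N^(μ/3) ≤ u N suffices, because σ can be made as large as desired.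
large-alphabet : ∀ (μ κ : ℝ) → μ ᴿ< 1ℚ → ∀ {N σ} → 1 ≤ N → N * proj₁ (upper-bound κ) ≤ σ → κ · N ^ᴿ (μ /3) ≤ σ
large-alphabet μ κ μ<1 {N} {σ} 1≤N Nu≤σ a b p q a/b<κ p/q<μ = begin
  a ^ suc q * N ^ p                      ≤⟨ *-mono-≤ (^-monoˡ-≤ (suc q) (proj₂ (upper-bound κ) a b a/b<κ))
                                              (^-monoʳ-≤ N {{>-nonZero 1≤N}} (third-exponent μ μ<1 p q p/q<μ)) ⟩
  (suc b * u) ^ suc q * N ^ suc q        ≡⟨ sym (^-distrib-* (suc b * u) N (suc q)) ⟩
  (suc b * u * N) ^ suc q                ≤⟨ ^-monoˡ-≤ (suc q) (≤-trans (≤-reflexive (trans (*-assoc (suc b) u N) (cong (suc b *_) (*-comm u N))))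
                                              (*-monoʳ-≤ (suc b) Nu≤σ)) ⟩
  (suc b * σ) ^ suc q                    ∎
  where
  open ≤-Reasoning
  u = proj₁ (upper-bound κ)

-- Choice of the constants; sizes, word length and running time

m<2^m : ∀ m → m < 2 ^ m
m<2^m zero    = s≤s z≤n
m<2^m (suc m) = begin
  2 + m             ≤⟨ s≤s (m<2^m m) ⟩
  suc (2 ^ m)       ≤⟨ +-monoˡ-≤ (2 ^ m) (m^n>0 2 m) ⟩
  2 ^ m + 2 ^ m     ≡⟨ cong (λ z → 2 ^ m + z) (sym (+-identityʳ (2 ^ m))) ⟩
  2 ^ suc m         ∎
  where open ≤-Reasoning

-- The factors come from `overhead≤` (the construction's own steps), `size+m≤` (grammar size plus
-- number of queries) and `bits-N≤` (logarithm of the text length).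
timeFactor : (e C d : ℕ) → ℕ
timeFactor e C d = 137 + 9 * (e + 1) + C * ((2 * (e + 1) + 5) * (e + 5) ^ d)

-- Here 1/(1+q) < μ and u > κ.  Blocks of repeats = 2 ^ (b * e) copies exceed twice the
-- additive error, and σ = 2 ^ (b * K ∸ 1) dominates everything else, so that the words
-- of the assumed algorithm have exactly c′ * K * b bits.
module Bounds (n b q u c′ e K c : ℕ) .{{_ : NonZero n}} (1≤b : 1 ≤ b) (n<2^b : n < 2 ^ b) (1≤c′ : 1 ≤ c′)
              (e≡ : e ≡ 4 * suc q) (K≡ : K ≡ e + (10 + u)) (c≡ : c ≡ c′ * K) where

  open Parameters n b c K e

  -- `y` is half the text length and serves as the unit for all estimates: every quantity other than
  -- σ and its codes is bounded by a small multiple of it.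
  w y N size : ℕ
  w    = c * b
  y    = n * n * n * repeats
  N    = n * blockLength
  size = n + (doublings * 2 + (n * n + (n * n + n)))

  private
    instance
      b≢0 : NonZero b
      b≢0 = >-nonZero 1≤b
      c′≢0 : NonZero c′
      c′≢0 = >-nonZero 1≤c′
      K≢0 : NonZero K
      K≢0 = subst NonZero (sym (trans K≡ (+-suc e (9 + u)))) _
      n*n≢0 : NonZero (n * n)
      n*n≢0 = m*n≢0 n n
      n*n*n≢0 : NonZero (n * n * n)
      n*n*n≢0 = m*n≢0 (n * n) n
      repeats≢0 : NonZero repeats
      repeats≢0 = m^n≢0 2 (b * e)

  n*n≤y : n * n ≤ y
  n*n≤y = ≤-trans (m≤m*n (n * n) n) (m≤m*n (n * n * n) repeats)

  n≤y : n ≤ y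
  n≤y = ≤-trans (m≤m*n n n) n*n≤y

  1≤y : 1 ≤ y
  1≤y = ≤-trans (>-nonZero⁻¹ n) n≤y

  repeats≤y : repeats ≤ y
  repeats≤y = m≤n*m repeats (n * n * n)

  levels≤repeats : levels ≤ repeats
  levels≤repeats = ≤-trans (≤-reflexive (+-comm (b * e) 1)) (m<2^m (b * e))

  doublings≤y : doublings ≤ y
  doublings≤y = begin
    levels * n               ≤⟨ *-monoˡ-≤ n levels≤repeats ⟩
    repeats * n              ≡⟨ *-comm repeats n ⟩
    n * repeats              ≤⟨ *-monoˡ-≤ repeats (m≤n*m n (n * n)) ⟩
    n * n * n * repeats      ∎
    where open ≤-Reasoning

  N≡2y : N ≡ 2 * y
  N≡2y = solve 2 (λ n r → n :* (n :* n :* r :+ n :* n :* r) := con 2 :* (n :* n :* n :* r)) refl n repeats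

  1≤N : 1 ≤ N
  1≤N = ≤-trans 1≤y (≤-trans (m≤n*m y 2) (≤-reflexive (sym N≡2y)))

  y≤ : y ≤ 2 ^ (b * (e + 3))
  y≤ = begin
    n * n * n * repeats                    ≤⟨ *-monoˡ-≤ repeats (*-mono-≤ (*-mono-≤ n≤ n≤) n≤) ⟩
    2 ^ b * 2 ^ b * 2 ^ b * 2 ^ (b * e)    ≡⟨ cong (λ z → z * 2 ^ b * 2 ^ (b * e)) (sym (^-distribˡ-+-* 2 b b)) ⟩
    2 ^ (b + b) * 2 ^ b * 2 ^ (b * e)      ≡⟨ cong (_* 2 ^ (b * e)) (sym (^-distribˡ-+-* 2 (b + b) b)) ⟩
    2 ^ (b + b + b) * 2 ^ (b * e)          ≡⟨ sym (^-distribˡ-+-* 2 (b + b + b) (b * e)) ⟩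
    2 ^ (b + b + b + b * e)                ≡⟨ cong (2 ^_) (solve 2 (λ b e → b :+ b :+ b :+ b :* e := b :* (e :+ con 3)) refl b e) ⟩
    2 ^ (b * (e + 3))                      ∎
    where
    open ≤-Reasoning
    n≤ = <⇒≤ n<2^b

  N≤ : N ≤ 2 ^ (b * (e + 4))
  N≤ = begin
    N                            ≡⟨ N≡2y ⟩
    2 * y                        ≤⟨ *-mono-≤ (^-monoʳ-≤ 2 1≤b) y≤ ⟩
    2 ^ b * 2 ^ (b * (e + 3))    ≡⟨ sym (^-distribˡ-+-* 2 b (b * (e + 3))) ⟩
    2 ^ (b + b * (e + 3))        ≡⟨ cong (2 ^_) (solve 2 (λ b e → b :+ b :* (e :+ con 3) := b :* (e :+ con 4)) refl b e) ⟩
    2 ^ (b * (e + 4))            ∎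
    where open ≤-Reasoning

  bits-N≤ : bits N ≤ b * (e + 5)
  bits-N≤ = bits-≤ (≤-trans (≤-trans (s≤s z≤n) (m≤n+m 5 e)) (m≤n*m (e + 5) b))
    (≤-<-trans N≤ (^-monoʳ-< 2 (s≤s (s≤s z≤n)) (*-monoʳ-< b (+-monoʳ-< e ≤-refl))))

  -- The origin of `e`: the text is longer than `repeats` by the factor 2 n³ ≤ 2^(4b), and (e + 4) q
  -- ≤ e (q + 1) holds once e ≥ 4q. So N^q ≤ `repeats`^(q+1), and (q+1)-th powers can be compared.
  approximation≤repeats : ∀ k → k ^ suc q ≤ N ^ q → k ≤ repeats
  approximation≤repeats k k^≤ = ≮⇒≥ λ repeats<k → <⇒≱ (^-monoˡ-< (suc q) repeats<k) (begin
    k ^ suc q                       ≤⟨ k^≤ ⟩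
    N ^ q                           ≤⟨ ^-monoˡ-≤ q N≤ ⟩
    (2 ^ (b * (e + 4))) ^ q         ≡⟨ ^-*-assoc 2 (b * (e + 4)) q ⟩
    2 ^ (b * (e + 4) * q)           ≤⟨ ^-monoʳ-≤ 2 (≤-trans (≤-reflexive (*-assoc b (e + 4) q))
                                         (≤-trans (*-monoʳ-≤ b exponent≤) (≤-reflexive (sym (*-assoc b e (suc q)))))) ⟩
    2 ^ (b * e * suc q)             ≡⟨ sym (^-*-assoc 2 (b * e) (suc q)) ⟩
    repeats ^ suc q                 ∎)
    where
    open ≤-Reasoning
    exponent≤ : (e + 4) * q ≤ e * suc q
    exponent≤ = begin
      (e + 4) * q      ≡⟨ solve 2 (λ e q → (e :+ con 4) :* q := con 4 :* q :+ e :* q) refl e q ⟩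
      4 * q + e * q    ≤⟨ +-monoˡ-≤ (e * q) (≤-trans (*-monoʳ-≤ 4 (n≤1+n q)) (≤-reflexive (sym e≡))) ⟩
      e + e * q        ≡⟨ sym (*-suc e q) ⟩
      e * suc q        ∎

  b*K≥1 : 1 ≤ b * K
  b*K≥1 = ≤-trans 1≤b (m≤m*n b K)

  -- The origin of `K`: e + 3 accounts for y, and 7 + u leaves enough for the factor 32 = 2^5, for
  -- 2^u and for the 1 subtracted in the exponent of σ. The factor 2^u > u is what `N*u≤σ` needs.
  σ-large : 32 * y * 2 ^ u ≤ σ
  σ-large = begin
    32 * y * 2 ^ u                             ≤⟨ *-monoˡ-≤ (2 ^ u) (*-monoʳ-≤ 32 y≤) ⟩
    2 ^ 5 * 2 ^ (b * (e + 3)) * 2 ^ u          ≡⟨ cong (_* 2 ^ u) (sym (^-distribˡ-+-* 2 5 (b * (e + 3)))) ⟩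
    2 ^ (5 + b * (e + 3)) * 2 ^ u              ≡⟨ sym (^-distribˡ-+-* 2 (5 + b * (e + 3)) u) ⟩
    2 ^ (5 + b * (e + 3) + u)                  ≤⟨ ^-monoʳ-≤ 2 (∸-monoˡ-≤ 1 exponent≤) ⟩
    2 ^ (b * K ∸ 1)                            ∎
    where
    open ≤-Reasoning
    exponent≤ : 1 + (5 + b * (e + 3) + u) ≤ b * K
    exponent≤ = begin
      1 + (5 + b * (e + 3) + u)          ≤⟨ n≤1+n _ ⟩
      2 + (5 + b * (e + 3) + u)          ≡⟨ solve 2 (λ s u → con 2 :+ (con 5 :+ s :+ u) := s :+ (con 7 :+ u)) refl (b * (e + 3)) u ⟩
      b * (e + 3) + (7 + u)              ≤⟨ +-monoʳ-≤ (b * (e + 3)) (m≤n*m (7 + u) b) ⟩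
      b * (e + 3) + b * (7 + u)          ≡⟨ solve 3 (λ b e u → b :* (e :+ con 3) :+ b :* (con 7 :+ u) := b :* (e :+ (con 10 :+ u))) refl b e u ⟩
      b * (e + (10 + u))                 ≡⟨ cong (b *_) (sym K≡) ⟩
      b * K                              ∎

  32y≤σ : 32 * y ≤ σ
  32y≤σ = ≤-trans (m≤m*n (32 * y) (2 ^ u) {{m^n≢0 2 u}}) σ-large

  32≤σ : 32 ≤ σ
  32≤σ = ≤-trans (≤-trans (≤-reflexive (sym (*-identityʳ 32))) (*-monoʳ-≤ 32 1≤y)) 32y≤σ

  y<σ : y < σ
  y<σ = <-≤-trans (m<n*m y 32 {{>-nonZero 1≤y}} (s≤s (s≤s z≤n))) 32y≤σ
    where
    m<n*m : ∀ m n .{{_ : NonZero m}} → 1 < n → m < n * m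
    m<n*m m n 1<n = subst (_< n * m) (+-identityʳ m) (*-monoˡ-< m 1<n)

  n<σ : n < σ
  n<σ = ≤-<-trans n≤y y<σ

  N*u≤σ : N * u ≤ σ
  N*u≤σ = begin
    N * u              ≤⟨ *-mono-≤ (≤-trans (≤-reflexive N≡2y) (*-monoˡ-≤ y (m≤m+n 2 30))) (<⇒≤ (m<2^m u)) ⟩
    32 * y * 2 ^ u     ≤⟨ σ-large ⟩
    σ                  ∎
    where open ≤-Reasoning

  2σ≡ : σ + σ ≡ 2 ^ (b * K)
  2σ≡ = trans (cong (λ z → σ + z) (sym (+-identityʳ σ))) (cong (2 ^_) (m+[n∸m]≡n b*K≥1))

  b*c≡w : b * c ≡ w
  b*c≡w = *-comm b c

  w≡ : c′ * (b * K) ≡ w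
  w≡ = trans (cong (c′ *_) (*-comm b K)) (trans (sym (*-assoc c′ K b)) (cong (_* b) (sym c≡)))

  2^b*K≤ : 2 ^ (b * K) ≤ 2 ^ w
  2^b*K≤ = ^-monoʳ-≤ 2 (≤-trans (m≤n*m (b * K) c′) (≤-reflexive w≡))

  b*c≥1 : 1 ≤ b * c
  b*c≥1 = ≤-trans b*K≥1 (≤-trans (m≤n*m (b * K) c′) (≤-reflexive (trans w≡ (sym b*c≡w))))

  σ+y< : ∀ {x} → x < σ → σ + x < 2 ^ w
  σ+y< x<σ = <-≤-trans (+-monoʳ-< σ x<σ) (≤-trans (≤-reflexive 2σ≡) 2^b*K≤)

  ≤32y⇒< : ∀ {x} → x ≤ 32 * y → x < 2 ^ w
  ≤32y⇒< x≤ = ≤-<-trans (≤-trans x≤ 32y≤σ) (≤-<-trans (m≤m+n σ 0) (σ+y< (≤-trans (s≤s z≤n) 32≤σ)))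

  ≤y⇒≤32y : ∀ {x} → x ≤ y → x ≤ 32 * y
  ≤y⇒≤32y x≤ = ≤-trans x≤ (m≤n*m y 32)

  area≤ : area ≤ 32 * y
  area≤ = begin
    area                                          ≡⟨ solve 2 (λ n d → n :* n :* con 3 :+ (con 1 :+ n :+ (n :* (con 1 :+ n) :+ (n :* (con 1 :+ n)
                                                       :+ (d :* con 3 :+ (con 1 :+ n :+ con 4)))))
                                                       := con 5 :* (n :* n) :+ (con 4 :* n :+ (con 3 :* d :+ con 6 :* con 1))) refl n doublings ⟩
    5 * (n * n) + (4 * n + (3 * doublings + 6 * 1)) ≤⟨ +-mono-≤ (*-monoʳ-≤ 5 n*n≤y) (+-mono-≤ (*-monoʳ-≤ 4 n≤y)
                                                       (+-mono-≤ (*-monoʳ-≤ 3 doublings≤y) (*-monoʳ-≤ 6 1≤y))) ⟩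
    5 * y + (4 * y + (3 * y + 6 * y))             ≡⟨ solve 1 (λ y → con 5 :* y :+ (con 4 :* y :+ (con 3 :* y :+ con 6 :* y)) := con 18 :* y) refl y ⟩
    18 * y                                        ≤⟨ *-monoˡ-≤ y (m≤m+n 18 14) ⟩
    32 * y                                        ∎
    where open ≤-Reasoning

  1+nonterminals≤ : suc nonterminals ≤ 6 * y
  1+nonterminals≤ = begin
    suc nonterminals                   ≡⟨ solve 2 (λ n d → con 2 :+ (d :+ (n :+ (n :+ con 1))) := d :+ (con 2 :* n :+ con 3 :* con 1)) refl n doublings ⟩
    doublings + (2 * n + 3 * 1)        ≤⟨ +-mono-≤ doublings≤y (+-mono-≤ (*-monoʳ-≤ 2 n≤y) (*-monoʳ-≤ 3 1≤y)) ⟩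
    y + (2 * y + 3 * y)                ≡⟨ solve 1 (λ y → y :+ (con 2 :* y :+ con 3 :* y) := con 6 :* y) refl y ⟩
    6 * y                              ∎
    where open ≤-Reasoning

  ≤9y⇒<σ : ∀ {x} → x ≤ 9 * y → x < σ
  ≤9y⇒<σ x≤ = <-≤-trans (≤-<-trans x≤ (*-monoˡ-< y {{>-nonZero 1≤y}} (m≤m+n 10 22))) 32y≤σ

  size+m+N≤ : size + n * n + N ≤ 9 * y
  size+m+N≤ = begin
    size + n * n + N                                  ≡⟨ cong (size + n * n +_) N≡2y ⟩
    size + n * n + 2 * y                              ≡⟨ solve 3 (λ n d y → n :+ (d :* con 2 :+ (n :* n :+ (n :* n :+ n))) :+ n :* n :+ con 2 :* y
                                                           := con 2 :* d :+ (con 3 :* (n :* n) :+ (con 2 :* n :+ con 2 :* y))) refl n doublings y ⟩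
    2 * doublings + (3 * (n * n) + (2 * n + 2 * y))   ≤⟨ +-mono-≤ (*-monoʳ-≤ 2 doublings≤y) (+-mono-≤ (*-monoʳ-≤ 3 n*n≤y) (+-monoˡ-≤ (2 * y) (*-monoʳ-≤ 2 n≤y))) ⟩
    2 * y + (3 * y + (2 * y + 2 * y))                 ≡⟨ solve 1 (λ y → con 2 :* y :+ (con 3 :* y :+ (con 2 :* y :+ con 2 :* y)) := con 9 :* y) refl y ⟩
    9 * y                                             ∎
    where open ≤-Reasoning

  -- All summands but σ add up to less than σ, so the sum lies between σ and 2σ = 2^(b K). Its bit
  -- length is therefore the same for all matrices of a given bit length b, and exactly proportional
  -- to b.
  bits-total : bits (size + σ + n * n + N) ≡ b * K
  bits-total = trans (bits-unique {b * K ∸ 1} (subst (σ ≤_) (sym total≡) (m≤m+n σ _))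
    (subst₂ _<_ (sym total≡) (trans 2σ≡ (cong (2 ^_) (sym (m+[n∸m]≡n b*K≥1)))) (+-monoʳ-< σ (≤9y⇒<σ size+m+N≤))))
    (m+[n∸m]≡n b*K≥1)
    where
    total≡ : size + σ + n * n + N ≡ σ + (size + n * n + N)
    total≡ = solve 4 (λ s a m k → s :+ a :+ m :+ k := a :+ (s :+ m :+ k)) refl size σ (n * n) N

  1<2 : 1 < 2
  1<2 = s≤s (s≤s z≤n)

  2half≡ : 2 * half ≡ 2 ^ w
  2half≡ = cong (2 ^_) (trans (m+[n∸m]≡n b*c≥1) b*c≡w)

  fits : ∀ orig → Build.Fits w n b c K e orig
  fits orig = record
    { b*c≥1    = b*c≥1
    ; b*K≥1    = b*K≥1
    ; 3<       = ≤32y⇒< (≤-trans (m≤m+n 3 29) (≤-trans (≤-reflexive (sym (*-identityʳ 32))) (*-monoʳ-≤ 32 1≤y)))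
    ; b<       = ≤-<-trans (m≤m*n b K) b*K<
    ; e<       = ≤-<-trans (m≤n*m e b) b*e<
    ; K<       = ≤-<-trans (m≤n*m K b) b*K<
    ; c<       = ≤-<-trans (m≤n*m c b) b*c<
    ; b*e<     = b*e<
    ; b*K<     = b*K<
    ; b*c<     = b*c<
    ; repeats< = ≤32y⇒< (≤y⇒≤32y repeats≤y)
    ; half<    = ^-monoʳ-< 2 1<2 (subst (b * c ∸ 1 <_) (trans (m+[n∸m]≡n b*c≥1) b*c≡w) ≤-refl)
    ; codes<   = subst (_< 2 ^ w) (+-suc σ nonterminals)
                   (σ+y< (≤9y⇒<σ (≤-trans 1+nonterminals≤ (*-monoˡ-≤ y (m≤m+n 6 3)))))
    ; string<  = ≤32y⇒< (≤-trans (≤-reflexive N≡2y) (*-monoˡ-≤ y (m≤m+n 2 30)))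
    ; area<    = ≤32y⇒< area≤
    }
    where
    b*e< : b * e < 2 ^ w
    b*e< = <-trans (m<2^m (b * e)) (≤32y⇒< (≤y⇒≤32y repeats≤y))
    b*K< : b * K < 2 ^ w
    b*K< = <-≤-trans (m<2^m (b * K)) 2^b*K≤
    b*c< : b * c < 2 ^ w
    b*c< = subst (_< 2 ^ w) (sym b*c≡w) (m<2^m w)

  private
    Y : ℕ
    Y = n ^ 2 * b

    n*n≤Y : n * n ≤ Y
    n*n≤Y = ≤-trans (≤-reflexive (cong (n *_) (sym (*-identityʳ n)))) (m≤m*n (n ^ 2) b)

    n≤Y : n ≤ Y
    n≤Y = ≤-trans (m≤m*n n n) n*n≤Y

    b≤Y : b ≤ Y
    b≤Y = m≤n*m b (n ^ 2) {{m^n≢0 n 2}}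

    1≤Y : 1 ≤ Y
    1≤Y = ≤-trans 1≤b b≤Y

    doublings≤Y : doublings ≤ (e + 1) * Y
    doublings≤Y = begin
      (b * e + 1) * n         ≤⟨ *-monoˡ-≤ n (+-monoʳ-≤ (b * e) 1≤b) ⟩
      (b * e + b) * n         ≡⟨ solve 3 (λ b e n → (b :* e :+ b) :* n := (e :+ con 1) :* (n :* b)) refl b e n ⟩
      (e + 1) * (n * b)       ≤⟨ *-monoʳ-≤ (e + 1) (*-monoˡ-≤ b (≤-trans (m≤m*n n n) (≤-reflexive (cong (n *_) (sym (*-identityʳ n)))))) ⟩
      (e + 1) * Y             ∎
      where open ≤-Reasoning

  overhead≤ : buildTime + (1 + (n * n * 7 + 1)) ≤ (137 + 9 * (e + 1)) * Y
  overhead≤ = begin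
    buildTime + (1 + (n * n * 7 + 1))
      ≡⟨ solve 3 (λ b n d →
           let matrix = con 1 :+ (n :* (con 1 :+ (con 2 :+ (n :* con 11 :+ con 1 :+ con 2))) :+ con 1) in
           (con 3 :+ (b :* con 3 :+ con 1 :+ (con 23 :+ (con 11 :+
           (con 1 :+ (n :* n :* con 13 :+ con 1) :+ (con 1 :+ (n :* con 4 :+ con 1 :+ con 2) :+
           (con 3 :+ (matrix :+ (con 2 :+ (matrix :+
           (con 2 :+ (d :* con 9 :+ con 1) :+ (con 2 :+ (n :* con 5 :+ con 1 :+ con 2) :+ con 8))))))))))))
           :+ (con 1 :+ (n :* n :* con 7 :+ con 1))
           := con 71 :* con 1 :+ (con 3 :* b :+ (con 21 :* n :+ (con 42 :* (n :* n) :+ con 9 :* d)))) refl b n doublings ⟩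
    71 * 1 + (3 * b + (21 * n + (42 * (n * n) + 9 * doublings)))
      ≤⟨ +-mono-≤ (*-monoʳ-≤ 71 1≤Y) (+-mono-≤ (*-monoʳ-≤ 3 b≤Y) (+-mono-≤ (*-monoʳ-≤ 21 n≤Y)
           (+-mono-≤ (*-monoʳ-≤ 42 n*n≤Y) (*-monoʳ-≤ 9 doublings≤Y)))) ⟩
    71 * Y + (3 * Y + (21 * Y + (42 * Y + 9 * ((e + 1) * Y))))
      ≡⟨ solve 2 (λ y e → con 71 :* y :+ (con 3 :* y :+ (con 21 :* y :+ (con 42 :* y :+ con 9 :* ((e :+ con 1) :* y))))
           := (con 137 :+ con 9 :* (e :+ con 1)) :* y) refl Y e ⟩
    (137 + 9 * (e + 1)) * Y ∎
    where open ≤-Reasoning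

  size+m≤ : size + n * n ≤ (2 * (e + 1) + 5) * Y
  size+m≤ = begin
    size + n * n                                  ≡⟨ solve 2 (λ n d → n :+ (d :* con 2 :+ (n :* n :+ (n :* n :+ n))) :+ n :* n
                                                       := con 2 :* d :+ (con 3 :* (n :* n) :+ con 2 :* n)) refl n doublings ⟩
    2 * doublings + (3 * (n * n) + 2 * n)         ≤⟨ +-mono-≤ (*-monoʳ-≤ 2 doublings≤Y) (+-mono-≤ (*-monoʳ-≤ 3 n*n≤Y) (*-monoʳ-≤ 2 n≤Y)) ⟩
    2 * ((e + 1) * Y) + (3 * Y + 2 * Y)           ≡⟨ solve 2 (λ y e → con 2 :* ((e :+ con 1) :* y) :+ (con 3 :* y :+ con 2 :* y)
                                                       := (con 2 :* (e :+ con 1) :+ con 5) :* y) refl Y e ⟩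
    (2 * (e + 1) + 5) * Y                         ∎
    where open ≤-Reasoning

  -- Of the d + 1 logarithmic factors, one is part of the bound n² b on grammar, queries and own
  -- steps, where it covers the levels of doubling; the other d come from `bits N` ≤ b (e + 5).
  total-time : ∀ C d {t t₀} → t₀ ≤ C * ((size + n * n) * bits N ^ d) →
    t ≤ buildTime + (t₀ + (1 + (n * n * 7 + 1))) →
    t ≤ timeFactor e C d * (n ^ 2 * b ^ suc d)
  total-time C d {t} {t₀} t₀≤ t≤ = begin
    t                                                       ≤⟨ t≤ ⟩
    buildTime + (t₀ + rest)                                 ≡⟨ solve 3 (λ x y z → x :+ (y :+ z) := x :+ z :+ y) refl buildTime t₀ rest ⟩
    buildTime + rest + t₀                                   ≤⟨ +-mono-≤ overhead≤ (≤-trans t₀≤ (*-monoʳ-≤ C (*-mono-≤ size+m≤ (^-monoˡ-≤ d bits-N≤)))) ⟩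
    A * Y + C * (B * Y * (b * (e + 5)) ^ d)                 ≤⟨ +-mono-≤ (*-monoʳ-≤ A (m≤m*n Y (b ^ d) {{m^n≢0 b d}}))
                                                                 (≤-reflexive (cong (λ z → C * (B * Y * z)) (^-distrib-* b (e + 5) d))) ⟩
    A * (Y * b ^ d) + C * (B * Y * (b ^ d * (e + 5) ^ d))   ≡⟨ solve 7 (λ A C B m b p g → A :* (m :* b :* p) :+ C :* (B :* (m :* b) :* (p :* g))
                                                                 := (A :+ C :* (B :* g)) :* (m :* (b :* p))) refl A C B (n ^ 2) b (b ^ d) ((e + 5) ^ d) ⟩
    (A + C * (B * (e + 5) ^ d)) * (n ^ 2 * b ^ suc d)       ∎
    where
    open ≤-Reasoning
    A = 137 + 9 * (e + 1)
    B = 2 * (e + 1) + 5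
    rest = 1 + (n * n * 7 + 1)

-- Memory cells of the input matrices

module _ (w : ℕ) where
  open WordRAM w using (cell)

  cell-++ˡ : ∀ {xs ys i} → i < length xs → cell (xs ++ ys) i ≡ cell xs i
  cell-++ˡ {x ∷ xs} {i = zero}  i<       = refl
  cell-++ˡ {x ∷ xs} {i = suc i} (s≤s i<) = cell-++ˡ {xs} i<

  cell-++ʳ : ∀ xs {ys} i → cell (xs ++ ys) (length xs + i) ≡ cell ys i
  cell-++ʳ []       i = refl
  cell-++ʳ (x ∷ xs) i = cell-++ʳ xs i

  cell-outside : ∀ xs i → length xs ≤ i → cell xs i ≡ 0
  cell-outside []       i       ≤i       = refl
  cell-outside (x ∷ xs) (suc i) (s≤s ≤i) = cell-outside xs i ≤i

  cell-applyUpTo : ∀ f n {i} → i < n → cell (applyUpTo f n) i ≡ f i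
  cell-applyUpTo f (suc n) {zero}  i<       = refl
  cell-applyUpTo f (suc n) {suc i} (s≤s i<) = cell-applyUpTo (f ∘ suc) n i<

  cell-concatUpTo : ∀ {f : ℕ → List ℕ} {ℓ} → (∀ x → length (f x) ≡ ℓ) → ∀ {n} ys i j → i < n → j < ℓ →
                    cell (concatUpTo f n ++ ys) (ℓ * i + j) ≡ cell (f i) j
  cell-concatUpTo {f} {ℓ} ℓ≡ {n} ys i j i< j<
    with v , split ← concatUpTo-split f i i< = begin
    cell (concatUpTo f n ++ ys) (ℓ * i + j)
      ≡⟨ cong₂ cell (trans (cong (_++ ys) split) (++-assoc (concatUpTo f i) (f i ++ v) ys))
           (cong (_+ j) (trans (*-comm ℓ i) (sym (length-concatUpTo ℓ≡ i)))) ⟩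
    cell (concatUpTo f i ++ (f i ++ v) ++ ys) (length (concatUpTo f i) + j)
      ≡⟨ cell-++ʳ (concatUpTo f i) j ⟩
    cell ((f i ++ v) ++ ys) j
      ≡⟨ cong (λ zs → cell zs j) (++-assoc (f i) v ys) ⟩
    cell (f i ++ v ++ ys) j
      ≡⟨ cell-++ˡ {f i} (subst (j <_) (sym (ℓ≡ i)) j<) ⟩
    cell (f i) j ∎
    where open ≡-Reasoning

tabulate≡applyUpTo : ∀ {A : Set} n {f : Fin n → A} {g : ℕ → A} → (∀ i → f i ≡ g (toℕ i)) → tabulate f ≡ applyUpTo g n
tabulate≡applyUpTo zero    f≡g = refl
tabulate≡applyUpTo (suc n) f≡g = cong₂ _∷_ (f≡g Fin.zero) (tabulate≡applyUpTo n (f≡g ∘ Fin.suc))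

modulo-toℕ : ∀ {n} .{{_ : NonZero n}} (i : Fin n) → toℕ i modulo n ≡ i
modulo-toℕ i = Finₚ.toℕ-injective (toℕ-mod (Finₚ.toℕ<n i))

module _ {n : ℕ} .{{_ : NonZero n}} where

  -- Out-of-range indices are reduced modulo n.
  extend : BoolMatrix n → ℕ → ℕ → Bool
  extend A i j = A (i modulo n) (j modulo n)

  entryRow : BoolMatrix n → ℕ → List ℕ
  entryRow A i = applyUpTo (λ j → bit (extend A i j)) n

  entries≡ : ∀ A → entries A ≡ concatUpTo (entryRow A) n
  entries≡ A = concatMap-allFin n λ i → trans (map-tabulate (λ j → j) (λ j → bit (A i j)))
    (tabulate≡applyUpTo n λ j → cong bit (sym (cong₂ A (modulo-toℕ i) (modulo-toℕ j))))

  length-entryRow : ∀ A i → length (entryRow A i) ≡ n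
  length-entryRow A i = length-applyUpTo (λ j → bit (extend A i j)) n

  length-entries : ∀ A → length (entries A) ≡ n * n
  length-entries A = trans (cong length (entries≡ A)) (length-concatUpTo (length-entryRow A) n)

  cell-entries : ∀ w A ys i j → i < n → j < n → WordRAM.cell w (entries A ++ ys) (n * i + j) ≡ bit (extend A i j)
  cell-entries w A ys i j i< j< rewrite entries≡ A =
    trans (cell-concatUpTo w (length-entryRow A) ys i j i< j<) (cell-applyUpTo w _ n j<)

-- From approximate ranks to entries of the product

or-true : ∀ n {f : Fin n → Bool} → Vector.foldr _∨_ false f ≡ true → ∃[ k ] f k ≡ true
or-true (suc n) {f} p with f Fin.zero in f0
... | true  = Fin.zero , f0
... | false = let k , fk = or-true n p in Fin.suc k , fk

or-false : ∀ n {f : Fin n → Bool} → Vector.foldr _∨_ false f ≡ false → ∀ k → f k ≡ false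
or-false (suc n) {f} p k with f Fin.zero in f0
or-false (suc n) {f} p Fin.zero    | false = f0
or-false (suc n) {f} p (Fin.suc k) | false = or-false n p k

<ᵇ-true : ∀ {m n} → m < n → (m <ᵇ n) ≡ true
<ᵇ-true {m} {n} m<n with m <ᵇ n in m<ᵇn
... | true  = refl
... | false = ⊥-elim (subst T m<ᵇn (<⇒<ᵇ m<n))

<ᵇ-false : ∀ {m n} → n ≤ m → (m <ᵇ n) ≡ false
<ᵇ-false {m} {n} n≤m with m <ᵇ n in m<ᵇn
... | false = refl
... | true  = ⊥-elim (<⇒≱ (<ᵇ⇒< m n (subst T (sym m<ᵇn) _)) n≤m)

module _ {w half : ℕ} (2half≡ : 2 * half ≡ 2 ^ w) where

  signed-low : ∀ {x} → x < half → signed w x ≡ pos x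
  signed-low {x} x< rewrite <ᵇ-true (subst (2 * x <_) 2half≡ (*-monoʳ-< 2 x<)) = refl

  signed-high : ∀ {x} → half ≤ x → x < 2 ^ w → signed w x ℤ.≤ pos 0
  signed-high {x} ≤x x< rewrite <ᵇ-false (≤-trans (≤-reflexive (sym 2half≡)) (*-monoʳ-≤ 2 ≤x)) =
    ℤₚ.≤-trans (ℤₚ.≤-reflexive (ℤₚ.⊖-≤ (<⇒≤ x<))) (ℤₚ.neg-mono-≤ (ℤ.+≤+ z≤n))

  -- An approximation of 0 may be negative, and then its word is at least `half`. This is why the
  -- accepted window has an upper end; nonnegative approximations are below k and miss the window at
  -- its lower end.
  answer-zero : ∀ {k low x} → k ≤ low → AdditiveApprox k 0 (signed w x) → answer low half x ≡ 0
  answer-zero {k} {low} {x} k≤low (_ , x<k) with <-≤-connex x half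
  ... | inj₂ half≤x rewrite <ᵇ-false half≤x = cong bit (<ᵇ-false {bit (x <ᵇ low)} z≤n)
  ... | inj₁ x<half rewrite <ᵇ-true x<half
                          | <ᵇ-true (<-≤-trans (ℤₚ.drop‿+<+ (subst (ℤ._< pos k) (signed-low x<half) x<k)) k≤low) = refl

  -- The signed value exceeds r - k ≥ 2 low - low = low. In particular it is positive, so the word
  -- lies below `half` and equals its signed reading.
  answer-one : ∀ {k low r x} → k ≤ low → 2 * low ≤ r → x < 2 ^ w →
               AdditiveApprox k r (signed w x) → answer low half x ≡ 1
  answer-one {k} {low} {r} {x} k≤low 2low≤r x< (r-k< , _) = decided (<-≤-connex x half)
    where
    low+k≤r : low + k ≤ r
    low+k≤r = ≤-trans (+-monoʳ-≤ low (≤-trans k≤low (≤-reflexive (sym (+-identityʳ low))))) 2low≤r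
    low<signed : pos low ℤ.< signed w x
    low<signed = ℤₚ.≤-<-trans (ℤₚ.≤-trans (ℤ.+≤+ (m+n≤o⇒m≤o∸n low low+k≤r))
      (ℤₚ.≤-reflexive (sym (trans (ℤₚ.m-n≡m⊖n r k) (ℤₚ.⊖-≥ (≤-trans (m≤n+m k low) low+k≤r)))))) r-k<
    decided : x < half ⊎ half ≤ x → answer low half x ≡ 1
    decided (inj₂ half≤x) = ⊥-elim (ℤₚ.<⇒≱ low<signed (ℤₚ.≤-trans (signed-high half≤x x<) (ℤ.+≤+ z≤n)))
    decided (inj₁ x<half) rewrite <ᵇ-true x<half
                          | <ᵇ-false (<⇒≤ (ℤₚ.drop‿+<+ (subst (pos low ℤ.<_) (signed-low x<half) low<signed))) = refl

-- The reduction

RankSolver : (μ κ : ℝ) → Prog → (c C d : ℕ) → Set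
RankSolver μ κ P c C d =
  ∀ {σ N m} (G : SLG σ) (T : Vec (Fin σ) N) (Q : Vec (Query N σ) m) →
  Generates G T → 1 ≤ N → κ · N ^ᴿ (μ /3) ≤ σ →
  let w = c * bits (grammarSize G + σ + m + N) in
  ∃[ t ] ∃[ out ]
    Run w P (encodeRank G Q) t out ×
    t ≤ C * ((grammarSize G + m) * bits N ^ d) ×
    (∀ (i : Fin m) k → ⌊ N ^ᴿ (1ᴿ- μ) ⌋≡ k →
     AdditiveApprox k (rank T (lookup Q i)) (signed w (out (toℕ i))))

module Reduction (μ κ : ℝ) (0<μ : 0ℚ <ᴿ μ) (μ<1 : μ ᴿ< 1ℚ) {P : Prog} {c′ C d : ℕ} (1≤c′ : 1 ≤ c′)
                 (solver : RankSolver μ κ P c′ C d) {q u e K c : ℕ}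
                 (gap : 1ᴿ- μ ᴿ< (pos q ℚ./ suc q)) (u≡ : u ≡ proj₁ (upper-bound κ))
                 (e≡ : e ≡ 4 * suc q) (K≡ : K ≡ e + (10 + u)) (c≡ : c ≡ c′ * K)
                 {n : ℕ} (A B : BoolMatrix n) .{{_ : NonZero n}} where

  private
    b : ℕ
    b = bits n

    α β : ℕ → ℕ → Bool
    α = extend A
    β = extend B

    open Bounds n b q u c′ e K c (s≤s z≤n) (n<2^bits n) 1≤c′ e≡ K≡ c≡ using (w; n<σ)
    module Sizes = Bounds n b q u c′ e K c (s≤s z≤n) (n<2^bits n) 1≤c′ e≡ K≡ c≡
    module Gram = Grammar n b c K e α β n<σ
    open Parameters n b c K e

  -- The word length is a variable, so that the run, its bounds and its answers can be transported
  -- together along the equality of word lengths `word≡`.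
  Solved : ℕ → Set
  Solved w = ∃[ t ] ∃[ out ] Run w P (target α β) t out ×
    t ≤ C * ((Sizes.size + n * n) * bits Sizes.N ^ d) ×
    (∀ (i : Fin (n * n)) k → ⌊ Gram.N ^ᴿ (1ᴿ- μ) ⌋≡ k
     → AdditiveApprox k (rank Gram.string (lookup Gram.queries i)) (signed w (out (toℕ i))))

  solved : Solved w
  solved = subst Solved word≡ answers
    where
    word≡ : c′ * bits (grammarSize Gram.grammar + σ + n * n + Gram.N) ≡ w
    word≡ = trans (cong (c′ *_) (trans (cong₂ (λ s N → bits (s + σ + n * n + N)) Gram.size≡ Gram.N≡) Sizes.bits-total)) Sizes.w≡
    large : κ · Gram.N ^ᴿ (μ /3) ≤ σ
    large = large-alphabet μ κ μ<1 (subst (1 ≤_) (sym Gram.N≡) Sizes.1≤N)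
      (subst₂ (λ N u → N * u ≤ σ) (sym Gram.N≡) u≡ Sizes.N*u≤σ)
    answers : Solved (c′ * bits (grammarSize Gram.grammar + σ + n * n + Gram.N))
    answers = let t , out , run₀ , t≤ , approx = solver Gram.grammar Gram.string Gram.queries Gram.generates
                   (subst (1 ≤_) (sym Gram.N≡) Sizes.1≤N) large
             in t , out , subst (λ xs → Run (c′ * bits (grammarSize Gram.grammar + σ + n * n + Gram.N)) P xs t out) Gram.encode≡target run₀
              , subst₂ (λ s N → t ≤ C * ((s + n * n) * bits N ^ d)) Gram.size≡ Gram.N≡ t≤
              , approx

  private
    input : List ℕ
    input = encodeMatrices A B

    open RAM w using (wrap; cell; wrap-id)

    n<2^w : n < 2 ^ w
    n<2^w = Sizes.≤32y⇒< (Sizes.≤y⇒≤32y Sizes.n≤y)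

    wrap-bit : ∀ β → wrap (bit β) ≡ bit β
    wrap-bit β = wrap-id (≤-<-trans (bit≤1 β) (≤-<-trans (>-nonZero⁻¹ n) n<2^w))

    bitLength≡ : ∀ m .{{_ : NonZero m}} → bitLength m ≡ bits m
    bitLength≡ (suc m) = refl

    input-α : ∀ k x → k < n → x < n → wrap (cell input (1 + (n * k + x))) ≡ bit (α k x)
    input-α k x k< x< = trans (cong wrap (cell-entries w A (entries B) k x k< x<)) (wrap-bit (α k x))

    input-β : ∀ k x → k < n → x < n → wrap (cell input (1 + n * n + (n * k + x))) ≡ bit (β k x)
    input-β k x k< x< = trans (cong wrap (begin
      cell (entries A ++ entries B) (n * n + (n * k + x))
        ≡⟨ cong₂ cell (cong (entries A ++_) (sym (++-identityʳ (entries B)))) (cong (_+ (n * k + x)) (sym (length-entries A))) ⟩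
      cell (entries A ++ entries B ++ []) (length (entries A) + (n * k + x))
        ≡⟨ cell-++ʳ w (entries A) (n * k + x) ⟩
      cell (entries B ++ []) (n * k + x)
        ≡⟨ cell-entries w B [] k x k< x< ⟩
      bit (β k x) ∎)) (wrap-bit (β k x))
      where open ≡-Reasoning

    -- The input has 1 + 2n² cells and `area` is at least 1 + 3n², so the pushing starts behind the
    -- input, in front of untouched zeros.
    input-0 : ∀ i → wrap (cell input (area + i)) ≡ 0
    input-0 i = trans (cong wrap (cell-outside w input (area + i) (begin
      suc (length (entries A ++ entries B))          ≡⟨ cong suc (length-++ (entries A)) ⟩
      suc (length (entries A) + length (entries B))  ≡⟨ cong suc (cong₂ _+_ (length-entries A) (length-entries B)) ⟩
      suc (n * n + n * n)                            ≡⟨ sym (+-comm (n * n + n * n) 1) ⟩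
      n * n + n * n + 1                              ≤⟨ +-mono-≤ (≤-trans (≤-reflexive (trans (cong (n * n +_) (sym (+-identityʳ (n * n)))) (*-comm 2 (n * n))))
                                                          (*-monoʳ-≤ (n * n) (s≤s (s≤s z≤n)))) (s≤s z≤n) ⟩
      area                                           ≤⟨ m≤m+n area i ⟩
      area + i                                       ∎)))
      (wrap-id (≤-<-trans z≤n n<2^w))
      where open ≤-Reasoning

    2^levels≡ : 2 ^ levels ≡ 2 * repeats
    2^levels≡ = cong (2 ^_) (+-comm (b * e) 1)

  answer-correct : ∀ i j {x} → x < 2 ^ w → ∀ k → ⌊ Gram.N ^ᴿ (1ᴿ- μ) ⌋≡ k →
    AdditiveApprox k (rank Gram.string (Gram.queryOf (n * toℕ i + toℕ j))) (signed w x) →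
    answer repeats half x ≡ bit ((A ⊗ B) i j)
  answer-correct i j {x} x< k (k≤ , _) approx = decided _ refl
    where
    k≤repeats : k ≤ repeats
    -- By `gap` the rational q/(1+q) lies above 1 - μ, so k ≤ N^(1-μ) gives k^(1+q) ≤ N^q.
    k≤repeats = Sizes.approximation≤repeats k (subst (λ N → k ^ suc q ≤ N ^ q) Gram.N≡ (k≤ q q gap))
    approx′ : AdditiveApprox k (2 ^ levels * count (toℕ j) (Gram.rowA (toℕ i))) (signed w x)
    approx′ = subst (λ r → AdditiveApprox k r (signed w x))
      (Gram.rank-query (toℕ i) (toℕ j) (Finₚ.toℕ<n i) (Finₚ.toℕ<n j)) approx
    term≡ : ∀ k → α (toℕ i) k ∧ β k (toℕ j) ≡ A i (k modulo n) ∧ B (k modulo n) j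
    term≡ k = cong₂ (λ i j → A i (k modulo n) ∧ B (k modulo n) j) (modulo-toℕ i) (modulo-toℕ j)
    decided : ∀ v → (A ⊗ B) i j ≡ v → answer repeats half x ≡ bit ((A ⊗ B) i j)
    decided false AB≡ = trans (answer-zero {w} {half} Sizes.2half≡ {k} {repeats} {x} k≤repeats
      (subst (λ r → AdditiveApprox k r (signed w x)) (trans (cong (2 ^ levels *_) count≡0) (*-zeroʳ (2 ^ levels))) approx′))
      (cong bit (sym AB≡))
      where
      count≡0 : count (toℕ j) (Gram.rowA (toℕ i)) ≡ 0
      count≡0 = Gram.count-zero (Finₚ.toℕ<n j) λ k _ → trans (term≡ k) (or-false n AB≡ (k modulo n))
    decided true AB≡ = trans (answer-one {w} {half} Sizes.2half≡ {k} {repeats} {x = x} k≤repeats (begin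
      2 * repeats                                    ≡⟨ sym 2^levels≡ ⟩
      2 ^ levels                                     ≡⟨ sym (*-identityʳ _) ⟩
      2 ^ levels * 1                                 ≤⟨ *-monoʳ-≤ (2 ^ levels) count≥1 ⟩
      2 ^ levels * count (toℕ j) (Gram.rowA (toℕ i))   ∎) x< approx′) (cong bit (sym AB≡))
      where
      open ≤-Reasoning
      count≥1 : 1 ≤ count (toℕ j) (Gram.rowA (toℕ i))
      count≥1 = let l , term = or-true n AB≡ in
        Gram.count-positive {k = toℕ l} (Finₚ.toℕ<n j) (Finₚ.toℕ<n l)
          (trans (term≡ (toℕ l)) (trans (cong (λ l → A i l ∧ B l j) (modulo-toℕ l)) term))

  Product : Set
  Product = ∃[ t ] ∃[ out ] Run w (algorithm P c K e) input t out ×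
    t ≤ timeFactor e C d * (n ^ 2 * b ^ suc d) ×
    (∀ i j → out (n * toℕ i + toℕ j) ≡ bit ((A ⊗ B) i j))

  product-from : ∀ {t₀ out₀} (run₀ : Run w P (target α β) t₀ out₀) →
    t₀ ≤ C * ((Sizes.size + n * n) * bits Sizes.N ^ d) →
    (∀ (i : Fin (n * n)) k → ⌊ Gram.N ^ᴿ (1ᴿ- μ) ⌋≡ k
     → AdditiveApprox k (rank Gram.string (lookup Gram.queries i)) (signed w (out₀ (toℕ i)))) → Product
  product-from {t₀} {out₀} run₀ t₀≤ approx =
    let
      out₀< , t , out , run , t≤ , out≡ = algorithm-ok w n b c K e input (Sizes.fits _) α β
        (wrap-id n<2^w) (bitLength≡ n) input-α input-β input-0 {P} {t₀} {out₀} run₀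
    in t , out , run , Sizes.total-time C d t₀≤ t≤ , λ i j →
      let index≡ = Finₚ.toℕ-combine i j in
      trans (out≡ _ (subst (_< n * n) index≡ (Finₚ.toℕ<n (Fin.combine i j))))
        (decidable-stable (_ ≟ _) λ ¬correct →
          -- `0<μ` also proves that 1 - μ is below 1, because 1 - 1 evaluates to 0 in the definition
          -- of `1ᴿ-_`.
          floor-exists (1ᴿ- μ) Gram.N 0<μ λ (k , floor) → ¬correct (answer-correct i j (out₀< _) k floor
            (subst (λ z → AdditiveApprox k (rank Gram.string (Gram.queryOf z)) (signed w (out₀ z))) index≡
              (subst (λ Q → AdditiveApprox k (rank Gram.string Q) (signed w (out₀ (toℕ (Fin.combine i j)))))
                (Vecₚ.lookup∘tabulate (Gram.queryOf ∘ toℕ) (Fin.combine i j)) (approx (Fin.combine i j) k floor)))))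

  multiplied : Product
  multiplied = let t₀ , out₀ , run₀ , t₀≤ , approx = solved in product-from run₀ t₀≤ approx

theorem1p5 : (μ : ℝ) → 0ℚ <ᴿ μ → μ ᴿ< 1ℚ →
    (κ : ℝ) → 0ℚ <ᴿ κ →
    ApproxRankAlgorithm μ κ → FastBooleanMatrixProduct
theorem1p5 μ 0<μ μ<1 κ _ (P , c′ , C , d , 1≤c′ , solver) =
  let q , gap = positive-gap μ 0<μ
      u = proj₁ (upper-bound κ)
      e = 4 * suc q
      K = e + (10 + u)
  in algorithm P (c′ * K) K e , c′ * K , timeFactor e C d , suc d
   , ≤-trans 1≤c′ (m≤m*n c′ K)
   , λ A B 1≤n → Reduction.multiplied μ κ 0<μ μ<1 {P} {c′} {C} {d} 1≤c′ solver {q} {u} {e} {K} {c′ * K} gap refl refl refl refl A B {{>-nonZero 1≤n}}
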